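{- Let $n\ge 2$, $X=\{x_1,\ldots,x_n\}$, and \[ B_{n,n-1}(X)=\prod_{S\subseteq[n],\,|S|=n-1}\ \sum_{i\in S}x_i . \] Then \[ B_{n,n-1}(X)=\sum_{\lambda\vdash n} a_\lambda\, s_\lambda(x_1,\ldots,x_n), \] where $a_\lambda$ is the number of standard Young tableaux $T$ of shape $\lambda$ whose smallest ascent is an even number.
   Context: Young diagrams are drawn in French notation: row $i$ (counted from the bottom) has $\lambda_i$ boxes. A standard Young tableau of shape $\lambda\vdash n$ is a filling of the diagram with the numbers $1,\ldots,n$, each used once, increasing along rows (left to right) and up columns (bottom to top). An entry $i$ of a standard Young tableau $T$ is a descent if $i+1$ lies in a row strictly above the row containing $i$; otherwise $i$ is an ascent (in particular the entry $n$ is always an ascent). $s_\lambda(x_1,\ldots,x_n)$ is the Schur polynomial in $n$ variables. -}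

module Defs where

open import Data.Nat.Base using (ℕ; zero; suc; _+_; _*_; _∸_; _≡ᵇ_; _<ᵇ_; _≤ᵇ_)
open import Data.Bool.Base using (Bool; true; false; _∧_; not; if_then_else_)
open import Data.List.Base
  using (List; []; _∷_; [_]; map; concatMap; length; filterᵇ; upTo; allFin; foldr; concat)
open import Data.Nat.ListAction using (sum)
open import Data.Maybe.Base using (Maybe; just; nothing)
open import Data.Vec.Base as V using (Vec)
open import Data.Fin.Base using (Fin; toℕ)
open import Data.Fin.Subset using (Subset; ∣_∣)
open import Relation.Binary.PropositionalEquality using (_≡_)

listsOf : {A : Set} → ℕ → List A → List (List A)
listsOf zero    xs = [ [] ]
listsOf (suc k) xs = concatMap (λ x → map (x ∷_) (listsOf k xs)) xs

allᵇ : {A : Set} → (A → Bool) → List A → Bool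
allᵇ p [] = true
allᵇ p (x ∷ xs) = p x ∧ allᵇ p xs

range1 : ℕ → List ℕ
range1 n = map suc (upTo n)

countℕ : ℕ → List ℕ → ℕ
countℕ v xs = length (filterᵇ (λ y → y ≡ᵇ v) xs)

-- Polynomials in x_1,...,x_n with natural-number coefficients,
-- represented by their coefficient function: exponent vector ↦ coefficient.
-- The variable x_{i+1} corresponds to  i : Fin n.

Mon : ℕ → Set
Mon n = Vec ℕ n

Poly : ℕ → Set
Poly n = Mon n → ℕ

eqVecᵇ : ∀ {n} → Vec ℕ n → Vec ℕ n → Bool
eqVecᵇ V.[] V.[] = true
eqVecᵇ (a V.∷ as) (b V.∷ bs) = (a ≡ᵇ b) ∧ eqVecᵇ as bs

below : ∀ {n} → Mon n → List (Mon n)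
below V.[] = [ V.[] ]
below (a V.∷ α) = concatMap (λ b → map (b V.∷_) (below α)) (upTo (suc a))

zeroP : ∀ {n} → Poly n
zeroP α = 0

oneP : ∀ {n} → Poly n
oneP α = if eqVecᵇ α (V.replicate _ 0) then 1 else 0

var : ∀ {n} → Fin n → Poly n
var {n} i α = if eqVecᵇ α (V.tabulate (λ j → if toℕ j ≡ᵇ toℕ i then 1 else 0)) then 1 else 0

_+P_ : ∀ {n} → Poly n → Poly n → Poly n
(f +P g) α = f α + g α

_*P_ : ∀ {n} → Poly n → Poly n → Poly n
(f *P g) α = sum (map (λ β → f β * g (V.zipWith _∸_ α β)) (below α))

scaleP : ∀ {n} → ℕ → Poly n → Poly n
scaleP k f α = k * f α

sumP : ∀ {n} → List (Poly n) → Poly n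
sumP = foldr _+P_ zeroP

prodP : ∀ {n} → List (Poly n) → Poly n
prodP = foldr _*P_ oneP

_≈P_ : ∀ {n} → Poly n → Poly n → Set
f ≈P g = ∀ α → f α ≡ g α

allSubsets : ∀ n → List (Subset n)
allSubsets zero = [ V.[] ]
allSubsets (suc n) = concatMap (λ b → map (b V.∷_) (allSubsets n)) (true ∷ false ∷ [])

sumOver : ∀ {n} → Subset n → Poly n
sumOver {n} S = sumP (map var (filterᵇ (λ i → V.lookup S i) (allFin n)))

B : ∀ n → Poly n
B n = prodP (map sumOver (filterᵇ (λ S → ∣ S ∣ ≡ᵇ n ∸ 1) (allSubsets n)))

-- Partitions: λ = (λ₁ ≥ λ₂ ≥ … ≥ λ_k > 0), listed from the bottom row.

weaklyDecᵇ : List ℕ → Bool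
weaklyDecᵇ (a ∷ b ∷ xs) = (b ≤ᵇ a) ∧ weaklyDecᵇ (b ∷ xs)
weaklyDecᵇ _ = true

isPartitionOfᵇ : ℕ → List ℕ → Bool
isPartitionOfᵇ n la = (sum la ≡ᵇ n) ∧ allᵇ (λ p → 0 <ᵇ p) la ∧ weaklyDecᵇ la

-- all partitions of n (every partition of n has at most n parts, each ≤ n)
partitions : ℕ → List (List ℕ)
partitions n =
  filterᵇ (isPartitionOfᵇ n) (concatMap (λ k → listsOf k (upTo (suc n))) (upTo (suc n)))

-- Fillings of a Young diagram (French notation): list of rows, bottom
-- row first; row i has λ_i entries, read left to right.

Filling : Set
Filling = List (List ℕ)

fillings : List ℕ → List ℕ → List Filling
fillings [] vals = [ [] ]
fillings (l ∷ la) vals = concatMap (λ r → map (r ∷_) (fillings la vals)) (listsOf l vals)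

rowWeakᵇ : List ℕ → Bool
rowWeakᵇ (a ∷ b ∷ xs) = (a ≤ᵇ b) ∧ rowWeakᵇ (b ∷ xs)
rowWeakᵇ _ = true

rowStrictᵇ : List ℕ → Bool
rowStrictᵇ (a ∷ b ∷ xs) = (a <ᵇ b) ∧ rowStrictᵇ (b ∷ xs)
rowStrictᵇ _ = true

strictBelowᵇ : List ℕ → List ℕ → Bool
strictBelowᵇ (a ∷ as) (b ∷ bs) = (a <ᵇ b) ∧ strictBelowᵇ as bs
strictBelowᵇ _ [] = true
strictBelowᵇ [] (_ ∷ _) = false

colsStrictᵇ : Filling → Bool
colsStrictᵇ (r ∷ r' ∷ rs) = strictBelowᵇ r r' ∧ colsStrictᵇ (r' ∷ rs)
colsStrictᵇ _ = true

isSSYTᵇ : Filling → Bool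
isSSYTᵇ T = allᵇ rowWeakᵇ T ∧ colsStrictᵇ T

content : ∀ n → Filling → Mon n
content n T = V.tabulate (λ i → countℕ (suc (toℕ i)) (concat T))

schur : ∀ n → List ℕ → Poly n
schur n la α =
  length (filterᵇ (λ T → isSSYTᵇ T ∧ eqVecᵇ (content n T) α) (fillings la (range1 n)))

isSYTᵇ : ℕ → Filling → Bool
isSYTᵇ m T = allᵇ (λ v → countℕ v (concat T) ≡ᵇ 1) (range1 m) ∧ allᵇ rowStrictᵇ T ∧ colsStrictᵇ T

memᵇ : ℕ → List ℕ → Bool
memᵇ v xs = 0 <ᵇ countℕ v xs

rowOf : ℕ → Filling → Maybe ℕ
rowOf v [] = nothing
rowOf v (r ∷ rs) = if memᵇ v r then just 0 else go (rowOf v rs)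
  where
  go : Maybe ℕ → Maybe ℕ
  go (just k) = just (suc k)
  go nothing = nothing

isDescentᵇ : Filling → ℕ → Bool
isDescentᵇ T i = cmp (rowOf i T) (rowOf (suc i) T)
  where
  cmp : Maybe ℕ → Maybe ℕ → Bool
  cmp (just r) (just r') = r <ᵇ r'
  cmp _ _ = false

isAscentᵇ : Filling → ℕ → Bool
isAscentᵇ T i = not (isDescentᵇ T i)

firstᵇ : (ℕ → Bool) → List ℕ → Maybe ℕ
firstᵇ p [] = nothing
firstᵇ p (x ∷ xs) = if p x then just x else firstᵇ p xs

evenᵇ : ℕ → Bool
evenᵇ zero = true
evenᵇ (suc k) = not (evenᵇ k)

smallestAscent : ℕ → Filling → Maybe ℕ
smallestAscent m T = firstᵇ (isAscentᵇ T) (range1 m)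

smallestAscentEvenᵇ : ℕ → Filling → Bool
smallestAscentEvenᵇ m T with smallestAscent m T
... | just i = evenᵇ i
... | nothing = false

aCoeff : ℕ → List ℕ → ℕ
aCoeff n la =
  length (filterᵇ (λ T → isSYTᵇ n T ∧ smallestAscentEvenᵇ n T) (fillings la (range1 n)))

{-# OPTIONS --safe #-}

-- With e_k the elementary symmetric polynomials and p = x₁ + ⋯ + xₙ, the product is
--   ∏ᵢ (p − xᵢ) = Σ_{k ≤ n} (−1)ᵏ e_k p^{n−k},
-- the diagonal value of E(j, m) = Σ_{k ≤ m} (−1)ᵏ e_k(x₁, …, x_j) p^{m−k}, which satisfies
-- E(j + 1, m + 1) = E(j, m + 1) − x_{j+1} E(j, m).
--
-- On the other side let a_m(λ) be the sum, over the standard tableaux T of shape λ ⊢ m, of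
-- Σ_{k ≤ m} (−1)ᵏ [1, …, k − 1 are descents of T]; this is the number of those with an even
-- smallest ascent.  Removing the box of m + 1 gives
--   a_{m+1}(λ) = Σ_{μ = λ − box} a_m(μ) + (−1)^{m+1} [λ = 1^{m+1}].
-- By Pieri's rule p s_μ = Σ_{λ = μ + box} s_λ and by s_{1^k} = e_k, the polynomials
-- Σ_λ a_m(λ) s_λ satisfy the recursion in m of E(n, m).
--
-- Pieri's rule is proved by induction on the number of variables: stripping the largest letter
-- gives s_λ(x₁, …, xₙ) = Σ_μ s_μ(x₁, …, xₙ₋₁) xₙ^{|λ| − |μ|} over the horizontal strips λ/μ, and
-- adding a box commutes with removing a horizontal strip up to one extra term, the box added
-- to the first row.
module Submission where

-- The alternating sum detects even smallest ascents because its bracket is 1 exactly for `k ≤ i`,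
-- where `i` is the smallest ascent, and `1 − 1 + ⋯ ± 1` with `i + 1` terms is `[i even]`. Truncated
-- at `m`, it does not look at the letter `m + 1`, so it is compatible with removing that letter.
-- The obstacle is the bookkeeping of shapes. They are taken as sequences of fixed length with
-- bounded entries, partitions being padded by zeros. Boxes are added and removed in every row, and
-- whatever is not a partition drops out because it carries no tableau. All sums over shapes then
-- run over a fixed finite box, where the order of summation can be exchanged. A size `m < n` leaves
-- an empty row for the box that Pieri's rule adds. One weighted sum over the tableaux of given
-- content, `ssytSum`, covers both the Schur coefficients and `a_m`, so the largest letter has to be
-- peeled off only once.

open import Defs
open import Data.Nat.Base using (ℕ; zero; suc; _≤_; _<_; z≤n; s≤s; _∸_; _≡ᵇ_; _<ᵇ_; _≤ᵇ_)
import Data.Nat.Base as ℕ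
import Data.Nat.Properties as ℕₚ
open import Data.Nat.ListAction using (sum)
open import Data.Integer.Base as ℤ using (ℤ; +_; 0ℤ; 1ℤ)
import Data.Integer.Properties as ℤₚ
open import Data.Integer.Tactic.RingSolver using (solve-∀)
open import Data.Nat.Tactic.RingSolver using () renaming (solve-∀ to ℕsolve-∀)
open import Data.Bool.Base using (Bool; true; false; _∧_; not; if_then_else_; T)
import Data.Bool.Properties as Bₚ
open import Data.List.Base
  using (List; []; _∷_; map; concatMap; length; filterᵇ; upTo; downFrom; allFin; tabulate; concat; _++_; replicate)
import Data.List.Properties as Lₚ
open import Data.List.Relation.Unary.All as All using (All; []; _∷_)
import Data.List.Relation.Unary.All.Properties as Allₚ
open import Data.Maybe.Base as Maybe using (Maybe; just; nothing)
open import Data.Vec.Base as V using (Vec)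
import Data.Vec.Properties as Vₚ
open import Data.Fin.Base as F using (Fin; toℕ)
open import Data.Fin.Subset using (Subset; ∣_∣)
open import Data.Fin.Subset.Properties using (∣p∣≤n)
open import Data.Product.Base using (_×_; _,_; proj₁; proj₂; ∃)
open import Data.Sum.Base using (inj₁; inj₂)
open import Data.Empty using (⊥; ⊥-elim)
open import Data.Unit.Base using (tt)
open import Function.Base using (_∘_; id)
open import Relation.Nullary using (yes; no; ¬_)
open import Relation.Binary.Definitions using (tri<; tri≈; tri>)
open import Relation.Binary.PropositionalEquality
open ≡-Reasoning

-- Opaque copies of the operations of ℤ: the originals unfold to a case analysis
-- on signs, which prevents unification from recovering the factors of a product.
infixl 6 _+_
infixl 7 _*_
infix 8 -_

opaque

  _+_ _*_ : ℤ → ℤ → ℤ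
  _+_ = ℤ._+_
  _*_ = ℤ._*_

  -_ : ℤ → ℤ
  -_ = ℤ.-_

opaque
  unfolding _+_

  +-identityˡ : ∀ x → 0ℤ + x ≡ x
  +-identityˡ = ℤₚ.+-identityˡ

  +-identityʳ : ∀ x → x + 0ℤ ≡ x
  +-identityʳ = ℤₚ.+-identityʳ

  +-assoc : ∀ x y z → x + y + z ≡ x + (y + z)
  +-assoc = ℤₚ.+-assoc

  +-comm : ∀ x y → x + y ≡ y + x
  +-comm = ℤₚ.+-comm

  *-identityˡ : ∀ x → 1ℤ * x ≡ x
  *-identityˡ = ℤₚ.*-identityˡ

  *-identityʳ : ∀ x → x * 1ℤ ≡ x
  *-identityʳ = ℤₚ.*-identityʳ

  *-zeroˡ : ∀ x → 0ℤ * x ≡ 0ℤ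
  *-zeroˡ = ℤₚ.*-zeroˡ

  *-zeroʳ : ∀ x → x * 0ℤ ≡ 0ℤ
  *-zeroʳ = ℤₚ.*-zeroʳ

  *-assoc : ∀ x y z → x * y * z ≡ x * (y * z)
  *-assoc = ℤₚ.*-assoc

  *-comm : ∀ x y → x * y ≡ y * x
  *-comm = ℤₚ.*-comm

  *-distribˡ-+ : ∀ x y z → x * (y + z) ≡ x * y + x * z
  *-distribˡ-+ = ℤₚ.*-distribˡ-+

  pos-+ : ∀ m n → + (m ℕ.+ n) ≡ + m + + n
  pos-+ m n = refl

  pos-* : ∀ m n → + (m ℕ.* n) ≡ + m * + n
  pos-* m n = ℤₚ.pos-* m n

  +-interchange : ∀ a b c d → a + b + (c + d) ≡ a + c + (b + d)
  +-interchange = solve-∀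

  *-swapˡ : ∀ a b c → a * (b * c) ≡ b * (a * c)
  *-swapˡ = solve-∀

-- Truth values as integers, and Boolean comparisons.

⟦_⟧ : Bool → ℤ
⟦ true ⟧ = 1ℤ
⟦ false ⟧ = 0ℤ

⟦∧⟧ : ∀ a b → ⟦ a ∧ b ⟧ ≡ ⟦ a ⟧ * ⟦ b ⟧
⟦∧⟧ true b = sym (*-identityˡ ⟦ b ⟧)
⟦∧⟧ false b = sym (*-zeroˡ ⟦ b ⟧)

⟦∧⟧* : ∀ a b x → ⟦ a ∧ b ⟧ * x ≡ ⟦ a ⟧ * (⟦ b ⟧ * x)
⟦∧⟧* a b x = trans (cong (_* x) (⟦∧⟧ a b)) (*-assoc ⟦ a ⟧ ⟦ b ⟧ x)

T⇒≡ : ∀ {b} → T b → b ≡ true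
T⇒≡ {true} _ = refl

≡⇒T : ∀ {b} → b ≡ true → T b
≡⇒T refl = tt

∧-true : ∀ {a b} → a ∧ b ≡ true → a ≡ true × b ≡ true
∧-true {true} p = refl , p

∧-intro : ∀ {a b} → a ≡ true → b ≡ true → a ∧ b ≡ true
∧-intro refl q = q

≡-of-true : ∀ {a b} → (a ≡ true → b ≡ true) → (b ≡ true → a ≡ true) → a ≡ b
≡-of-true {true} f g = sym (f refl)
≡-of-true {false} {true} f g = g refl
≡-of-true {false} {false} f g = refl

≤⇒≤ᵇ : ∀ {m n} → m ≤ n → (m ≤ᵇ n) ≡ true
≤⇒≤ᵇ p = T⇒≡ (ℕₚ.≤⇒≤ᵇ p)

≤ᵇ⇒≤ : ∀ m n → (m ≤ᵇ n) ≡ true → m ≤ n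
≤ᵇ⇒≤ m n p = ℕₚ.≤ᵇ⇒≤ m n (≡⇒T p)

<⇒<ᵇ : ∀ {m n} → m < n → (m <ᵇ n) ≡ true
<⇒<ᵇ p = T⇒≡ (ℕₚ.<⇒<ᵇ p)

<ᵇ⇒< : ∀ m n → (m <ᵇ n) ≡ true → m < n
<ᵇ⇒< m n p = ℕₚ.<ᵇ⇒< m n (≡⇒T p)

≡ᵇ⇒≡ : ∀ m n → (m ≡ᵇ n) ≡ true → m ≡ n
≡ᵇ⇒≡ m n p = ℕₚ.≡ᵇ⇒≡ m n (≡⇒T p)

≡⇒≡ᵇ : ∀ {m n} → m ≡ n → (m ≡ᵇ n) ≡ true
≡⇒≡ᵇ {m} {n} p = T⇒≡ (ℕₚ.≡⇒≡ᵇ m n p)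

≢true : ∀ {b} → ¬ b ≡ true → b ≡ false
≢true {true} p = ⊥-elim (p refl)
≢true {false} p = refl

>⇒≤ᵇ : ∀ {m n} → n < m → (m ≤ᵇ n) ≡ false
>⇒≤ᵇ {m} {n} p = ≢true (λ q → ℕₚ.<⇒≱ p (≤ᵇ⇒≤ m n q))

≥⇒<ᵇ : ∀ {m n} → n ≤ m → (m <ᵇ n) ≡ false
≥⇒<ᵇ {m} {n} p = ≢true (λ q → ℕₚ.≤⇒≯ p (<ᵇ⇒< m n q))

≢⇒≡ᵇ : ∀ {m n} → ¬ m ≡ n → (m ≡ᵇ n) ≡ false
≢⇒≡ᵇ {m} {n} p = ≢true (λ q → p (≡ᵇ⇒≡ m n q))

-- Not definitional for a variable `m`: the left side unfolds to `m <ᵇ suc n`, which is stuck until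
-- `m` is a constructor.
≤ᵇ-suc : ∀ m n → (suc m ≤ᵇ suc n) ≡ (m ≤ᵇ n)
≤ᵇ-suc zero n = refl
≤ᵇ-suc (suc m) n = refl

-- Finite sums of integers.

opaque

  ∑ : {A : Set} → List A → (A → ℤ) → ℤ
  ∑ [] f = 0ℤ
  ∑ (x ∷ xs) f = f x + ∑ xs f

infix 8 ∑
syntax ∑ xs (λ x → e) = ∑[ x ← xs ] e

opaque
  unfolding ∑ _+_

  ∑-[] : ∀ {A : Set} {f : A → ℤ} → ∑ [] f ≡ 0ℤ
  ∑-[] = refl

  ∑-∷ : ∀ {A : Set} {x : A} {xs f} → ∑ (x ∷ xs) f ≡ f x + ∑ xs f
  ∑-∷ = refl

  ∑-[x] : ∀ {A : Set} {x : A} {f} → ∑ (x ∷ []) f ≡ f x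
  ∑-[x] = +-identityʳ _

  ∑-cong : ∀ {A : Set} (xs : List A) {f g} → (∀ x → f x ≡ g x) → ∑ xs f ≡ ∑ xs g
  ∑-cong [] p = refl
  ∑-cong (x ∷ xs) p = cong₂ _+_ (p x) (∑-cong xs p)

  ∑-congAll : ∀ {A : Set} {xs : List A} {P : A → Set} {f g} →
              All P xs → (∀ x → P x → f x ≡ g x) → ∑ xs f ≡ ∑ xs g
  ∑-congAll [] p = refl
  ∑-congAll (q ∷ qs) p = cong₂ _+_ (p _ q) (∑-congAll qs p)

  ∑-0 : ∀ {A : Set} (xs : List A) {f} → (∀ x → f x ≡ 0ℤ) → ∑ xs f ≡ 0ℤ
  ∑-0 [] p = refl
  ∑-0 (x ∷ xs) p = cong₂ _+_ (p x) (∑-0 xs p)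

  ∑-0All : ∀ {A : Set} {xs : List A} {P : A → Set} {f} →
           All P xs → (∀ x → P x → f x ≡ 0ℤ) → ∑ xs f ≡ 0ℤ
  ∑-0All [] p = refl
  ∑-0All (q ∷ qs) p = cong₂ _+_ (p _ q) (∑-0All qs p)

  ∑-++ : ∀ {A : Set} (xs ys : List A) {f} → ∑ (xs ++ ys) f ≡ ∑ xs f + ∑ ys f
  ∑-++ [] ys = sym (+-identityˡ _)
  ∑-++ (x ∷ xs) ys {f} =
    trans (cong (_+_ (f x)) (∑-++ xs ys)) (sym (+-assoc (f x) (∑ xs f) (∑ ys f)))

  ∑-+ : ∀ {A : Set} (xs : List A) f g → ∑[ x ← xs ] (f x + g x) ≡ ∑ xs f + ∑ xs g
  ∑-+ [] f g = refl
  ∑-+ (x ∷ xs) f g = trans (cong (_+_ (f x + g x)) (∑-+ xs f g)) (+-interchange (f x) (g x) _ _)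

  ∑-*ˡ : ∀ {A : Set} (xs : List A) c f → ∑[ x ← xs ] (c * f x) ≡ c * ∑ xs f
  ∑-*ˡ [] c f = sym (*-zeroʳ c)
  ∑-*ˡ (x ∷ xs) c f =
    trans (cong (_+_ (c * f x)) (∑-*ˡ xs c f)) (sym (*-distribˡ-+ c (f x) (∑ xs f)))

  ∑-*ʳ : ∀ {A : Set} (xs : List A) c f → ∑[ x ← xs ] (f x * c) ≡ ∑ xs f * c
  ∑-*ʳ xs c f = trans (∑-cong xs (λ x → *-comm (f x) c)) (trans (∑-*ˡ xs c f) (*-comm c _))

  ∑-map : ∀ {A B : Set} (h : A → B) xs {f} → ∑ (map h xs) f ≡ ∑[ x ← xs ] f (h x)
  ∑-map h [] = refl
  ∑-map h (x ∷ xs) {f} = cong (_+_ (f (h x))) (∑-map h xs)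

  ∑-concatMap : ∀ {A B : Set} (h : A → List B) xs {f} →
                ∑ (concatMap h xs) f ≡ ∑[ x ← xs ] ∑ (h x) f
  ∑-concatMap h [] = refl
  ∑-concatMap h (x ∷ xs) = trans (∑-++ (h x) (concatMap h xs)) (cong (_+_ (∑ (h x) _)) (∑-concatMap h xs))

  ∑-swap : ∀ {A B : Set} (xs : List A) (ys : List B) (f : A → B → ℤ) →
           ∑[ x ← xs ] ∑[ y ← ys ] f x y ≡ ∑[ y ← ys ] ∑[ x ← xs ] f x y
  ∑-swap [] ys f = sym (∑-0 ys (λ _ → refl))
  ∑-swap (x ∷ xs) ys f =
    trans (cong (_+_ (∑ ys (f x))) (∑-swap xs ys f)) (sym (∑-+ ys (f x) (λ y → ∑ xs (λ x → f x y))))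

  ∑-cartesian : ∀ {A B C : Set} (c : A → B → C) (xs : List A) (ys : List B) {f} →
                ∑ (concatMap (λ x → map (c x) ys) xs) f ≡ ∑[ x ← xs ] ∑[ y ← ys ] f (c x y)
  ∑-cartesian c xs ys = trans (∑-concatMap _ xs) (∑-cong xs (λ x → ∑-map (c x) ys))

  ∑-filter : ∀ {A : Set} (p : A → Bool) xs f → ∑ (filterᵇ p xs) f ≡ ∑[ x ← xs ] (⟦ p x ⟧ * f x)
  ∑-filter p [] f = refl
  ∑-filter p (x ∷ xs) f with p x
  ... | true = cong₂ _+_ (sym (*-identityˡ (f x))) (∑-filter p xs f)
  ... | false = trans (∑-filter p xs f) (sym (+-identityˡ _))

  length-filter : ∀ {A : Set} (p : A → Bool) xs → + length (filterᵇ p xs) ≡ ∑[ x ← xs ] ⟦ p x ⟧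
  length-filter p [] = refl
  length-filter p (x ∷ xs) with p x
  ... | true = cong (_+_ 1ℤ) (length-filter p xs)
  ... | false = trans (length-filter p xs) (sym (+-identityˡ _))

∑-upTo-suc : ∀ n {f} → ∑ (upTo (suc n)) f ≡ f 0 + ∑[ m ← upTo n ] f (suc m)
∑-upTo-suc n {f} = trans ∑-∷ (cong (_+_ (f 0)) (trans (cong (λ z → ∑ z f) (sym (Lₚ.map-upTo suc n))) (∑-map suc (upTo n))))

∑-upTo-last : ∀ n {f} → ∑ (upTo (suc n)) f ≡ ∑ (upTo n) f + f n
∑-upTo-last n {f} = begin
  ∑ (upTo (suc n)) f            ≡⟨ cong (λ z → ∑ z f) (sym (Lₚ.upTo-∷ʳ n)) ⟩
  ∑ (upTo n ++ n ∷ []) f        ≡⟨ ∑-++ (upTo n) (n ∷ []) ⟩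
  ∑ (upTo n) f + ∑ (n ∷ []) f   ≡⟨ cong (_+_ (∑ (upTo n) f)) ∑-[x] ⟩
  ∑ (upTo n) f + f n            ∎

-- Trades a range that depends on `l` for a fixed range with an indicator, so that sums over shapes
-- can be interchanged.
∑-upTo-≤ : ∀ {l M} → l < M → ∀ f → ∑ (upTo (suc l)) f ≡ ∑[ m ← upTo M ] (⟦ m ≤ᵇ l ⟧ * f m)
∑-upTo-≤ {zero} {suc M} p f = begin
  ∑ (0 ∷ []) f   ≡⟨ ∑-[x] ⟩
  f 0            ≡⟨ +-identityʳ (f 0) ⟨
  f 0 + 0ℤ       ≡⟨ cong₂ _+_ (sym (*-identityˡ (f 0))) (sym (∑-0 (upTo M) (λ _ → *-zeroˡ _))) ⟩
  1ℤ * f 0 + ∑[ m ← upTo M ] (⟦ suc m ≤ᵇ 0 ⟧ * f (suc m)) ≡⟨ ∑-upTo-suc M ⟨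
  ∑[ m ← upTo (suc M) ] (⟦ m ≤ᵇ 0 ⟧ * f m)   ∎
∑-upTo-≤ {suc l} {suc M} (s≤s p) f = begin
  ∑ (upTo (suc (suc l))) f                ≡⟨ ∑-upTo-suc (suc l) ⟩
  f 0 + ∑[ m ← upTo (suc l) ] f (suc m)   ≡⟨ cong₂ _+_ (sym (*-identityˡ (f 0))) (∑-upTo-≤ p (f ∘ suc)) ⟩
  1ℤ * f 0 + ∑[ m ← upTo M ] (⟦ m ≤ᵇ l ⟧ * f (suc m))
    ≡⟨ cong (_+_ (1ℤ * f 0)) (∑-cong (upTo M) (λ m → cong (λ b → ⟦ b ⟧ * f (suc m)) (sym (≤ᵇ-suc m l)))) ⟩
  1ℤ * f 0 + ∑[ m ← upTo M ] (⟦ suc m ≤ᵇ suc l ⟧ * f (suc m)) ≡⟨ ∑-upTo-suc M ⟨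
  ∑[ m ← upTo (suc M) ] (⟦ m ≤ᵇ suc l ⟧ * f m)   ∎

range1-∷ʳ : ∀ n → range1 (suc n) ≡ range1 n ++ suc n ∷ []
range1-∷ʳ n = trans (cong (map suc) (sym (Lₚ.upTo-∷ʳ n))) (Lₚ.map-++ suc (upTo n) (n ∷ []))

∑-range1 : ∀ n f → ∑ (range1 (suc n)) f ≡ ∑ (range1 n) f + f (suc n)
∑-range1 n f = trans (∑-map suc (upTo (suc n))) (trans (∑-upTo-last n) (cong (_+ f (suc n)) (sym (∑-map suc (upTo n)))))

upTo-< : ∀ n → All (_< n) (upTo n)
upTo-< n = Allₚ.applyUpTo⁺₁ id n id

range1-≤ : ∀ n → All (_≤ n) (range1 n)
range1-≤ n = Allₚ.map⁺ (upTo-< n)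

listsOf-All : ∀ {A : Set} {P : A → Set} {xs} → All P xs → ∀ k →
              All (λ r → length r ≡ k × All P r) (listsOf k xs)
listsOf-All ps zero = (refl , []) ∷ []
listsOf-All {xs = xs} ps (suc k) =
  Allₚ.concat⁺ (Allₚ.map⁺ (All.map (λ {x} px → Allₚ.map⁺ (All.map (λ (l , a) → cong suc l , px ∷ a) (listsOf-All ps k))) ps))

-- Peeling off the largest letter of a semistandard tableau.

Box : ℕ → ℕ → List (List ℕ)
Box M R = listsOf R (upTo M)

∑-Box : ∀ M R {f} → ∑ (Box M (suc R)) f ≡ ∑[ m ← upTo M ] ∑[ mu ← Box M R ] f (m ∷ mu)
∑-Box M R = ∑-cartesian _∷_ (upTo M) (Box M R)

Box-All : ∀ M R → All (λ mu → length mu ≡ R × All (_< M) mu) (Box M R)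
Box-All M R = listsOf-All (upTo-< M) R

leqs : List ℕ → List ℕ → Bool
leqs (m ∷ mu) (l ∷ la) = (m ≤ᵇ l) ∧ leqs mu la
leqs [] [] = true
leqs _ _ = false

-- p ≥ λ₁ ≥ μ₁ ≥ λ₂ ≥ μ₂ ≥ ⋯, i.e. λ/μ is a horizontal strip and p bounds λ.
hsp : ℕ → List ℕ → List ℕ → Bool
hsp p (l ∷ la) (m ∷ mu) = (l ≤ᵇ p) ∧ (m ≤ᵇ l) ∧ hsp m la mu
hsp p [] [] = true
hsp p _ _ = false

-- Fills the boxes of la outside mu with the letter N.
ext : ℕ → List ℕ → List ℕ → Filling → Filling
ext N (l ∷ la) (m ∷ mu) (r ∷ T) = (r ++ replicate (l ∸ m) N) ∷ ext N la mu T
ext N _ _ _ = []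

data Fits (n : ℕ) : List ℕ → Filling → Set where
  []  : Fits n [] []
  _∷_ : ∀ {m mu r T} → length r ≡ m × All (_≤ n) r → Fits n mu T → Fits n (m ∷ mu) (r ∷ T)

fillings-Fits : ∀ n mu → All (Fits n mu) (fillings mu (range1 n))
fillings-Fits n [] = [] ∷ []
fillings-Fits n (m ∷ mu) =
  Allₚ.concat⁺ (Allₚ.map⁺ (All.map (λ p → Allₚ.map⁺ (All.map (p ∷_) (fillings-Fits n mu))) (listsOf-All (range1-≤ n) m)))

-- A dummy letter 0 gives `row-peel`, which remembers the entry before the row, a place to start.
rowWeak-0 : ∀ r → rowWeakᵇ (0 ∷ r) ≡ rowWeakᵇ r
rowWeak-0 [] = refl
rowWeak-0 (x ∷ r) = refl

-- After the largest letter a weakly increasing row can only repeat it, so a single row survives.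
row-top : ∀ n l (f : List ℕ → ℤ) → ∑[ r ← listsOf l (range1 (suc n)) ] (⟦ rowWeakᵇ (suc n ∷ r) ⟧ * f r) ≡ f (replicate l (suc n))
row-top n zero f = trans ∑-[x] (*-identityˡ (f []))
row-top n (suc l) f = begin
  ∑[ r ← listsOf (suc l) (range1 (suc n)) ] (⟦ rowWeakᵇ (suc n ∷ r) ⟧ * f r)
    ≡⟨ ∑-cartesian _∷_ (range1 (suc n)) (listsOf l (range1 (suc n))) ⟩
  ∑[ x ← range1 (suc n) ] rest x
    ≡⟨ ∑-range1 n _ ⟩
  ∑[ x ← range1 n ] rest x + rest (suc n)
    ≡⟨ cong₂ _+_ (∑-0All (range1-≤ n) (λ x x≤n → ∑-0 (listsOf l (range1 (suc n))) (λ r →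
         trans (cong (λ b → ⟦ b ∧ rowWeakᵇ (x ∷ r) ⟧ * f (x ∷ r)) (>⇒≤ᵇ (s≤s x≤n))) (*-zeroˡ _))))
       (∑-cong (listsOf l (range1 (suc n))) (λ r →
         cong (λ b → ⟦ b ∧ rowWeakᵇ (suc n ∷ r) ⟧ * f (suc n ∷ r)) (≤⇒≤ᵇ (ℕₚ.≤-refl {suc n})))) ⟩
  0ℤ + ∑[ r ← listsOf l (range1 (suc n)) ] (⟦ rowWeakᵇ (suc n ∷ r) ⟧ * f (suc n ∷ r))
    ≡⟨ +-identityˡ _ ⟩
  ∑[ r ← listsOf l (range1 (suc n)) ] (⟦ rowWeakᵇ (suc n ∷ r) ⟧ * f (suc n ∷ r))
    ≡⟨ row-top n l (f ∘ (suc n ∷_)) ⟩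
  f (replicate (suc l) (suc n)) ∎
  where
  rest : ℕ → ℤ
  rest x = ∑[ r ← listsOf l (range1 (suc n)) ] (⟦ rowWeakᵇ (suc n ∷ x ∷ r) ⟧ * f (x ∷ r))

-- In a weakly increasing row the copies of the largest letter form a final segment; the outer sum
-- runs over the length `m` of what precedes it. The letter `p` stands for the entry before the row
-- and carries the order condition through the induction.
row-peel : ∀ {n p} → p ≤ n → ∀ l (f : List ℕ → ℤ) →
  ∑[ r ← listsOf l (range1 (suc n)) ] (⟦ rowWeakᵇ (p ∷ r) ⟧ * f r) ≡
  ∑[ m ← upTo (suc l) ] ∑[ r ← listsOf m (range1 n) ] (⟦ rowWeakᵇ (p ∷ r) ⟧ * f (r ++ replicate (l ∸ m) (suc n)))
row-peel p≤n zero f = trans (trans ∑-[x] (sym ∑-[x])) (sym ∑-[x])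
row-peel {n} {p} p≤n (suc l) f = begin
  ∑[ r ← listsOf (suc l) (range1 (suc n)) ] (⟦ rowWeakᵇ (p ∷ r) ⟧ * f r)
    ≡⟨ ∑-cartesian _∷_ (range1 (suc n)) (listsOf l (range1 (suc n))) ⟩
  ∑[ x ← range1 (suc n) ] rest x
    ≡⟨ ∑-range1 n _ ⟩
  ∑[ x ← range1 n ] rest x + rest (suc n)
    ≡⟨ cong₂ _+_ (trans (∑-congAll (range1-≤ n) small) (∑-swap (range1 n) (upTo (suc l)) _)) big ⟩
  ∑[ m ← upTo (suc l) ] ∑[ x ← range1 n ] ∑[ r ← listsOf m (range1 n) ] G x m r + f (replicate (suc l) (suc n))
    ≡⟨ +-comm _ (f (replicate (suc l) (suc n))) ⟩
  f (replicate (suc l) (suc n)) + ∑[ m ← upTo (suc l) ] ∑[ x ← range1 n ] ∑[ r ← listsOf m (range1 n) ] G x m r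
    ≡⟨ cong₂ _+_ (sym (trans ∑-[x] (*-identityˡ _))) (∑-cong (upTo (suc l)) (λ m → sym (∑-cartesian _∷_ (range1 n) (listsOf m (range1 n))))) ⟩
  H 0 + ∑[ m ← upTo (suc l) ] H (suc m)
    ≡⟨ ∑-upTo-suc (suc l) ⟨
  ∑[ m ← upTo (suc (suc l)) ] H m ∎
  where
  rest : ℕ → ℤ
  rest x = ∑[ r ← listsOf l (range1 (suc n)) ] (⟦ rowWeakᵇ (p ∷ x ∷ r) ⟧ * f (x ∷ r))
  G : ℕ → ℕ → List ℕ → ℤ
  G x m r = ⟦ rowWeakᵇ (p ∷ x ∷ r) ⟧ * f (x ∷ r ++ replicate (l ∸ m) (suc n))
  H : ℕ → ℤ
  H m = ∑[ r ← listsOf m (range1 n) ] (⟦ rowWeakᵇ (p ∷ r) ⟧ * f (r ++ replicate (suc l ∸ m) (suc n)))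
  small : ∀ x → x ≤ n → rest x ≡ ∑[ m ← upTo (suc l) ] ∑[ r ← listsOf m (range1 n) ] G x m r
  small x x≤n = begin
    rest x
      ≡⟨ ∑-cong (listsOf l (range1 (suc n))) (λ r → ⟦∧⟧* (p ≤ᵇ x) _ _) ⟩
    ∑[ r ← listsOf l (range1 (suc n)) ] (⟦ p ≤ᵇ x ⟧ * (⟦ rowWeakᵇ (x ∷ r) ⟧ * f (x ∷ r)))
      ≡⟨ ∑-*ˡ (listsOf l (range1 (suc n))) ⟦ p ≤ᵇ x ⟧ _ ⟩
    ⟦ p ≤ᵇ x ⟧ * ∑[ r ← listsOf l (range1 (suc n)) ] (⟦ rowWeakᵇ (x ∷ r) ⟧ * f (x ∷ r))
      ≡⟨ cong (⟦ p ≤ᵇ x ⟧ *_) (row-peel x≤n l (f ∘ (x ∷_))) ⟩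
    ⟦ p ≤ᵇ x ⟧ * ∑[ m ← upTo (suc l) ] ∑[ r ← listsOf m (range1 n) ] (⟦ rowWeakᵇ (x ∷ r) ⟧ * f (x ∷ r ++ replicate (l ∸ m) (suc n)))
      ≡⟨ ∑-*ˡ (upTo (suc l)) _ _ ⟨
    ∑[ m ← upTo (suc l) ] (⟦ p ≤ᵇ x ⟧ * ∑[ r ← listsOf m (range1 n) ] (⟦ rowWeakᵇ (x ∷ r) ⟧ * f (x ∷ r ++ replicate (l ∸ m) (suc n))))
      ≡⟨ ∑-cong (upTo (suc l)) (λ m → trans (sym (∑-*ˡ (listsOf m (range1 n)) _ _))
           (∑-cong (listsOf m (range1 n)) (λ r → sym (⟦∧⟧* (p ≤ᵇ x) _ _)))) ⟩
    ∑[ m ← upTo (suc l) ] ∑[ r ← listsOf m (range1 n) ] G x m r ∎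
  big : rest (suc n) ≡ f (replicate (suc l) (suc n))
  big = trans (∑-cong (listsOf l (range1 (suc n))) (λ r →
      cong (λ b → ⟦ b ∧ rowWeakᵇ (suc n ∷ r) ⟧ * f (suc n ∷ r)) (≤⇒≤ᵇ (ℕₚ.m≤n⇒m≤1+n p≤n))))
    (row-top n l (f ∘ (suc n ∷_)))

-- The row conditions are independent of each other, so the sum factors row by row. The column
-- condition couples neighbouring rows and is left to `colsStrict-ext`.
fillings-peel : ∀ {M} n la → All (_< M) la → ∀ (f : Filling → ℤ) →
  ∑[ t ← fillings la (range1 (suc n)) ] (⟦ allᵇ rowWeakᵇ t ⟧ * f t) ≡
  ∑[ mu ← Box M (length la) ] (⟦ leqs mu la ⟧ *
    ∑[ t ← fillings mu (range1 n) ] (⟦ allᵇ rowWeakᵇ t ⟧ * f (ext (suc n) la mu t)))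
fillings-peel n [] [] f =
  sym (trans ∑-[x] (trans (*-identityˡ _) (trans ∑-[x] (sym ∑-[x]))))
fillings-peel {M} n (l ∷ la) (l<M ∷ la<M) f = begin
  ∑[ t ← fillings (l ∷ la) (range1 (suc n)) ] (⟦ allᵇ rowWeakᵇ t ⟧ * f t)
    ≡⟨ ∑-cartesian _∷_ (listsOf l (range1 (suc n))) (fillings la (range1 (suc n))) ⟩
  ∑[ r ← listsOf l (range1 (suc n)) ] ∑[ t ← fillings la (range1 (suc n)) ] (⟦ rowWeakᵇ r ∧ allᵇ rowWeakᵇ t ⟧ * f (r ∷ t))
    ≡⟨ ∑-cong (listsOf l (range1 (suc n))) (λ r → trans
         (trans (∑-cong (fillings la (range1 (suc n))) (λ t → ⟦∧⟧* (rowWeakᵇ r) _ _)) (∑-*ˡ (fillings la (range1 (suc n))) _ _))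
         (cong (λ b → ⟦ b ⟧ * K r) (sym (rowWeak-0 r)))) ⟩
  ∑[ r ← listsOf l (range1 (suc n)) ] (⟦ rowWeakᵇ (0 ∷ r) ⟧ * K r)
    ≡⟨ row-peel z≤n l K ⟩
  ∑[ m ← upTo (suc l) ] ∑[ r ← listsOf m (range1 n) ] (⟦ rowWeakᵇ (0 ∷ r) ⟧ * K (r ++ replicate (l ∸ m) (suc n)))
    ≡⟨ ∑-upTo-≤ l<M _ ⟩
  ∑[ m ← upTo M ] (⟦ m ≤ᵇ l ⟧ * ∑[ r ← listsOf m (range1 n) ] (⟦ rowWeakᵇ (0 ∷ r) ⟧ * K (r ++ replicate (l ∸ m) (suc n))))
    ≡⟨ ∑-cong (upTo M) step ⟩
  ∑[ m ← upTo M ] ∑[ mu ← Box M (length la) ] (⟦ leqs (m ∷ mu) (l ∷ la) ⟧ * Q (m ∷ mu))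
    ≡⟨ ∑-Box M (length la) ⟨
  ∑[ mu ← Box M (suc (length la)) ] (⟦ leqs mu (l ∷ la) ⟧ * Q mu) ∎
  where
  K : List ℕ → ℤ
  K r = ∑[ t ← fillings la (range1 (suc n)) ] (⟦ allᵇ rowWeakᵇ t ⟧ * f (r ∷ t))
  Q : List ℕ → ℤ
  Q mu = ∑[ t ← fillings mu (range1 n) ] (⟦ allᵇ rowWeakᵇ t ⟧ * f (ext (suc n) (l ∷ la) mu t))
  E : ℕ → List ℕ → List ℕ → ℤ
  E m r mu = ∑[ t ← fillings mu (range1 n) ] (⟦ allᵇ rowWeakᵇ t ⟧ * f ((r ++ replicate (l ∸ m) (suc n)) ∷ ext (suc n) la mu t))
  row : ∀ m mu → ∑[ r ← listsOf m (range1 n) ] (⟦ rowWeakᵇ r ⟧ * E m r mu) ≡ Q (m ∷ mu)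
  row m mu = begin
    ∑[ r ← listsOf m (range1 n) ] (⟦ rowWeakᵇ r ⟧ * E m r mu)
      ≡⟨ ∑-cong (listsOf m (range1 n)) (λ r → trans (sym (∑-*ˡ (fillings mu (range1 n)) _ _))
           (∑-cong (fillings mu (range1 n)) (λ t → sym (⟦∧⟧* (rowWeakᵇ r) _ _)))) ⟩
    ∑[ r ← listsOf m (range1 n) ] ∑[ t ← fillings mu (range1 n) ] (⟦ rowWeakᵇ r ∧ allᵇ rowWeakᵇ t ⟧ * f (ext (suc n) (l ∷ la) (m ∷ mu) (r ∷ t)))
      ≡⟨ ∑-cartesian _∷_ (listsOf m (range1 n)) (fillings mu (range1 n)) ⟨
    Q (m ∷ mu) ∎
  step : ∀ m → ⟦ m ≤ᵇ l ⟧ * ∑[ r ← listsOf m (range1 n) ] (⟦ rowWeakᵇ (0 ∷ r) ⟧ * K (r ++ replicate (l ∸ m) (suc n))) ≡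
               ∑[ mu ← Box M (length la) ] (⟦ leqs (m ∷ mu) (l ∷ la) ⟧ * Q (m ∷ mu))
  step m = begin
    ⟦ m ≤ᵇ l ⟧ * ∑[ r ← listsOf m (range1 n) ] (⟦ rowWeakᵇ (0 ∷ r) ⟧ * K (r ++ replicate (l ∸ m) (suc n)))
      ≡⟨ cong (⟦ m ≤ᵇ l ⟧ *_) (∑-cong (listsOf m (range1 n)) (λ r →
           cong₂ (λ b z → ⟦ b ⟧ * z) (rowWeak-0 r) (fillings-peel n la la<M _))) ⟩
    ⟦ m ≤ᵇ l ⟧ * ∑[ r ← listsOf m (range1 n) ] (⟦ rowWeakᵇ r ⟧ * ∑[ mu ← Box M (length la) ] (⟦ leqs mu la ⟧ * E m r mu))
      ≡⟨ cong (⟦ m ≤ᵇ l ⟧ *_) (∑-cong (listsOf m (range1 n)) (λ r → trans (sym (∑-*ˡ (Box M (length la)) _ _))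
           (∑-cong (Box M (length la)) (λ mu → *-swapˡ ⟦ rowWeakᵇ r ⟧ ⟦ leqs mu la ⟧ (E m r mu))))) ⟩
    ⟦ m ≤ᵇ l ⟧ * ∑[ r ← listsOf m (range1 n) ] ∑[ mu ← Box M (length la) ] (⟦ leqs mu la ⟧ * (⟦ rowWeakᵇ r ⟧ * E m r mu))
      ≡⟨ cong (⟦ m ≤ᵇ l ⟧ *_) (∑-swap (listsOf m (range1 n)) (Box M (length la)) _) ⟩
    ⟦ m ≤ᵇ l ⟧ * ∑[ mu ← Box M (length la) ] ∑[ r ← listsOf m (range1 n) ] (⟦ leqs mu la ⟧ * (⟦ rowWeakᵇ r ⟧ * E m r mu))
      ≡⟨ cong (⟦ m ≤ᵇ l ⟧ *_) (∑-cong (Box M (length la)) (λ mu →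
           trans (∑-*ˡ (listsOf m (range1 n)) _ _) (cong (⟦ leqs mu la ⟧ *_) (row m mu)))) ⟩
    ⟦ m ≤ᵇ l ⟧ * ∑[ mu ← Box M (length la) ] (⟦ leqs mu la ⟧ * Q (m ∷ mu))
      ≡⟨ ∑-*ˡ (Box M (length la)) _ _ ⟨
    ∑[ mu ← Box M (length la) ] (⟦ m ≤ᵇ l ⟧ * (⟦ leqs mu la ⟧ * Q (m ∷ mu)))
      ≡⟨ ∑-cong (Box M (length la)) (λ mu → sym (⟦∧⟧* (m ≤ᵇ l) _ _)) ⟩
    ∑[ mu ← Box M (length la) ] (⟦ leqs (m ∷ mu) (l ∷ la) ⟧ * Q (m ∷ mu)) ∎

strictBelow-[] : ∀ r → strictBelowᵇ r [] ≡ true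
strictBelow-[] [] = refl
strictBelow-[] (x ∷ r) = refl

∧-swapˡ : ∀ a b c → a ∧ (b ∧ c) ≡ b ∧ (a ∧ c)
∧-swapˡ true b c = refl
∧-swapˡ false b c = sym (Bₚ.∧-zeroʳ b)

-- A letter `suc n` of the upper row needs a smaller letter underneath, that is, an old entry of
-- `r`; so the extended upper row must fit over the unextended lower one.
strictBelow-ext : ∀ {n r r'} c c' → All (_≤ n) r → All (_≤ n) r' →
  strictBelowᵇ (r ++ replicate c (suc n)) (r' ++ replicate c' (suc n)) ≡
  (length r' ℕ.+ c' ≤ᵇ length r) ∧ strictBelowᵇ r r'
strictBelow-ext c zero [] [] = strictBelow-[] (replicate c _)
strictBelow-ext zero (suc c') [] [] = refl
strictBelow-ext {n} (suc c) (suc c') [] [] rewrite ≥⇒<ᵇ (ℕₚ.≤-refl {suc n}) = refl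
strictBelow-ext zero c' [] (y ∷ ys) = refl
strictBelow-ext (suc c) c' [] (y ∷ ys) rewrite ≥⇒<ᵇ (ℕₚ.m≤n⇒m≤1+n y) = refl
strictBelow-ext c zero (x ∷ xs) [] = refl
strictBelow-ext {n} {r = a ∷ r} c (suc c') (x ∷ xs) [] = begin
  (a <ᵇ suc n) ∧ strictBelowᵇ (r ++ replicate c (suc n)) (replicate c' (suc n))
    ≡⟨ cong₂ _∧_ (<⇒<ᵇ (s≤s x)) (strictBelow-ext c c' xs []) ⟩
  (c' ≤ᵇ length r) ∧ strictBelowᵇ r []
    ≡⟨ cong₂ _∧_ (sym (≤ᵇ-suc c' (length r))) (strictBelow-[] r) ⟩
  (suc c' ≤ᵇ suc (length r)) ∧ true ∎
strictBelow-ext {r = a ∷ r} {b ∷ r'} c c' (x ∷ xs) (y ∷ ys) = begin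
  (a <ᵇ b) ∧ strictBelowᵇ (r ++ _) (r' ++ _)
    ≡⟨ cong ((a <ᵇ b) ∧_) (strictBelow-ext c c' xs ys) ⟩
  (a <ᵇ b) ∧ ((length r' ℕ.+ c' ≤ᵇ length r) ∧ strictBelowᵇ r r')
    ≡⟨ ∧-swapˡ (a <ᵇ b) (length r' ℕ.+ c' ≤ᵇ length r) (strictBelowᵇ r r') ⟩
  (length r' ℕ.+ c' ≤ᵇ length r) ∧ ((a <ᵇ b) ∧ strictBelowᵇ r r')
    ≡⟨ cong (_∧ ((a <ᵇ b) ∧ strictBelowᵇ r r')) (sym (≤ᵇ-suc (length r' ℕ.+ c') (length r))) ⟩
  (suc (length r' ℕ.+ c') ≤ᵇ suc (length r)) ∧ ((a <ᵇ b) ∧ strictBelowᵇ r r') ∎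

-- The inequality of `strictBelow-ext` is the interlacing `l ≤ length r` of a horizontal strip. The
-- factor `leqs` guards the truncated subtraction: only for `m ≤ l` does adding `l ∸ m` letters
-- produce a row of length `l`.
colsStrict-ext-tail : ∀ {n r} c la {mu t} → All (_≤ n) r → Fits n mu t →
  leqs mu la ∧ colsStrictᵇ ((r ++ replicate c (suc n)) ∷ ext (suc n) la mu t) ≡
  hsp (length r) la mu ∧ colsStrictᵇ (r ∷ t)
colsStrict-ext-tail c [] r≤ [] = refl
colsStrict-ext-tail c [] r≤ (_ ∷ _) = refl
colsStrict-ext-tail c (l ∷ la) r≤ [] = refl
colsStrict-ext-tail {n} {r} c (l ∷ la) {m ∷ mu} {r' ∷ t} r≤ ((refl , r'≤) ∷ fits) with length r' ≤ᵇ l in eq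
... | false = cong (_∧ colsStrictᵇ (r ∷ r' ∷ t)) (sym (Bₚ.∧-zeroʳ (l ≤ᵇ length r)))
... | true = begin
  leqs mu la ∧ (strictBelowᵇ (r ++ replicate c (suc n)) (r' ++ replicate (l ∸ length r') (suc n)) ∧ _)
    ≡⟨ cong (λ b → leqs mu la ∧ (b ∧ _)) (trans (strictBelow-ext c (l ∸ length r') r≤ r'≤)
         (cong (λ k → (k ≤ᵇ length r) ∧ strictBelowᵇ r r') (ℕₚ.m+[n∸m]≡n (≤ᵇ⇒≤ (length r') l eq)))) ⟩
  leqs mu la ∧ (((l ≤ᵇ length r) ∧ strictBelowᵇ r r') ∧ colsStrictᵇ ((r' ++ replicate (l ∸ length r') (suc n)) ∷ ext (suc n) la mu t))
    ≡⟨ shuffle (l ≤ᵇ length r) (strictBelowᵇ r r') (leqs mu la) _ _ _ (colsStrict-ext-tail (l ∸ length r') la r'≤ fits) ⟩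
  ((l ≤ᵇ length r) ∧ hsp (length r') la mu) ∧ (strictBelowᵇ r r' ∧ colsStrictᵇ (r' ∷ t)) ∎
  where
  shuffle : ∀ A S L K H K' → L ∧ K ≡ H ∧ K' → L ∧ ((A ∧ S) ∧ K) ≡ (A ∧ H) ∧ (S ∧ K')
  shuffle false S L K H K' p = Bₚ.∧-zeroʳ L
  shuffle true false L K H K' p = trans (Bₚ.∧-zeroʳ L) (sym (Bₚ.∧-zeroʳ H))
  shuffle true true L K H K' p = p

-- The bound `M` acts as a row under the bottom one, long enough to impose nothing.
colsStrict-ext : ∀ {M n} la {mu t} → All (_< M) la → Fits n mu t →
  leqs mu la ∧ colsStrictᵇ (ext (suc n) la mu t) ≡ hsp M la mu ∧ colsStrictᵇ t
colsStrict-ext [] [] [] = refl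
colsStrict-ext [] [] (_ ∷ _) = refl
colsStrict-ext (l ∷ la) (p ∷ _) [] = refl
colsStrict-ext {M} (l ∷ la) {m ∷ mu} {r ∷ t} (p ∷ _) ((refl , r≤) ∷ fits) = begin
  ((m ≤ᵇ l) ∧ leqs mu la) ∧ _   ≡⟨ Bₚ.∧-assoc (m ≤ᵇ l) _ _ ⟩
  (m ≤ᵇ l) ∧ (leqs mu la ∧ _)   ≡⟨ cong ((m ≤ᵇ l) ∧_) (colsStrict-ext-tail (l ∸ m) la r≤ fits) ⟩
  (m ≤ᵇ l) ∧ (hsp m la mu ∧ colsStrictᵇ (r ∷ t)) ≡⟨ Bₚ.∧-assoc (m ≤ᵇ l) _ _ ⟨
  ((m ≤ᵇ l) ∧ hsp m la mu) ∧ colsStrictᵇ (r ∷ t)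
    ≡⟨ cong (λ b → (b ∧ ((m ≤ᵇ l) ∧ hsp m la mu)) ∧ colsStrictᵇ (r ∷ t)) (≤⇒≤ᵇ (ℕₚ.<⇒≤ p)) ⟨
  hsp M (l ∷ la) (m ∷ mu) ∧ colsStrictᵇ (r ∷ t) ∎

count-∷ : ∀ v x xs → countℕ v (x ∷ xs) ≡ (if x ≡ᵇ v then 1 else 0) ℕ.+ countℕ v xs
count-∷ v x xs with x ≡ᵇ v
... | true = refl
... | false = refl

count-++ : ∀ v xs ys → countℕ v (xs ++ ys) ≡ countℕ v xs ℕ.+ countℕ v ys
count-++ v [] ys = refl
count-++ v (x ∷ xs) ys with x ≡ᵇ v
... | true = cong suc (count-++ v xs ys)
... | false = count-++ v xs ys

count-replicate-≢ : ∀ {v N} → ¬ N ≡ v → ∀ c → countℕ v (replicate c N) ≡ 0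
count-replicate-≢ p zero = refl
count-replicate-≢ {v} {N} p (suc c) rewrite ≢⇒≡ᵇ p = count-replicate-≢ p c

count-replicate : ∀ N c → countℕ N (replicate c N) ≡ c
count-replicate N zero = refl
count-replicate N (suc c) rewrite ≡⇒≡ᵇ (refl {x = N}) = cong suc (count-replicate N c)

count-0 : ∀ {v xs} → All (_< v) xs → countℕ v xs ≡ 0
count-0 [] = refl
count-0 {v} {x ∷ xs} (p ∷ ps) rewrite ≢⇒≡ᵇ (ℕₚ.<⇒≢ p) = count-0 ps

count-ext-≤ : ∀ {n v} → v ≤ n → ∀ la {mu t} → Fits n mu t → leqs mu la ≡ true →
  countℕ v (concat (ext (suc n) la mu t)) ≡ countℕ v (concat t)
count-ext-≤ v≤n [] [] eq = refl
count-ext-≤ {n} {v} v≤n (l ∷ la) {m ∷ mu} {r ∷ t} (_ ∷ fits) eq = begin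
  countℕ v ((r ++ R) ++ concat (ext (suc n) la mu t))        ≡⟨ count-++ v (r ++ R) _ ⟩
  countℕ v (r ++ R) ℕ.+ countℕ v (concat (ext (suc n) la mu t))
    ≡⟨ cong₂ ℕ._+_ (trans (count-++ v r R) (trans (cong (countℕ v r ℕ.+_) (count-replicate-≢ (λ e → ℕₚ.<⇒≢ (s≤s v≤n) (sym e)) (l ∸ m))) (ℕₚ.+-identityʳ _)))
                   (count-ext-≤ v≤n la fits (proj₂ (∧-true {m ≤ᵇ l} eq))) ⟩
  countℕ v r ℕ.+ countℕ v (concat t)                         ≡⟨ count-++ v r (concat t) ⟨
  countℕ v (concat (r ∷ t)) ∎
  where R = replicate (l ∸ m) (suc n)

+-interchangeℕ : ∀ a b c d → (a ℕ.+ b) ℕ.+ (c ℕ.+ d) ≡ (a ℕ.+ c) ℕ.+ (b ℕ.+ d)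
+-interchangeℕ = ℕsolve-∀

count-ext-suc : ∀ {n} la {mu t} → Fits n mu t → leqs mu la ≡ true →
  countℕ (suc n) (concat (ext (suc n) la mu t)) ℕ.+ sum mu ≡ sum la
count-ext-suc [] [] eq = refl
count-ext-suc {n} (l ∷ la) {m ∷ mu} {r ∷ t} ((_ , r≤) ∷ fits) eq = begin
  countℕ (suc n) ((r ++ R) ++ rest) ℕ.+ (m ℕ.+ sum mu)
    ≡⟨ cong (ℕ._+ (m ℕ.+ sum mu)) (trans (count-++ (suc n) (r ++ R) rest) (cong (ℕ._+ countℕ (suc n) rest)
         (trans (count-++ (suc n) r R) (cong₂ ℕ._+_ (count-0 (All.map s≤s r≤)) (count-replicate (suc n) (l ∸ m)))))) ⟩
  ((l ∸ m) ℕ.+ countℕ (suc n) rest) ℕ.+ (m ℕ.+ sum mu)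
    ≡⟨ +-interchangeℕ (l ∸ m) _ m (sum mu) ⟩
  ((l ∸ m) ℕ.+ m) ℕ.+ (countℕ (suc n) rest ℕ.+ sum mu)
    ≡⟨ cong₂ ℕ._+_ (ℕₚ.m∸n+n≡m (≤ᵇ⇒≤ m l (proj₁ (∧-true {m ≤ᵇ l} eq)))) (count-ext-suc la fits (proj₂ (∧-true {m ≤ᵇ l} eq))) ⟩
  l ℕ.+ sum la ∎
  where
  R = replicate (l ∸ m) (suc n)
  rest = concat (ext (suc n) la mu t)

tabulate-∷ʳ : ∀ n (h : ℕ → ℕ) → V.tabulate {n = suc n} (h ∘ toℕ) ≡ V.tabulate {n = n} (h ∘ toℕ) V.∷ʳ h n
tabulate-∷ʳ zero h = refl
tabulate-∷ʳ (suc n) h = cong (h 0 V.∷_) (tabulate-∷ʳ n (h ∘ suc))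

tabulate-cong-< : ∀ n {h k : ℕ → ℕ} → (∀ i → i < n → h i ≡ k i) → V.tabulate {n = n} (h ∘ toℕ) ≡ V.tabulate (k ∘ toℕ)
tabulate-cong-< zero p = refl
tabulate-cong-< (suc n) p = cong₂ V._∷_ (p 0 (s≤s z≤n)) (tabulate-cong-< n (λ i q → p (suc i) (s≤s q)))

content-ext : ∀ {n} la {mu t} → Fits n mu t → leqs mu la ≡ true →
  content (suc n) (ext (suc n) la mu t) ≡ content n t V.∷ʳ countℕ (suc n) (concat (ext (suc n) la mu t))
content-ext {n} la {mu} {t} fits eq = trans (tabulate-∷ʳ n (λ i → countℕ (suc i) (concat (ext (suc n) la mu t))))
  (cong (V._∷ʳ countℕ (suc n) (concat (ext (suc n) la mu t))) (tabulate-cong-< n (λ i i<n → count-ext-≤ i<n la fits eq)))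

eqVec-∷ʳ : ∀ {n} (as bs : Vec ℕ n) a b → eqVecᵇ (as V.∷ʳ a) (bs V.∷ʳ b) ≡ eqVecᵇ as bs ∧ (a ≡ᵇ b)
eqVec-∷ʳ V.[] V.[] a b = Bₚ.∧-identityʳ (a ≡ᵇ b)
eqVec-∷ʳ (x V.∷ as) (y V.∷ bs) a b = trans (cong ((x ≡ᵇ y) ∧_) (eqVec-∷ʳ as bs a b)) (sym (Bₚ.∧-assoc (x ≡ᵇ y) _ _))

-- The weight `f ≡ 1` gives a coefficient of a Schur polynomial, the exponent vector `ones n` a sum
-- over standard tableaux.
ssytSum : ∀ n → List ℕ → Vec ℕ n → (Filling → ℤ) → ℤ
ssytSum n la α f = ∑[ t ← fillings la (range1 n) ] (⟦ isSSYTᵇ t ∧ eqVecᵇ (content n t) α ⟧ * f t)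

-- For a partition `la` bounded by `M`, the coefficient of `xᵃ` in the skew Schur polynomial of
-- `la/mu` in one variable `x`.
kernel : ℕ → List ℕ → List ℕ → ℕ → ℤ
kernel M la mu a = ⟦ hsp M la mu ∧ (sum la ≡ᵇ sum mu ℕ.+ a) ⟧

≡ᵇ-+ : ∀ {c s l} a → c ℕ.+ s ≡ l → (c ≡ᵇ a) ≡ (l ≡ᵇ s ℕ.+ a)
≡ᵇ-+ {c} {s} {l} a refl = ≡-of-true
  (λ p → ≡⇒≡ᵇ (trans (ℕₚ.+-comm c s) (cong (s ℕ.+_) (≡ᵇ⇒≡ c a p))))
  (λ p → ≡⇒≡ᵇ (ℕₚ.+-cancelˡ-≡ s c a (trans (ℕₚ.+-comm s c) (≡ᵇ⇒≡ (c ℕ.+ s) (s ℕ.+ a) p))))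

-- The branching rule, with weights. The boxes of `la` outside `mu` hold the letter `suc n`, so
-- their number is the last exponent `a`; the rest is a tableau of shape `mu` and content `β`.
ssytSum-peel : ∀ {M} n la (β : Vec ℕ n) a (f : Filling → ℤ) → All (_< M) la →
  ssytSum (suc n) la (β V.∷ʳ a) f ≡
  ∑[ mu ← Box M (length la) ] (kernel M la mu a * ssytSum n mu β (λ t → f (ext (suc n) la mu t)))
ssytSum-peel {M} n la β a f la<M = begin
  ssytSum (suc n) la (β V.∷ʳ a) f
    ≡⟨ ∑-cong (fillings la (range1 (suc n))) (λ t → trans
         (cong (λ b → ⟦ b ⟧ * f t) (Bₚ.∧-assoc (allᵇ rowWeakᵇ t) _ _)) (⟦∧⟧* (allᵇ rowWeakᵇ t) _ (f t))) ⟩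
  ∑[ t ← fillings la (range1 (suc n)) ] (⟦ allᵇ rowWeakᵇ t ⟧ * g t)
    ≡⟨ fillings-peel n la la<M g ⟩
  ∑[ mu ← Box M (length la) ] (⟦ leqs mu la ⟧ *
    ∑[ t ← fillings mu (range1 n) ] (⟦ allᵇ rowWeakᵇ t ⟧ * g (ext (suc n) la mu t)))
    ≡⟨ ∑-cong (Box M (length la)) (λ mu → trans (sym (∑-*ˡ (fillings mu (range1 n)) _ _))
         (trans (∑-congAll (fillings-Fits n mu) (λ t → step mu t)) (∑-*ˡ (fillings mu (range1 n)) _ _))) ⟩
  ∑[ mu ← Box M (length la) ] (kernel M la mu a * ssytSum n mu β (λ t → f (ext (suc n) la mu t))) ∎
  where
  g : Filling → ℤ
  g t = ⟦ colsStrictᵇ t ∧ eqVecᵇ (content (suc n) t) (β V.∷ʳ a) ⟧ * f t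
  bools : ∀ mu t → Fits n mu t →
    leqs mu la ∧ (allᵇ rowWeakᵇ t ∧ (colsStrictᵇ (ext (suc n) la mu t) ∧ eqVecᵇ (content (suc n) (ext (suc n) la mu t)) (β V.∷ʳ a))) ≡
    (hsp M la mu ∧ (sum la ≡ᵇ sum mu ℕ.+ a)) ∧ (isSSYTᵇ t ∧ eqVecᵇ (content n t) β)
  bools mu t fits with leqs mu la in eq
  ... | false = sym (shuffle₀ (hsp M la mu) _ (allᵇ rowWeakᵇ t) (colsStrictᵇ t) _
                  (trans (sym (colsStrict-ext la la<M fits)) (cong (_∧ colsStrictᵇ (ext (suc n) la mu t)) eq)))
    where
    shuffle₀ : ∀ h s w c e → h ∧ c ≡ false → (h ∧ s) ∧ ((w ∧ c) ∧ e) ≡ false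
    shuffle₀ false s w c e p = refl
    shuffle₀ true s w c e p rewrite p | Bₚ.∧-zeroʳ w = Bₚ.∧-zeroʳ s
  ... | true = begin
    allᵇ rowWeakᵇ t ∧ (colsStrictᵇ (ext (suc n) la mu t) ∧ eqVecᵇ (content (suc n) (ext (suc n) la mu t)) (β V.∷ʳ a))
      ≡⟨ cong₂ (λ x y → allᵇ rowWeakᵇ t ∧ (x ∧ y))
           (trans (cong (_∧ colsStrictᵇ (ext (suc n) la mu t)) (sym eq)) (colsStrict-ext la la<M fits))
           (trans (cong (λ v → eqVecᵇ v (β V.∷ʳ a)) (content-ext la fits eq))
             (trans (eqVec-∷ʳ (content n t) β _ a) (cong (eqVecᵇ (content n t) β ∧_) (≡ᵇ-+ a (count-ext-suc la fits eq))))) ⟩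
    allᵇ rowWeakᵇ t ∧ ((hsp M la mu ∧ colsStrictᵇ t) ∧ (eqVecᵇ (content n t) β ∧ (sum la ≡ᵇ sum mu ℕ.+ a)))
      ≡⟨ shuffle₁ (allᵇ rowWeakᵇ t) (hsp M la mu) (colsStrictᵇ t) _ _ ⟩
    (hsp M la mu ∧ (sum la ≡ᵇ sum mu ℕ.+ a)) ∧ (isSSYTᵇ t ∧ eqVecᵇ (content n t) β) ∎
    where
    shuffle₁ : ∀ w h c e s → w ∧ ((h ∧ c) ∧ (e ∧ s)) ≡ (h ∧ s) ∧ ((w ∧ c) ∧ e)
    shuffle₁ false h c e s = sym (Bₚ.∧-zeroʳ (h ∧ s))
    shuffle₁ true false c e s = refl
    shuffle₁ true true false e s = sym (Bₚ.∧-zeroʳ s)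
    shuffle₁ true true true e s = Bₚ.∧-comm e s
  step : ∀ mu t → Fits n mu t →
    ⟦ leqs mu la ⟧ * (⟦ allᵇ rowWeakᵇ t ⟧ * g (ext (suc n) la mu t)) ≡
    kernel M la mu a * (⟦ isSSYTᵇ t ∧ eqVecᵇ (content n t) β ⟧ * f (ext (suc n) la mu t))
  step mu t fits = begin
    ⟦ leqs mu la ⟧ * (⟦ allᵇ rowWeakᵇ t ⟧ * (⟦ b ⟧ * x))   ≡⟨ cong (⟦ leqs mu la ⟧ *_) (⟦∧⟧* (allᵇ rowWeakᵇ t) b x) ⟨
    ⟦ leqs mu la ⟧ * (⟦ allᵇ rowWeakᵇ t ∧ b ⟧ * x)         ≡⟨ ⟦∧⟧* (leqs mu la) _ x ⟨
    ⟦ leqs mu la ∧ (allᵇ rowWeakᵇ t ∧ b) ⟧ * x             ≡⟨ cong (λ b → ⟦ b ⟧ * x) (bools mu t fits) ⟩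
    ⟦ (hsp M la mu ∧ (sum la ≡ᵇ sum mu ℕ.+ a)) ∧ (isSSYTᵇ t ∧ eqVecᵇ (content n t) β) ⟧ * x
      ≡⟨ ⟦∧⟧* (hsp M la mu ∧ (sum la ≡ᵇ sum mu ℕ.+ a)) _ x ⟩
    kernel M la mu a * (⟦ isSSYTᵇ t ∧ eqVecᵇ (content n t) β ⟧ * x) ∎
    where
    b = colsStrictᵇ (ext (suc n) la mu t) ∧ eqVecᵇ (content (suc n) (ext (suc n) la mu t)) (β V.∷ʳ a)
    x = f (ext (suc n) la mu t)

-- Adding and removing boxes.

-- Results that are not partitions stay in the list: their tableau sums vanish by
-- `ssytSum-weaklyDec`.
incs : List ℕ → List (List ℕ)
incs [] = []
incs (l ∷ la) = (suc l ∷ la) ∷ map (l ∷_) (incs la)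

decHead : ℕ → List ℕ → List (List ℕ)
decHead zero nu = []
decHead (suc v) nu = (v ∷ nu) ∷ []

decs : List ℕ → List (List ℕ)
decs [] = []
decs (v ∷ nu) = decHead v nu ++ map (v ∷_) (decs nu)

∑-incs : ∀ l la (f : List ℕ → ℤ) → ∑ (incs (l ∷ la)) f ≡ f (suc l ∷ la) + ∑[ x ← incs la ] f (l ∷ x)
∑-incs l la f = trans ∑-∷ (cong (_+_ (f (suc l ∷ la))) (∑-map (l ∷_) (incs la)))

∑-decs : ∀ v nu (f : List ℕ → ℤ) → ∑ (decs (v ∷ nu)) f ≡ ∑ (decHead v nu) f + ∑[ x ← decs nu ] f (v ∷ x)
∑-decs v nu f = trans (∑-++ (decHead v nu) _) (cong (_+_ (∑ (decHead v nu) f)) (∑-map (v ∷_) (decs nu)))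

incs-sum : ∀ la → All (λ x → sum x ≡ suc (sum la) × length x ≡ length la) (incs la)
incs-sum [] = []
incs-sum (l ∷ la) = (refl , refl) ∷ Allₚ.map⁺ (All.map (λ (s , e) → trans (cong (l ℕ.+_) s) (ℕₚ.+-suc l (sum la)) , cong suc e) (incs-sum la))

decs-sum : ∀ nu → All (λ x → suc (sum x) ≡ sum nu × length x ≡ length nu) (decs nu)
decs-sum [] = []
decs-sum (v ∷ nu) = Allₚ.++⁺ (hd v)
  (Allₚ.map⁺ (All.map (λ {x} (s , e) → trans (sym (ℕₚ.+-suc v (sum x))) (cong (v ℕ.+_) s) , cong suc e) (decs-sum nu)))
  where
  hd : ∀ v → All (λ x → suc (sum x) ≡ sum (v ∷ nu) × length x ≡ length (v ∷ nu)) (decHead v nu)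
  hd zero = []
  hd (suc v) = (refl , refl) ∷ []

-- Both sides run over the pairs in which `nu` is `mu` plus a box. The hypothesis on `F` takes care
-- of the edge: an entry `M ∸ 1` of `mu` can be raised out of `Box M R`.
∑-incs-decs : ∀ M R (F : List ℕ → List ℕ → ℤ) →
  (∀ mu nu → ¬ All (λ m → suc m < M) mu → F mu nu ≡ 0ℤ) →
  ∑[ mu ← Box M R ] ∑[ nu ← incs mu ] F mu nu ≡ ∑[ nu ← Box M R ] ∑[ mu ← decs nu ] F mu nu
∑-incs-decs M zero F F0 = trans ∑-[x] (trans (trans ∑-[] (sym ∑-[])) (sym ∑-[x]))
∑-incs-decs M (suc R) F F0 = begin
  ∑[ mu ← Box M (suc R) ] ∑[ nu ← incs mu ] F mu nu
    ≡⟨ ∑-Box M R ⟩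
  ∑[ m ← upTo M ] ∑[ mu ← Box M R ] ∑[ nu ← incs (m ∷ mu) ] F (m ∷ mu) nu
    ≡⟨ ∑-cong (upTo M) (λ m → trans (∑-cong (Box M R) (λ mu → ∑-incs m mu (F (m ∷ mu)))) (∑-+ (Box M R) _ _)) ⟩
  ∑[ m ← upTo M ] (G m (suc m) + ∑[ mu ← Box M R ] ∑[ nu ← incs mu ] F (m ∷ mu) (m ∷ nu))
    ≡⟨ ∑-+ (upTo M) _ _ ⟩
  ∑[ m ← upTo M ] G m (suc m) + ∑[ m ← upTo M ] ∑[ mu ← Box M R ] ∑[ nu ← incs mu ] F (m ∷ mu) (m ∷ nu)
    ≡⟨ cong₂ _+_ (heads M F0)
         (∑-cong (upTo M) (λ m → ∑-incs-decs M R (λ mu nu → F (m ∷ mu) (m ∷ nu)) (λ mu nu p → F0 _ _ (λ { (_ ∷ q) → p q })))) ⟩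
  ∑[ v ← upTo M ] ∑[ nu ← Box M R ] ∑[ mu ← decHead v nu ] F mu (v ∷ nu) + ∑[ v ← upTo M ] ∑[ nu ← Box M R ] ∑[ mu ← decs nu ] F (v ∷ mu) (v ∷ nu)
    ≡⟨ ∑-+ (upTo M) _ _ ⟨
  ∑[ v ← upTo M ] (∑[ nu ← Box M R ] ∑[ mu ← decHead v nu ] F mu (v ∷ nu) + ∑[ nu ← Box M R ] ∑[ mu ← decs nu ] F (v ∷ mu) (v ∷ nu))
    ≡⟨ ∑-cong (upTo M) (λ v → trans (sym (∑-+ (Box M R) _ _)) (∑-cong (Box M R) (λ nu → sym (∑-decs v nu (λ mu → F mu (v ∷ nu)))))) ⟩
  ∑[ v ← upTo M ] ∑[ nu ← Box M R ] ∑[ mu ← decs (v ∷ nu) ] F mu (v ∷ nu)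
    ≡⟨ ∑-Box M R ⟨
  ∑[ nu ← Box M (suc R) ] ∑[ mu ← decs nu ] F mu nu ∎
  where
  G : ℕ → ℕ → ℤ
  G m v = ∑[ mu ← Box M R ] F (m ∷ mu) (v ∷ mu)
  -- A box in the first row shifts the index by one: the top value on the left leaves the range and
  -- vanishes by `F0`, the value 0 on the right has no box to lose. Only the range of the first row
  -- is generalised to `K`; the box of the other rows stays fixed.
  heads : ∀ K → (∀ mu nu → ¬ All (λ m → suc m < K) mu → F mu nu ≡ 0ℤ) →
    ∑[ m ← upTo K ] G m (suc m) ≡ ∑[ v ← upTo K ] ∑[ nu ← Box M R ] ∑[ mu ← decHead v nu ] F mu (v ∷ nu)
  heads zero _ = trans ∑-[] (sym ∑-[])
  heads (suc K) F0 = begin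
    ∑[ m ← upTo (suc K) ] G m (suc m)        ≡⟨ ∑-upTo-last K ⟩
    ∑[ m ← upTo K ] G m (suc m) + G K (suc K)
      ≡⟨ cong (_+_ (∑[ m ← upTo K ] G m (suc m))) (∑-0 (Box M R) (λ mu → F0 _ _ (λ { (q ∷ _) → ℕₚ.<-irrefl refl q }))) ⟩
    ∑[ m ← upTo K ] G m (suc m) + 0ℤ         ≡⟨ +-comm _ 0ℤ ⟩
    0ℤ + ∑[ m ← upTo K ] G m (suc m)
      ≡⟨ cong₂ _+_ (sym (∑-0 (Box M R) (λ nu → ∑-[]))) (∑-cong (upTo K) (λ v → ∑-cong (Box M R) (λ nu → sym ∑-[x]))) ⟩
    H 0 + ∑[ v ← upTo K ] H (suc v)          ≡⟨ ∑-upTo-suc K ⟨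
    ∑[ v ← upTo (suc K) ] H v ∎
    where
    H : ℕ → ℤ
    H v = ∑[ nu ← Box M R ] ∑[ mu ← decHead v nu ] F mu (v ∷ nu)

-- Weakly decreasing sequences bounded by b whose last entry vanishes, so that
-- every box addable to the diagram lies within the given number of rows.
data Shape : ℕ → List ℕ → Set where
  last : ∀ {b} → Shape b (0 ∷ [])
  _∷_  : ∀ {b l la} → l ≤ b → Shape l la → Shape b (l ∷ la)

Shape-≤ : ∀ {b la} → Shape b la → All (_≤ b) la
Shape-≤ last = z≤n ∷ []
Shape-≤ (p ∷ s) = p ∷ All.map (λ q → ℕₚ.≤-trans q p) (Shape-≤ s)

incs-≤ : ∀ {b la} → All (_≤ b) la → All (All (_≤ suc b)) (incs la)
incs-≤ [] = []
incs-≤ (p ∷ ps) = (s≤s p ∷ All.map ℕₚ.m≤n⇒m≤1+n ps) ∷ Allₚ.map⁺ (All.map (ℕₚ.m≤n⇒m≤1+n p ∷_) (incs-≤ ps))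

hsp-∷ : ∀ p l la m mu → hsp p (l ∷ la) (m ∷ mu) ≡ true → l ≤ p × m ≤ l × hsp m la mu ≡ true
hsp-∷ p l la m mu e =
  let e₁ , e₂ = ∧-true {l ≤ᵇ p} e ; e₃ , e₄ = ∧-true {m ≤ᵇ l} e₂ in ≤ᵇ⇒≤ l p e₁ , ≤ᵇ⇒≤ m l e₃ , e₄

-- By interlacing, consecutive entries of `mu` are separated by an entry of `la`, so `mu` decreases;
-- its last entry is at most the final 0 of `la`.
hsp-Shape : ∀ {p b la} mu → Shape b la → hsp p la mu ≡ true → Shape b mu
hsp-Shape {p} {la = 0 ∷ []} (m ∷ []) last e with hsp-∷ p 0 [] m [] e
... | _ , z≤n , _ = last
hsp-Shape {p} {la = 0 ∷ []} (m ∷ k ∷ mu) last e with hsp-∷ p 0 [] m (k ∷ mu) e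
... | _ , _ , ()
hsp-Shape {p} {la = l ∷ la} (m ∷ mu) (l≤b ∷ s) e with hsp-∷ p l la m mu e
... | _ , m≤l , e' = ℕₚ.≤-trans m≤l l≤b ∷ tail s mu e'
  where
  tail : ∀ {l la} → Shape l la → ∀ mu → hsp m la mu ≡ true → Shape m mu
  tail {la = l' ∷ la} s (m' ∷ mu) e with hsp-∷ m l' la m' mu e | hsp-Shape {m} (m' ∷ mu) s e
  ... | _ | last = last
  ... | l'≤m , m'≤l' , _ | _ ∷ s' = ℕₚ.≤-trans m'≤l' l'≤m ∷ s'

hsp-sum : ∀ {p} la mu → hsp p la mu ≡ true → sum mu ≤ sum la
hsp-sum [] [] e = z≤n
hsp-sum {p} (l ∷ la) (m ∷ mu) e with hsp-∷ p l la m mu e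
... | _ , m≤l , e' = ℕₚ.+-mono-≤ m≤l (hsp-sum la mu e')

hsp-pred : ∀ {v l la nu} → length nu ≡ length (l ∷ la) →
  hsp v (l ∷ la) nu ≡ (l ≤ᵇ v) ∧ hsp (suc v) (l ∷ la) nu
hsp-pred {v} {l} {la} {m ∷ nu} e = ≡-of-true
  (λ p → let p₁ , p₂ = ∧-true {l ≤ᵇ v} p in
     ∧-intro p₁ (∧-intro (≤⇒≤ᵇ (ℕₚ.m≤n⇒m≤1+n (≤ᵇ⇒≤ l v p₁))) p₂))
  (λ p → let p₁ , p₂ = ∧-true {l ≤ᵇ v} p in ∧-intro p₁ (proj₂ (∧-true {l ≤ᵇ suc v} p₂)))

head₀ : List ℕ → ℕ
head₀ [] = 0
head₀ (l ∷ la) = l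

-- Adding a box to row i + 1 of λ corresponds to removing one from row i of ν, and adding
-- a box to the first row of λ to leaving ν unchanged.
∑-hsp-incs : ∀ {p b la} nu → Shape b la → length nu ≡ length la → weaklyDecᵇ (p ∷ nu) ≡ true →
  ∑[ x ← incs la ] ⟦ hsp p x nu ⟧ ≡ ∑[ x ← decs nu ] ⟦ hsp p la x ⟧ + ⟦ (head₀ la <ᵇ p) ∧ hsp p la nu ⟧
∑-hsp-incs {p} (zero ∷ []) last len wd = begin
  ∑[ x ← incs (0 ∷ []) ] ⟦ hsp p x (0 ∷ []) ⟧   ≡⟨ ∑-[x] ⟩
  ⟦ (0 <ᵇ p) ∧ true ⟧                           ≡⟨ +-identityˡ _ ⟨
  0ℤ + ⟦ (0 <ᵇ p) ∧ true ⟧                      ≡⟨ cong (_+ ⟦ (0 <ᵇ p) ∧ true ⟧) ∑-[] ⟨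
  ∑[ x ← [] ] ⟦ hsp p (0 ∷ []) x ⟧ + ⟦ (0 <ᵇ p) ∧ true ⟧ ∎
∑-hsp-incs {suc p} (suc zero ∷ []) last len wd = begin
  ∑[ x ← incs (0 ∷ []) ] ⟦ hsp (suc p) x (1 ∷ []) ⟧     ≡⟨ ∑-[x] ⟩
  1ℤ                                                    ≡⟨ +-identityʳ _ ⟨
  1ℤ + 0ℤ                                               ≡⟨ cong (_+ 0ℤ) ∑-[x] ⟨
  ∑[ x ← (0 ∷ []) ∷ [] ] ⟦ hsp (suc p) (0 ∷ []) x ⟧ + 0ℤ ∎
∑-hsp-incs {p} (suc (suc v) ∷ []) last len wd = begin
  ∑[ x ← incs (0 ∷ []) ] ⟦ hsp p x (suc (suc v) ∷ []) ⟧        ≡⟨ ∑-[x] ⟩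
  ⟦ (0 <ᵇ p) ∧ false ⟧                                         ≡⟨ +-identityˡ _ ⟨
  0ℤ + ⟦ (0 <ᵇ p) ∧ false ⟧                                    ≡⟨ cong (_+ ⟦ (0 <ᵇ p) ∧ false ⟧) ∑-[x] ⟨
  ∑[ x ← (suc v ∷ []) ∷ [] ] ⟦ hsp p (0 ∷ []) x ⟧ + ⟦ (0 <ᵇ p) ∧ false ⟧ ∎
∑-hsp-incs {p} {la = l ∷ l' ∷ la} (v ∷ nu) (_ ∷ sh) len wd = begin
  ∑[ x ← incs (l ∷ la') ] ⟦ hsp p x (v ∷ nu) ⟧
    ≡⟨ ∑-incs l la' _ ⟩
  ⟦ (l <ᵇ p) ∧ (v ≤ᵇ suc l) ∧ Hv ⟧ + ∑[ x ← incs la' ] ⟦ (l ≤ᵇ p) ∧ (v ≤ᵇ l) ∧ hsp v x nu ⟧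
    ≡⟨ cong (_+_ ⟦ (l <ᵇ p) ∧ (v ≤ᵇ suc l) ∧ Hv ⟧) (trans (pull (incs la') (λ x → hsp v x nu))
         (cong (⟦ (l ≤ᵇ p) ∧ (v ≤ᵇ l) ⟧ *_) (∑-hsp-incs nu sh (ℕₚ.suc-injective len) (proj₂ (∧-true {v ≤ᵇ p} wd))))) ⟩
  ⟦ (l <ᵇ p) ∧ (v ≤ᵇ suc l) ∧ Hv ⟧ + ⟦ (l ≤ᵇ p) ∧ (v ≤ᵇ l) ⟧ * (D + ⟦ (l' <ᵇ v) ∧ Hv ⟧)
    ≡⟨ regroup ⟦ (l <ᵇ p) ∧ (v ≤ᵇ suc l) ∧ Hv ⟧ ⟦ (l ≤ᵇ p) ∧ (v ≤ᵇ l) ⟧ D ⟦ (l' <ᵇ v) ∧ Hv ⟧ ⟩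
  (⟦ (l <ᵇ p) ∧ (v ≤ᵇ suc l) ∧ Hv ⟧ + ⟦ (l ≤ᵇ p) ∧ (v ≤ᵇ l) ⟧ * ⟦ (l' <ᵇ v) ∧ Hv ⟧) + ⟦ (l ≤ᵇ p) ∧ (v ≤ᵇ l) ⟧ * D
    ≡⟨ cong (_+ ⟦ (l ≤ᵇ p) ∧ (v ≤ᵇ l) ⟧ * D) (trans core (cong (_+ ⟦ (l <ᵇ p) ∧ hsp p (l ∷ la') (v ∷ nu) ⟧) (sym (top v refl)))) ⟩
  (∑[ x ← decHead v nu ] ⟦ hsp p (l ∷ la') x ⟧ + ⟦ (l <ᵇ p) ∧ hsp p (l ∷ la') (v ∷ nu) ⟧) + ⟦ (l ≤ᵇ p) ∧ (v ≤ᵇ l) ⟧ * D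
    ≡⟨ swap₃ (∑[ x ← decHead v nu ] ⟦ hsp p (l ∷ la') x ⟧) _ _ ⟩
  (∑[ x ← decHead v nu ] ⟦ hsp p (l ∷ la') x ⟧ + ⟦ (l ≤ᵇ p) ∧ (v ≤ᵇ l) ⟧ * D) + ⟦ (l <ᵇ p) ∧ hsp p (l ∷ la') (v ∷ nu) ⟧
    ≡⟨ cong (λ z → (∑[ x ← decHead v nu ] ⟦ hsp p (l ∷ la') x ⟧ + z) + ⟦ (l <ᵇ p) ∧ hsp p (l ∷ la') (v ∷ nu) ⟧) (pull (decs nu) (λ x → hsp v la' x)) ⟨
  (∑[ x ← decHead v nu ] ⟦ hsp p (l ∷ la') x ⟧ + ∑[ x ← decs nu ] ⟦ hsp p (l ∷ la') (v ∷ x) ⟧) + ⟦ (l <ᵇ p) ∧ hsp p (l ∷ la') (v ∷ nu) ⟧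
    ≡⟨ cong (_+ ⟦ (l <ᵇ p) ∧ hsp p (l ∷ la') (v ∷ nu) ⟧) (∑-decs v nu _) ⟨
  ∑[ x ← decs (v ∷ nu) ] ⟦ hsp p (l ∷ la') x ⟧ + ⟦ (l <ᵇ p) ∧ hsp p (l ∷ la') (v ∷ nu) ⟧ ∎
  where
  la' = l' ∷ la
  Hv = hsp v la' nu
  D = ∑[ x ← decs nu ] ⟦ hsp v la' x ⟧
  pull : ∀ {A : Set} (xs : List A) (h : A → Bool) →
    ∑[ x ← xs ] ⟦ (l ≤ᵇ p) ∧ (v ≤ᵇ l) ∧ h x ⟧ ≡ ⟦ (l ≤ᵇ p) ∧ (v ≤ᵇ l) ⟧ * ∑[ x ← xs ] ⟦ h x ⟧
  pull xs h = trans (∑-cong xs (λ x → trans (cong ⟦_⟧ (sym (Bₚ.∧-assoc (l ≤ᵇ p) _ _))) (⟦∧⟧ ((l ≤ᵇ p) ∧ (v ≤ᵇ l)) (h x)))) (∑-*ˡ xs _ _)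
  opaque
    unfolding _+_
    regroup : ∀ a b c d → a + b * (c + d) ≡ (a + b * d) + b * c
    regroup = solve-∀
    swap₃ : ∀ a b c → (a + b) + c ≡ (a + c) + b
    swap₃ = solve-∀
  top : ∀ w → w ≡ v → ∑[ x ← decHead w nu ] ⟦ hsp p (l ∷ la') x ⟧ ≡ ⟦ (l ≤ᵇ p) ∧ (w ≤ᵇ suc l) ∧ ((l' <ᵇ w) ∧ hsp w la' nu) ⟧
  top zero e = trans ∑-[] (sym (cong ⟦_⟧ (Bₚ.∧-zeroʳ (l ≤ᵇ p))))
  top (suc w) e = trans ∑-[x] (cong (λ b → ⟦ (l ≤ᵇ p) ∧ b ⟧) (cong₂ _∧_ (sym (≤ᵇ-suc w l))
    (trans (hsp-pred {w} {l'} {la} {nu} (ℕₚ.suc-injective len)) (cong (_∧ hsp (suc w) la' nu) (sym (≤ᵇ-suc l' w))))))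
  v≤p : v ≤ p
  v≤p = ≤ᵇ⇒≤ v p (proj₁ (∧-true {v ≤ᵇ p} wd))
  l'≤l : l' ≤ l
  l'≤l = All.head (Shape-≤ sh)
  -- On the left the new box lies in the first or second row of λ; on the right `nu` loses a box of
  -- its first row or stays unchanged. For `v ≤ l` the terms match crosswise. For `v = l + 1` the
  -- box in the first row of λ matches the box lost by `nu`, and the other two terms vanish. For
  -- `v > l + 1` all four vanish.
  core : ⟦ (l <ᵇ p) ∧ (v ≤ᵇ suc l) ∧ Hv ⟧ + ⟦ (l ≤ᵇ p) ∧ (v ≤ᵇ l) ⟧ * ⟦ (l' <ᵇ v) ∧ Hv ⟧ ≡
         ⟦ (l ≤ᵇ p) ∧ (v ≤ᵇ suc l) ∧ ((l' <ᵇ v) ∧ Hv) ⟧ + ⟦ (l <ᵇ p) ∧ ((l ≤ᵇ p) ∧ (v ≤ᵇ l) ∧ Hv) ⟧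
  core with ℕₚ.<-cmp v (suc l)
  ... | tri< v<l+1 _ _ rewrite ≤⇒≤ᵇ (ℕₚ.<⇒≤ v<l+1) | ≤⇒≤ᵇ (ℕₚ.≤-pred v<l+1) | Bₚ.∧-identityʳ (l ≤ᵇ p) = begin
    ⟦ (l <ᵇ p) ∧ Hv ⟧ + ⟦ l ≤ᵇ p ⟧ * ⟦ (l' <ᵇ v) ∧ Hv ⟧       ≡⟨ +-comm _ _ ⟩
    ⟦ l ≤ᵇ p ⟧ * ⟦ (l' <ᵇ v) ∧ Hv ⟧ + ⟦ (l <ᵇ p) ∧ Hv ⟧       ≡⟨ cong₂ _+_ (sym (⟦∧⟧ (l ≤ᵇ p) _)) (cong ⟦_⟧ absorb) ⟩
    ⟦ (l ≤ᵇ p) ∧ ((l' <ᵇ v) ∧ Hv) ⟧ + ⟦ (l <ᵇ p) ∧ ((l ≤ᵇ p) ∧ Hv) ⟧ ∎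
    where
    absorb : (l <ᵇ p) ∧ Hv ≡ (l <ᵇ p) ∧ ((l ≤ᵇ p) ∧ Hv)
    absorb with l <ᵇ p in eq
    ... | false = refl
    ... | true = cong (_∧ Hv) (sym (≤⇒≤ᵇ (ℕₚ.<⇒≤ (<ᵇ⇒< l p eq))))
  ... | tri≈ _ refl _ rewrite >⇒≤ᵇ {suc l} {l} ℕₚ.≤-refl | ≤⇒≤ᵇ (ℕₚ.≤-refl {suc l}) | <⇒<ᵇ v≤p | ≤⇒≤ᵇ (ℕₚ.<⇒≤ v≤p) | <⇒<ᵇ (s≤s l'≤l) =
    cong (_+_ ⟦ Hv ⟧) (*-zeroˡ _)
  ... | tri> _ _ l+1<v rewrite >⇒≤ᵇ (ℕₚ.<-trans (ℕₚ.n<1+n l) l+1<v) | >⇒≤ᵇ l+1<v | Bₚ.∧-zeroʳ (l ≤ᵇ p) | Bₚ.∧-zeroʳ (l <ᵇ p) =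
    cong (_+_ 0ℤ) (*-zeroˡ _)

-- Vanishing of tableau sums.

strictBelow-length : ∀ r r' → strictBelowᵇ r r' ≡ true → length r' ≤ length r
strictBelow-length r [] e = z≤n
strictBelow-length (a ∷ r) (b ∷ r') e = s≤s (strictBelow-length r r' (proj₂ (∧-true {a <ᵇ b} e)))

colsStrict-weaklyDec : ∀ {n la t} → Fits n la t → colsStrictᵇ t ≡ true → weaklyDecᵇ la ≡ true
colsStrict-weaklyDec [] e = refl
colsStrict-weaklyDec (_ ∷ []) e = refl
colsStrict-weaklyDec {t = r ∷ r' ∷ t} ((refl , _) ∷ (refl , p) ∷ fits) e =
  let e₁ , e₂ = ∧-true {strictBelowᵇ r r'} e in
  ∧-intro (≤⇒≤ᵇ (strictBelow-length r r' e₁)) (colsStrict-weaklyDec ((refl , p) ∷ fits) e₂)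

-- Strict columns force every row to be at most as long as the one below it. This removes the
-- sequences that are not partitions from the sums over `Box` and `incs`.
ssytSum-weaklyDec : ∀ n la (α : Vec ℕ n) f → weaklyDecᵇ la ≡ false → ssytSum n la α f ≡ 0ℤ
ssytSum-weaklyDec n la α f wd = ∑-0All (fillings-Fits n la) (λ t fits → trans (cong (λ b → ⟦ b ⟧ * f t) (no-SSYT t fits)) (*-zeroˡ (f t)))
  where
  no-SSYT : ∀ t → Fits n la t → isSSYTᵇ t ∧ eqVecᵇ (content n t) α ≡ false
  no-SSYT t fits = ≢true (λ p → case-⊥ (colsStrict-weaklyDec fits (proj₂ (∧-true {allᵇ rowWeakᵇ t} (proj₁ (∧-true {isSSYTᵇ t} p))))))
    where
    case-⊥ : weaklyDecᵇ la ≡ true → ⊥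
    case-⊥ q with trans (sym q) wd
    ... | ()

fillings-[] : ∀ la → ¬ sum la ≡ 0 → fillings la [] ≡ []
fillings-[] [] p = ⊥-elim (p refl)
fillings-[] (zero ∷ la) p rewrite fillings-[] la p = refl
fillings-[] (suc l ∷ la) p = refl

All-≤-sum : ∀ la → All (_≤ sum la) la
All-≤-sum [] = []
All-≤-sum (l ∷ la) = ℕₚ.m≤m+n l (sum la) ∷ All.map (λ q → ℕₚ.≤-trans q (ℕₚ.m≤n+m (sum la) l)) (All-≤-sum la)

sum-∷ʳ : ∀ {n} (β : Vec ℕ n) a → V.sum (β V.∷ʳ a) ≡ V.sum β ℕ.+ a
sum-∷ʳ V.[] a = ℕₚ.+-identityʳ a
sum-∷ʳ (b V.∷ β) a = trans (cong (b ℕ.+_) (sum-∷ʳ β a)) (sym (ℕₚ.+-assoc b _ a))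

-- Allows a fact proved only for horizontal strips of the right size to be used under a sum over all
-- of `Box`.
kernel-true : ∀ M la mu a {x y} → (hsp M la mu ≡ true → sum la ≡ sum mu ℕ.+ a → x ≡ y) →
  kernel M la mu a * x ≡ kernel M la mu a * y
kernel-true M la mu a {x} {y} p with hsp M la mu | sum la ≡ᵇ sum mu ℕ.+ a in eq
... | false | _ = trans (*-zeroˡ x) (sym (*-zeroˡ y))
... | true | false = trans (*-zeroˡ x) (sym (*-zeroˡ y))
... | true | true = cong (1ℤ *_) (p refl (≡ᵇ⇒≡ (sum la) _ eq))

-- Peeling the last letter lowers the number of boxes and the total degree by the same `a`; without
-- letters only a diagram without boxes can be filled.
ssytSum-size : ∀ n la (α : Vec ℕ n) f → ¬ sum la ≡ V.sum α → ssytSum n la α f ≡ 0ℤ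
ssytSum-size zero la V.[] f p rewrite fillings-[] la p = ∑-[]
ssytSum-size (suc n) la α f p with V.initLast α
... | β , a , refl = trans (ssytSum-peel n la β a f (All.map s≤s (All-≤-sum la)))
  (∑-0 (Box (suc (sum la)) (length la)) (λ mu → trans
    (kernel-true (suc (sum la)) la mu a (λ _ e → ssytSum-size n mu β _ (λ q → p (trans e (trans (cong (ℕ._+ a) q) (sym (sum-∷ʳ β a)))))))
    (*-zeroʳ _)))

-- mulVar j is multiplication by the variable x_{j+1}, acting on coefficient functions.
mulVar : ∀ {n} → ℕ → (Vec ℕ n → ℤ) → Vec ℕ n → ℤ
mulVar j f V.[] = 0ℤ
mulVar zero f (zero V.∷ α) = 0ℤ
mulVar zero f (suc a V.∷ α) = f (a V.∷ α)
mulVar (suc j) f (a V.∷ α) = mulVar j (λ α → f (a V.∷ α)) α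

mulVar-cong : ∀ {n} j {f g : Vec ℕ n → ℤ} → (∀ α → f α ≡ g α) → ∀ α → mulVar j f α ≡ mulVar j g α
mulVar-cong j p V.[] = refl
mulVar-cong zero p (zero V.∷ α) = refl
mulVar-cong zero p (suc a V.∷ α) = p _
mulVar-cong (suc j) p (a V.∷ α) = mulVar-cong j (λ α → p _) α

mulVar-0 : ∀ {n} j (α : Vec ℕ n) → mulVar j (λ _ → 0ℤ) α ≡ 0ℤ
mulVar-0 j V.[] = refl
mulVar-0 zero (zero V.∷ α) = refl
mulVar-0 zero (suc a V.∷ α) = refl
mulVar-0 (suc j) (a V.∷ α) = mulVar-0 j α

mulVar-+ : ∀ {n} j (f g : Vec ℕ n → ℤ) α → mulVar j (λ α → f α + g α) α ≡ mulVar j f α + mulVar j g α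
mulVar-+ j f g V.[] = sym (+-identityˡ 0ℤ)
mulVar-+ zero f g (zero V.∷ α) = sym (+-identityˡ 0ℤ)
mulVar-+ zero f g (suc a V.∷ α) = refl
mulVar-+ (suc j) f g (a V.∷ α) = mulVar-+ j _ _ α

mulVar-* : ∀ {n} j c (f : Vec ℕ n → ℤ) α → mulVar j (λ α → c * f α) α ≡ c * mulVar j f α
mulVar-* j c f V.[] = sym (*-zeroʳ c)
mulVar-* zero c f (zero V.∷ α) = sym (*-zeroʳ c)
mulVar-* zero c f (suc a V.∷ α) = refl
mulVar-* (suc j) c f (a V.∷ α) = mulVar-* j c _ α

mulVar-∑ : ∀ {n} {A : Set} j (xs : List A) (F : A → Vec ℕ n → ℤ) α →
  mulVar j (λ α → ∑[ x ← xs ] F x α) α ≡ ∑[ x ← xs ] mulVar j (F x) α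
mulVar-∑ j [] F α = trans (mulVar-cong j (λ _ → ∑-[]) α) (trans (mulVar-0 j α) (sym ∑-[]))
mulVar-∑ j (x ∷ xs) F α = trans (mulVar-cong j (λ _ → ∑-∷) α) (trans (mulVar-+ j (F x) _ α)
  (trans (cong (_+_ (mulVar j (F x) α)) (mulVar-∑ j xs F α)) (sym ∑-∷)))

mulVar-∷ʳ : ∀ {n j} → j < n → (f : Vec ℕ (suc n) → ℤ) → ∀ β a → mulVar j f (β V.∷ʳ a) ≡ mulVar j (λ β → f (β V.∷ʳ a)) β
mulVar-∷ʳ {suc n} {zero} p f (zero V.∷ β) a = refl
mulVar-∷ʳ {suc n} {zero} p f (suc b V.∷ β) a = refl
mulVar-∷ʳ {suc n} {suc j} (s≤s p) f (b V.∷ β) a = mulVar-∷ʳ p _ β a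

mulVar-last-zero : ∀ n (f : Vec ℕ (suc n) → ℤ) β → mulVar n f (β V.∷ʳ 0) ≡ 0ℤ
mulVar-last-zero zero f V.[] = refl
mulVar-last-zero (suc n) f (b V.∷ β) = mulVar-last-zero n _ β

mulVar-last-suc : ∀ n (f : Vec ℕ (suc n) → ℤ) β a → mulVar n f (β V.∷ʳ suc a) ≡ f (β V.∷ʳ a)
mulVar-last-suc zero f V.[] a = refl
mulVar-last-suc (suc n) f (b V.∷ β) a = mulVar-last-suc n _ β a

mulVar-comm : ∀ {n} i j (f : Vec ℕ n → ℤ) α → mulVar i (mulVar j f) α ≡ mulVar j (mulVar i f) α
mulVar-comm i j f V.[] = refl
mulVar-comm zero zero f α = refl
mulVar-comm zero (suc j) f (zero V.∷ α) = sym (mulVar-0 j α)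
mulVar-comm zero (suc j) f (suc a V.∷ α) = refl
mulVar-comm (suc i) zero f (zero V.∷ α) = mulVar-0 i α
mulVar-comm (suc i) zero f (suc a V.∷ α) = refl
mulVar-comm (suc i) (suc j) f (a V.∷ α) = mulVar-comm i j _ α

mulSum : ∀ n → (Vec ℕ n → ℤ) → Vec ℕ n → ℤ
mulSum n f α = ∑[ j ← upTo n ] mulVar j f α

mulSum-cong : ∀ n {f g : Vec ℕ n → ℤ} → (∀ α → f α ≡ g α) → ∀ α → mulSum n f α ≡ mulSum n g α
mulSum-cong n p α = ∑-cong (upTo n) (λ j → mulVar-cong j p α)

mulSum-+ : ∀ n (f g : Vec ℕ n → ℤ) α → mulSum n (λ α → f α + g α) α ≡ mulSum n f α + mulSum n g α
mulSum-+ n f g α = trans (∑-cong (upTo n) (λ j → mulVar-+ j f g α)) (∑-+ (upTo n) _ _)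

mulSum-* : ∀ n c (f : Vec ℕ n → ℤ) α → mulSum n (λ α → c * f α) α ≡ c * mulSum n f α
mulSum-* n c f α = trans (∑-cong (upTo n) (λ j → mulVar-* j c f α)) (∑-*ˡ (upTo n) c _)

mulSum-∑ : ∀ n {A : Set} (xs : List A) (c : A → ℤ) (F : A → Vec ℕ n → ℤ) α →
  mulSum n (λ α → ∑[ x ← xs ] (c x * F x α)) α ≡ ∑[ x ← xs ] (c x * mulSum n (F x) α)
mulSum-∑ n xs c F α = begin
  ∑[ j ← upTo n ] mulVar j (λ α → ∑[ x ← xs ] (c x * F x α)) α
    ≡⟨ ∑-cong (upTo n) (λ j → trans (mulVar-∑ j xs _ α) (∑-cong xs (λ x → mulVar-* j (c x) (F x) α))) ⟩
  ∑[ j ← upTo n ] ∑[ x ← xs ] (c x * mulVar j (F x) α)   ≡⟨ ∑-swap (upTo n) xs _ ⟩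
  ∑[ x ← xs ] ∑[ j ← upTo n ] (c x * mulVar j (F x) α)   ≡⟨ ∑-cong xs (λ x → ∑-*ˡ (upTo n) (c x) _) ⟩
  ∑[ x ← xs ] (c x * mulSum n (F x) α) ∎

mulSum-mulVar : ∀ n i (f : Vec ℕ n → ℤ) α → mulSum n (mulVar i f) α ≡ mulVar i (mulSum n f) α
mulSum-mulVar n i f α = trans (∑-cong (upTo n) (λ j → mulVar-comm j i f α)) (sym (mulVar-∑ i (upTo n) (λ j → mulVar j f) α))

-- Splits `p` into the first `n` variables, to which the induction in `Pieri` applies, and the last
-- one.
mulSum-∷ʳ : ∀ n (f : Vec ℕ (suc n) → ℤ) β a → mulSum (suc n) f (β V.∷ʳ a) ≡ mulSum n (λ β → f (β V.∷ʳ a)) β + mulVar n f (β V.∷ʳ a)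
mulSum-∷ʳ n f β a = trans (∑-upTo-last n) (cong (_+ mulVar n f (β V.∷ʳ a)) (∑-congAll (upTo-< n) (λ j p → mulVar-∷ʳ p f β a)))

-- Pieri's rule for one box.

schurℤ : ∀ n → List ℕ → Vec ℕ n → ℤ
schurℤ n la α = ssytSum n la α (λ _ → 1ℤ)

Shape-bound : ∀ {M b la} → Shape b la → suc b < M → All (_< M) la
Shape-bound sh b<M = All.map (λ q → ℕₚ.≤-<-trans q (ℕₚ.<-trans (ℕₚ.n<1+n _) b<M)) (Shape-≤ sh)

kernel-split : ∀ M la mu a → kernel M la mu a ≡ ⟦ hsp M la mu ⟧ * ⟦ sum la ≡ᵇ sum mu ℕ.+ a ⟧
kernel-split M la mu a = ⟦∧⟧ (hsp M la mu) _

∑-kernel-decs : ∀ {M} la nu a →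
  ∑[ mu ← decs nu ] kernel M la mu a ≡ ∑[ mu ← decs nu ] ⟦ hsp M la mu ⟧ * ⟦ suc (sum la) ≡ᵇ sum nu ℕ.+ a ⟧
∑-kernel-decs la nu a = trans (∑-congAll (decs-sum nu) (λ mu (e , _) → trans (kernel-split _ la mu a)
  (cong (λ k → _ * ⟦ suc (sum la) ≡ᵇ k ℕ.+ a ⟧) e))) (∑-*ʳ (decs nu) _ _)

-- Pieri's rule seen in the last variable alone: the second summand on the left comes from
-- multiplying by that variable. Since `M` exceeds the entries of `la`, the side condition of the
-- extra term in `∑-hsp-incs` holds.
kernel-Pieri : ∀ {M b la} nu a → Shape b la → suc b < M → length nu ≡ length la → All (_< M) nu → weaklyDecᵇ nu ≡ true →
  ∑[ mu ← decs nu ] kernel M la mu a + ⟦ hsp M la nu ∧ (suc (sum la) ≡ᵇ sum nu ℕ.+ a) ⟧ ≡ ∑[ x ← incs la ] kernel M x nu a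
kernel-Pieri {M} {b} {la} nu a sh b<M len nu<M wd = begin
  ∑[ mu ← decs nu ] kernel M la mu a + ⟦ hsp M la nu ∧ (suc (sum la) ≡ᵇ sum nu ℕ.+ a) ⟧
    ≡⟨ cong₂ _+_ (∑-kernel-decs la nu a) (⟦∧⟧ (hsp M la nu) _) ⟩
  ∑[ mu ← decs nu ] ⟦ hsp M la mu ⟧ * δ + ⟦ hsp M la nu ⟧ * δ
    ≡⟨ factor _ _ δ ⟩
  (∑[ mu ← decs nu ] ⟦ hsp M la mu ⟧ + ⟦ hsp M la nu ⟧) * δ
    ≡⟨ cong (λ b → (∑[ mu ← decs nu ] ⟦ hsp M la mu ⟧ + ⟦ b ∧ hsp M la nu ⟧) * δ) (sym (<⇒<ᵇ (head< (Shape-bound sh b<M)))) ⟩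
  (∑[ mu ← decs nu ] ⟦ hsp M la mu ⟧ + ⟦ (head₀ la <ᵇ M) ∧ hsp M la nu ⟧) * δ
    ≡⟨ cong (_* δ) (∑-hsp-incs nu sh len (wd∷ nu nu<M wd)) ⟨
  ∑[ x ← incs la ] ⟦ hsp M x nu ⟧ * δ
    ≡⟨ ∑-*ʳ (incs la) _ _ ⟨
  ∑[ x ← incs la ] (⟦ hsp M x nu ⟧ * δ)
    ≡⟨ ∑-congAll (incs-sum la) (λ x (e , _) → sym (trans (kernel-split M x nu a) (cong (λ k → ⟦ hsp M x nu ⟧ * ⟦ k ≡ᵇ sum nu ℕ.+ a ⟧) e))) ⟩
  ∑[ x ← incs la ] kernel M x nu a ∎
  where
  δ = ⟦ suc (sum la) ≡ᵇ sum nu ℕ.+ a ⟧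
  opaque
    unfolding _+_
    factor : ∀ x y z → x * z + y * z ≡ (x + y) * z
    factor = solve-∀
  head< : ∀ {la} → All (_< M) la → head₀ la < M
  head< [] = ℕₚ.≤-<-trans z≤n b<M
  head< (p ∷ _) = p
  wd∷ : ∀ nu → All (_< M) nu → weaklyDecᵇ nu ≡ true → weaklyDecᵇ (M ∷ nu) ≡ true
  wd∷ [] _ e = refl
  wd∷ (v ∷ nu) (q ∷ _) e = ∧-intro (≤⇒≤ᵇ (ℕₚ.<⇒≤ q)) e

-- Peel the last letter. By induction the other variables remove a strip and then add a box, and the
-- last variable makes the strip one box longer; `kernel-Pieri` identifies the total with adding a
-- box first and removing a strip afterwards. The bound `suc b < M` keeps the enlarged shapes inside
-- the box.
Pieri : ∀ {M b la} n (α : Vec ℕ n) → Shape b la → suc b < M → mulSum n (schurℤ n la) α ≡ ∑[ x ← incs la ] schurℤ n x α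
Pieri {la = la} zero V.[] sh b<M = trans ∑-[] (sym (∑-0All (incs-sum la) (λ x (e , _) →
  ssytSum-size 0 x V.[] _ (λ q → ℕₚ.0≢1+n (trans (sym q) e)))))
Pieri {M} {b} {la} (suc n) α sh b<M with V.initLast α
... | β , a , refl = begin
  mulSum (suc n) (schurℤ (suc n) la) (β V.∷ʳ a)
    ≡⟨ mulSum-∷ʳ n _ β a ⟩
  mulSum n (λ β → schurℤ (suc n) la (β V.∷ʳ a)) β + mulVar n (schurℤ (suc n) la) (β V.∷ʳ a)
    ≡⟨ cong₂ _+_ first (second a) ⟩
  ∑[ nu ← Box M R ] ∑[ mu ← decs nu ] (kernel M la mu a * schurℤ n nu β) + ∑[ nu ← Box M R ] (⟦ hsp M la nu ∧ (suc (sum la) ≡ᵇ sum nu ℕ.+ a) ⟧ * schurℤ n nu β)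
    ≡⟨ ∑-+ (Box M R) _ _ ⟨
  ∑[ nu ← Box M R ] (∑[ mu ← decs nu ] (kernel M la mu a * schurℤ n nu β) + ⟦ hsp M la nu ∧ (suc (sum la) ≡ᵇ sum nu ℕ.+ a) ⟧ * schurℤ n nu β)
    ≡⟨ ∑-congAll (Box-All M R) (λ nu (len , nu<M) → pointwise nu len nu<M) ⟩
  ∑[ nu ← Box M R ] ∑[ x ← incs la ] (kernel M x nu a * schurℤ n nu β)
    ≡⟨ ∑-swap (Box M R) (incs la) _ ⟩
  ∑[ x ← incs la ] ∑[ nu ← Box M R ] (kernel M x nu a * schurℤ n nu β)
    ≡⟨ ∑-congAll (All.zip (incs-sum la , incs-≤ (Shape-≤ sh))) (λ x ((_ , len) , x≤) → sym (trans
         (ssytSum-peel n x β a _ (All.map (λ q → ℕₚ.≤-<-trans q b<M) x≤)) (cong (λ r → ∑[ nu ← Box M r ] (kernel M x nu a * schurℤ n nu β)) len))) ⟩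
  ∑[ x ← incs la ] schurℤ (suc n) x (β V.∷ʳ a) ∎
  where
  R = length la
  peel : ∀ β a → schurℤ (suc n) la (β V.∷ʳ a) ≡ ∑[ mu ← Box M R ] (kernel M la mu a * schurℤ n mu β)
  peel β a = ssytSum-peel n la β a _ (Shape-bound sh b<M)
  first : mulSum n (λ β → schurℤ (suc n) la (β V.∷ʳ a)) β ≡ ∑[ nu ← Box M R ] ∑[ mu ← decs nu ] (kernel M la mu a * schurℤ n nu β)
  first = begin
    mulSum n (λ β → schurℤ (suc n) la (β V.∷ʳ a)) β
      ≡⟨ mulSum-cong n (λ β → peel β a) β ⟩
    mulSum n (λ β → ∑[ mu ← Box M R ] (kernel M la mu a * schurℤ n mu β)) β
      ≡⟨ mulSum-∑ n (Box M R) _ (schurℤ n) β ⟩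
    ∑[ mu ← Box M R ] (kernel M la mu a * mulSum n (schurℤ n mu) β)
      ≡⟨ ∑-cong (Box M R) (λ mu → trans (kernel-true M la mu a (λ e _ → Pieri n β (hsp-Shape mu sh e) b<M)) (sym (∑-*ˡ (incs mu) _ _))) ⟩
    ∑[ mu ← Box M R ] ∑[ nu ← incs mu ] (kernel M la mu a * schurℤ n nu β)
      ≡⟨ ∑-incs-decs M R (λ mu nu → kernel M la mu a * schurℤ n nu β) (λ mu nu large →
           trans (kernel-true M la mu a {y = 0ℤ} (λ e _ → ⊥-elim (large (All.map (λ q → ℕₚ.≤-<-trans (s≤s q) b<M) (Shape-≤ (hsp-Shape mu sh e)))))) (*-zeroʳ _)) ⟩
    ∑[ nu ← Box M R ] ∑[ mu ← decs nu ] (kernel M la mu a * schurℤ n nu β) ∎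
  second : ∀ a → mulVar n (schurℤ (suc n) la) (β V.∷ʳ a) ≡ ∑[ nu ← Box M R ] (⟦ hsp M la nu ∧ (suc (sum la) ≡ᵇ sum nu ℕ.+ a) ⟧ * schurℤ n nu β)
  -- With exponent 0 the shape `nu`, contained in `la`, would need one box more than `la`.
  second zero = trans (mulVar-last-zero n _ β) (sym (∑-0 (Box M R) (λ nu → trans
    (cong (λ b → ⟦ b ⟧ * schurℤ n nu β) (≢true (λ p → let p₁ , p₂ = ∧-true {hsp M la nu} p in
      ℕₚ.<⇒≱ (ℕₚ.n<1+n (sum la)) (ℕₚ.≤-trans (ℕₚ.≤-reflexive (trans (≡ᵇ⇒≡ (suc (sum la)) _ p₂) (ℕₚ.+-identityʳ _))) (hsp-sum la nu p₁)))))
    (*-zeroˡ _))))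
  second (suc a) = trans (mulVar-last-suc n _ β a) (trans (peel β a) (∑-cong (Box M R) (λ nu →
    cong (λ k → ⟦ hsp M la nu ∧ (suc (sum la) ≡ᵇ k) ⟧ * schurℤ n nu β) (sym (ℕₚ.+-suc (sum nu) a)))))
  pointwise : ∀ nu → length nu ≡ R → All (_< M) nu →
    ∑[ mu ← decs nu ] (kernel M la mu a * schurℤ n nu β) + ⟦ hsp M la nu ∧ (suc (sum la) ≡ᵇ sum nu ℕ.+ a) ⟧ * schurℤ n nu β ≡
    ∑[ x ← incs la ] (kernel M x nu a * schurℤ n nu β)
  pointwise nu len nu<M with weaklyDecᵇ nu in wd
  -- `kernel-Pieri` speaks of decreasing `nu` only; for the others the Schur factor kills both
  -- sides.
  ... | false rewrite ssytSum-weaklyDec n nu β (λ _ → 1ℤ) wd = trans (cong₂ _+_ (∑-0 (decs nu) (λ _ → *-zeroʳ _)) (*-zeroʳ _))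
    (trans (+-identityˡ 0ℤ) (sym (∑-0 (incs la) (λ _ → *-zeroʳ _))))
  ... | true = begin
    ∑[ mu ← decs nu ] (kernel M la mu a * schurℤ n nu β) + k * schurℤ n nu β ≡⟨ cong (_+ k * schurℤ n nu β) (∑-*ʳ (decs nu) (schurℤ n nu β) _) ⟩
    ∑[ mu ← decs nu ] kernel M la mu a * schurℤ n nu β + k * schurℤ n nu β   ≡⟨ factor _ k (schurℤ n nu β) ⟩
    (∑[ mu ← decs nu ] kernel M la mu a + k) * schurℤ n nu β            ≡⟨ cong (_* schurℤ n nu β) (kernel-Pieri nu a sh b<M len nu<M wd) ⟩
    ∑[ x ← incs la ] kernel M x nu a * schurℤ n nu β                    ≡⟨ ∑-*ʳ (incs la) (schurℤ n nu β) _ ⟨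
    ∑[ x ← incs la ] (kernel M x nu a * schurℤ n nu β) ∎
    where
    k = ⟦ hsp M la nu ∧ (suc (sum la) ≡ᵇ sum nu ℕ.+ a) ⟧
    opaque
      unfolding _+_
      factor : ∀ x y z → x * z + y * z ≡ (x + y) * z
      factor = solve-∀

-- Elementary symmetric polynomials.

∑-upTo-only : ∀ {M l} → l < M → (f : ℕ → ℤ) → (∀ m → ¬ m ≡ l → f m ≡ 0ℤ) → ∑ (upTo M) f ≡ f l
∑-upTo-only {suc M} {zero} p f f0 = trans (∑-upTo-suc M)
  (trans (cong (_+_ (f 0)) (∑-0 (upTo M) (λ m → f0 (suc m) (λ ())))) (+-identityʳ (f 0)))
∑-upTo-only {suc M} {suc l} (s≤s p) f f0 = trans (∑-upTo-suc M)
  (trans (cong₂ _+_ (f0 0 (λ ())) (∑-upTo-only p (f ∘ suc) (λ m q → f0 (suc m) (q ∘ ℕₚ.suc-injective)))) (+-identityˡ _))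

∑-upTo-two : ∀ {M l} → suc l < M → (f : ℕ → ℤ) → (∀ m → ¬ m ≡ l → ¬ m ≡ suc l → f m ≡ 0ℤ) →
  ∑ (upTo M) f ≡ f l + f (suc l)
∑-upTo-two {suc M} {zero} (s≤s p) f f0 = trans (∑-upTo-suc M)
  (cong (_+_ (f 0)) (∑-upTo-only p (f ∘ suc) (λ m q → f0 (suc m) (λ ()) (q ∘ ℕₚ.suc-injective))))
∑-upTo-two {suc M} {suc l} (s≤s p) f f0 = trans (∑-upTo-suc M)
  (trans (cong₂ _+_ (f0 0 (λ ()) (λ ()))
    (∑-upTo-two p (f ∘ suc) (λ m q r → f0 (suc m) (q ∘ ℕₚ.suc-injective) (r ∘ ℕₚ.suc-injective)))) (+-identityˡ _))

∑-Box-only : ∀ {M} c → All (_< M) c → (f : List ℕ → ℤ) → (∀ mu → length mu ≡ length c → ¬ mu ≡ c → f mu ≡ 0ℤ) →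
  ∑ (Box M (length c)) f ≡ f c
∑-Box-only [] [] f f0 = ∑-[x]
∑-Box-only {M} (l ∷ c) (p ∷ ps) f f0 = begin
  ∑ (Box M (suc (length c))) f                              ≡⟨ ∑-Box M (length c) ⟩
  ∑[ m ← upTo M ] ∑[ mu ← Box M (length c) ] f (m ∷ mu)
    ≡⟨ ∑-upTo-only p _ (λ m q → ∑-0All (Box-All M (length c)) (λ mu (len , _) → f0 _ (cong suc len) (q ∘ Lₚ.∷-injectiveˡ))) ⟩
  ∑[ mu ← Box M (length c) ] f (l ∷ mu)                     ≡⟨ ∑-Box-only c ps (f ∘ (l ∷_)) (λ mu len q → f0 _ (cong suc len) (q ∘ Lₚ.∷-injectiveʳ)) ⟩
  f (l ∷ c) ∎

-- The shape 1ᵏ, padded by `r` zeros so that it has the length prescribed by a `Box`.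
col : ℕ → ℕ → List ℕ
col k r = replicate k 1 ++ replicate r 0

col-length : ∀ k r → length (col k r) ≡ k ℕ.+ r
col-length zero r = Lₚ.length-replicate r
col-length (suc k) r = cong suc (col-length k r)

col-sum : ∀ k r → sum (col k r) ≡ k
col-sum zero zero = refl
col-sum zero (suc r) = col-sum zero r
col-sum (suc k) r = cong suc (col-sum k r)

col-< : ∀ {M} k r → 1 < M → All (_< M) (col k r)
col-< k r p = Allₚ.++⁺ (Allₚ.replicate⁺ k p) (Allₚ.replicate⁺ r (ℕₚ.<-trans (s≤s z≤n) p))

∑-hsp-zeros : ∀ {M} p r → 0 < M → (f : List ℕ → ℤ) →
  ∑[ mu ← Box M r ] (⟦ hsp p (replicate r 0) mu ⟧ * f mu) ≡ f (replicate r 0)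
∑-hsp-zeros p zero 0<M f = trans ∑-[x] (*-identityˡ _)
∑-hsp-zeros {M} p (suc r) 0<M f = begin
  ∑[ mu ← Box M (suc r) ] (⟦ hsp p (replicate (suc r) 0) mu ⟧ * f mu)   ≡⟨ ∑-Box M r ⟩
  ∑[ m ← upTo M ] ∑[ mu ← Box M r ] (⟦ (m ≤ᵇ 0) ∧ hsp m (replicate r 0) mu ⟧ * f (m ∷ mu))
    ≡⟨ ∑-upTo-only 0<M _ (λ { zero q → ⊥-elim (q refl) ; (suc m) _ → ∑-0 (Box M r) (λ _ → *-zeroˡ _) }) ⟩
  ∑[ mu ← Box M r ] (⟦ hsp 0 (replicate r 0) mu ⟧ * f (0 ∷ mu))         ≡⟨ ∑-hsp-zeros 0 r 0<M (f ∘ (0 ∷_)) ⟩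
  f (replicate (suc r) 0) ∎

-- A horizontal strip has at most one box in each column, so from a single column either nothing or
-- the top box is removed.
∑-hsp-col : ∀ {M} p k r → 1 < M → (f : List ℕ → ℤ) →
  ∑[ mu ← Box M (suc k ℕ.+ r) ] (⟦ hsp (suc p) (col (suc k) r) mu ⟧ * f mu) ≡ f (col (suc k) r) + f (col k (suc r))
∑-hsp-col {M} p k r 1<M f = begin
  ∑[ mu ← Box M (suc k ℕ.+ r) ] (⟦ hsp (suc p) (col (suc k) r) mu ⟧ * f mu)   ≡⟨ ∑-Box M (k ℕ.+ r) ⟩
  ∑[ m ← upTo M ] ∑[ mu ← Box M (k ℕ.+ r) ] (⟦ (m ≤ᵇ 1) ∧ hsp m (col k r) mu ⟧ * f (m ∷ mu))
    ≡⟨ ∑-upTo-two 1<M _ (λ { zero q _ → ⊥-elim (q refl) ; (suc zero) _ q → ⊥-elim (q refl) ; (suc (suc m)) _ _ → ∑-0 (Box M (k ℕ.+ r)) (λ _ → *-zeroˡ _) }) ⟩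
  ∑[ mu ← Box M (k ℕ.+ r) ] (⟦ hsp 0 (col k r) mu ⟧ * f (0 ∷ mu)) + ∑[ mu ← Box M (k ℕ.+ r) ] (⟦ hsp 1 (col k r) mu ⟧ * f (1 ∷ mu))
    ≡⟨ rest k ⟩
  f (col (suc k) r) + f (col k (suc r)) ∎
  where
  0<M : 0 < M
  0<M = ℕₚ.<-trans (s≤s z≤n) 1<M
  rest : ∀ k → ∑[ mu ← Box M (k ℕ.+ r) ] (⟦ hsp 0 (col k r) mu ⟧ * f (0 ∷ mu)) + ∑[ mu ← Box M (k ℕ.+ r) ] (⟦ hsp 1 (col k r) mu ⟧ * f (1 ∷ mu)) ≡
         f (col (suc k) r) + f (col k (suc r))
  rest zero = trans (cong₂ _+_ (∑-hsp-zeros 0 r 0<M (f ∘ (0 ∷_))) (∑-hsp-zeros 1 r 0<M (f ∘ (1 ∷_)))) (+-comm _ _)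
  rest (suc k) = trans (cong₂ _+_ (∑-0All (Box-All M (suc k ℕ.+ r)) (λ { (m ∷ mu) _ → *-zeroˡ _ ; [] (() , _) }))
    (∑-hsp-col 0 k r 1<M (f ∘ (1 ∷_)))) (+-identityˡ _)

≡ᵇ-cancel : ∀ k x y → (k ℕ.+ x ≡ᵇ k ℕ.+ y) ≡ (x ≡ᵇ y)
≡ᵇ-cancel zero x y = refl
≡ᵇ-cancel (suc k) x y = ≡ᵇ-cancel k x y

schurℤ-col-zero : ∀ n r (β : Vec ℕ n) a → schurℤ (suc n) (col 0 r) (β V.∷ʳ a) ≡ ⟦ 0 ≡ᵇ a ⟧ * schurℤ n (col 0 r) β
schurℤ-col-zero n r β a = begin
  schurℤ (suc n) (col 0 r) (β V.∷ʳ a)   ≡⟨ ssytSum-peel n (col 0 r) β a _ (col-< 0 r (ℕₚ.n<1+n 1)) ⟩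
  ∑[ mu ← Box 2 (length (col 0 r)) ] (kernel 2 (col 0 r) mu a * schurℤ n mu β)
    ≡⟨ cong (λ R → ∑[ mu ← Box 2 R ] (kernel 2 (col 0 r) mu a * schurℤ n mu β)) (col-length 0 r) ⟩
  ∑[ mu ← Box 2 r ] (kernel 2 (col 0 r) mu a * schurℤ n mu β)
    ≡⟨ ∑-cong (Box 2 r) (λ mu → ⟦∧⟧* (hsp 2 (col 0 r) mu) _ _) ⟩
  ∑[ mu ← Box 2 r ] (⟦ hsp 2 (col 0 r) mu ⟧ * (⟦ sum (col 0 r) ≡ᵇ sum mu ℕ.+ a ⟧ * schurℤ n mu β))
    ≡⟨ ∑-hsp-zeros 2 r (s≤s z≤n) _ ⟩
  ⟦ sum (col 0 r) ≡ᵇ sum (col 0 r) ℕ.+ a ⟧ * schurℤ n (col 0 r) β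
    ≡⟨ cong (λ k → ⟦ k ≡ᵇ k ℕ.+ a ⟧ * schurℤ n (col 0 r) β) (col-sum 0 r) ⟩
  ⟦ 0 ≡ᵇ a ⟧ * schurℤ n (col 0 r) β ∎

-- The two strips of `∑-hsp-col` give the two terms of `e_{k+1}(x₁, …, x_{n+1}) = e_{k+1}(x₁, …, xₙ)
-- + x_{n+1} e_k(x₁, …, xₙ)`.
schurℤ-col-suc : ∀ n k r (β : Vec ℕ n) a →
  schurℤ (suc n) (col (suc k) r) (β V.∷ʳ a) ≡ ⟦ 0 ≡ᵇ a ⟧ * schurℤ n (col (suc k) r) β + ⟦ 1 ≡ᵇ a ⟧ * schurℤ n (col k (suc r)) β
schurℤ-col-suc n k r β a = begin
  schurℤ (suc n) (col (suc k) r) (β V.∷ʳ a)   ≡⟨ ssytSum-peel n (col (suc k) r) β a _ (col-< (suc k) r (ℕₚ.n<1+n 1)) ⟩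
  ∑[ mu ← Box 2 (length (col (suc k) r)) ] (kernel 2 (col (suc k) r) mu a * schurℤ n mu β)
    ≡⟨ cong (λ R → ∑[ mu ← Box 2 R ] (kernel 2 (col (suc k) r) mu a * schurℤ n mu β)) (col-length (suc k) r) ⟩
  ∑[ mu ← Box 2 (suc k ℕ.+ r) ] (kernel 2 (col (suc k) r) mu a * schurℤ n mu β)
    ≡⟨ ∑-cong (Box 2 (suc k ℕ.+ r)) (λ mu → ⟦∧⟧* (hsp 2 (col (suc k) r) mu) _ _) ⟩
  ∑[ mu ← Box 2 (suc k ℕ.+ r) ] (⟦ hsp 2 (col (suc k) r) mu ⟧ * (⟦ sum (col (suc k) r) ≡ᵇ sum mu ℕ.+ a ⟧ * schurℤ n mu β))
    ≡⟨ ∑-hsp-col 1 k r (ℕₚ.n<1+n 1) _ ⟩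
  ⟦ sum (col (suc k) r) ≡ᵇ sum (col (suc k) r) ℕ.+ a ⟧ * schurℤ n (col (suc k) r) β + ⟦ sum (col (suc k) r) ≡ᵇ sum (col k (suc r)) ℕ.+ a ⟧ * schurℤ n (col k (suc r)) β
    ≡⟨ cong₂ (λ b c → ⟦ b ⟧ * schurℤ n (col (suc k) r) β + ⟦ c ⟧ * schurℤ n (col k (suc r)) β)
         (trans (cong₂ _≡ᵇ_ (trans (col-sum (suc k) r) (sym (ℕₚ.+-identityʳ _))) (cong (ℕ._+ a) (col-sum (suc k) r))) (≡ᵇ-cancel (suc k) 0 a))
         (trans (cong₂ _≡ᵇ_ (trans (col-sum (suc k) r) (ℕₚ.+-comm 1 k)) (cong (ℕ._+ a) (col-sum k (suc r)))) (≡ᵇ-cancel k 1 a)) ⟩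
  ⟦ 0 ≡ᵇ a ⟧ * schurℤ n (col (suc k) r) β + ⟦ 1 ≡ᵇ a ⟧ * schurℤ n (col k (suc r)) β ∎

fillings-zeros : ∀ r xs → fillings (replicate r 0) xs ≡ replicate r [] ∷ []
fillings-zeros zero xs = refl
fillings-zeros (suc r) xs rewrite fillings-zeros r xs = refl

isSSYT-empty : ∀ r → isSSYTᵇ (replicate r []) ≡ true
isSSYT-empty r = ∧-intro (weak r) (cols r)
  where
  weak : ∀ r → allᵇ rowWeakᵇ (replicate r []) ≡ true
  weak zero = refl
  weak (suc r) = weak r
  cols : ∀ r → colsStrictᵇ (replicate r []) ≡ true
  cols zero = refl
  cols (suc zero) = refl
  cols (suc (suc r)) = cols (suc r)

ssytSum-zeros : ∀ r f → ssytSum 0 (replicate r 0) V.[] f ≡ f (replicate r [])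
ssytSum-zeros r f rewrite fillings-zeros r (range1 0) = trans ∑-[x] (trans (cong (λ b → ⟦ b ∧ true ⟧ * f (replicate r [])) (isSSYT-empty r)) (*-identityˡ _))

one : ∀ {n} → Vec ℕ n → ℤ
one α = ⟦ eqVecᵇ α (V.replicate _ 0) ⟧

-- elementary j k is the k-th elementary symmetric polynomial of x₁, …, x_j.
elementary : ∀ {n} → ℕ → ℕ → Vec ℕ n → ℤ
elementary j zero α = one α
elementary zero (suc k) α = 0ℤ
elementary (suc j) (suc k) α = elementary j (suc k) α + mulVar j (elementary j k) α

elementary-> : ∀ {n} j k → j < k → (α : Vec ℕ n) → elementary j k α ≡ 0ℤ
elementary-> zero (suc k) p α = refl
elementary-> (suc j) (suc k) (s≤s p) α = trans (cong₂ _+_ (elementary-> j (suc k) (ℕₚ.m≤n⇒m≤1+n p) α) (trans (mulVar-cong j (elementary-> j k p) α) (mulVar-0 j α))) (+-identityˡ 0ℤ)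

replicate-∷ʳ : ∀ n (x : ℕ) → V.replicate (suc n) x ≡ V.replicate n x V.∷ʳ x
replicate-∷ʳ zero x = refl
replicate-∷ʳ (suc n) x = cong (x V.∷_) (replicate-∷ʳ n x)

elementary-∷ʳ : ∀ {n} j k → j ≤ n → (β : Vec ℕ n) → ∀ a → elementary j k (β V.∷ʳ a) ≡ ⟦ 0 ≡ᵇ a ⟧ * elementary j k β
elementary-∷ʳ {n} j zero p β a = begin
  ⟦ eqVecᵇ (β V.∷ʳ a) (V.replicate (suc n) 0) ⟧          ≡⟨ cong (λ v → ⟦ eqVecᵇ (β V.∷ʳ a) v ⟧) (replicate-∷ʳ n 0) ⟩
  ⟦ eqVecᵇ (β V.∷ʳ a) (V.replicate n 0 V.∷ʳ 0) ⟧         ≡⟨ cong ⟦_⟧ (trans (eqVec-∷ʳ β _ a 0) (Bₚ.∧-comm _ (a ≡ᵇ 0))) ⟩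
  ⟦ (a ≡ᵇ 0) ∧ eqVecᵇ β (V.replicate n 0) ⟧              ≡⟨ ⟦∧⟧ (a ≡ᵇ 0) _ ⟩
  ⟦ a ≡ᵇ 0 ⟧ * one β                                     ≡⟨ cong (λ b → ⟦ b ⟧ * one β) (≡-of-true (λ q → ≡⇒≡ᵇ (sym (≡ᵇ⇒≡ a 0 q))) (λ q → ≡⇒≡ᵇ (sym (≡ᵇ⇒≡ 0 a q)))) ⟩
  ⟦ 0 ≡ᵇ a ⟧ * one β ∎
elementary-∷ʳ zero (suc k) p β a = sym (*-zeroʳ _)
elementary-∷ʳ (suc j) (suc k) p β a = trans (cong₂ _+_ (elementary-∷ʳ j (suc k) (ℕₚ.<⇒≤ p) β a)
    (trans (mulVar-∷ʳ p (elementary j k) β a) (trans (mulVar-cong j (λ β → elementary-∷ʳ j k (ℕₚ.<⇒≤ p) β a) β) (mulVar-* j _ (elementary j k) β))))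
  (sym (*-distribˡ-+ _ _ _))

-- Both sides satisfy the same recursion in the last variable. The padding `r` varies in the
-- induction because removing the top box leaves one more zero.
schurℤ-col : ∀ n k r (α : Vec ℕ n) → schurℤ n (col k r) α ≡ elementary n k α
schurℤ-col zero zero r V.[] = ssytSum-zeros r _
schurℤ-col zero (suc k) r V.[] = ssytSum-size 0 (col (suc k) r) V.[] _ (λ ())
schurℤ-col (suc n) k r α with V.initLast α
schurℤ-col (suc n) zero r .(β V.∷ʳ a) | β , a , refl =
  trans (schurℤ-col-zero n r β a) (trans (cong (⟦ 0 ≡ᵇ a ⟧ *_) (schurℤ-col n 0 r β)) (sym (elementary-∷ʳ n 0 ℕₚ.≤-refl β a)))
schurℤ-col (suc n) (suc k) r .(β V.∷ʳ a) | β , a , refl = trans (schurℤ-col-suc n k r β a)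
  (cong₂ _+_ (trans (cong (⟦ 0 ≡ᵇ a ⟧ *_) (schurℤ-col n (suc k) r β)) (sym (elementary-∷ʳ n (suc k) ℕₚ.≤-refl β a)))
    (trans (cong (⟦ 1 ≡ᵇ a ⟧ *_) (schurℤ-col n k (suc r) β)) (sym (last-var a))))
  where
  last-var : ∀ a → mulVar n (elementary n k) (β V.∷ʳ a) ≡ ⟦ 1 ≡ᵇ a ⟧ * elementary n k β
  last-var zero = trans (mulVar-last-zero n (elementary n k) β) (sym (*-zeroˡ _))
  last-var (suc a) = trans (mulVar-last-suc n (elementary n k) β a) (elementary-∷ʳ n k ℕₚ.≤-refl β a)

schurℤ-col-ones : ∀ n r → schurℤ n (col n r) (V.replicate n 1) ≡ 1ℤ
schurℤ-col-ones zero r = ssytSum-zeros r _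
schurℤ-col-ones (suc n) r = begin
  schurℤ (suc n) (col (suc n) r) (V.replicate (suc n) 1)        ≡⟨ cong (schurℤ (suc n) (col (suc n) r)) (replicate-∷ʳ n 1) ⟩
  schurℤ (suc n) (col (suc n) r) (V.replicate n 1 V.∷ʳ 1)       ≡⟨ schurℤ-col-suc n n r (V.replicate n 1) 1 ⟩
  0ℤ * _ + 1ℤ * schurℤ n (col n (suc r)) (V.replicate n 1)      ≡⟨ cong₂ _+_ (*-zeroˡ _) (trans (*-identityˡ _) (schurℤ-col-ones n (suc r))) ⟩
  0ℤ + 1ℤ                                                  ≡⟨ +-identityˡ 1ℤ ⟩
  1ℤ ∎

sgn : ℕ → ℤ
sgn zero = 1ℤ
sgn (suc k) = - sgn k

-- altElementary j m = Σ_{k ≤ m} (−1)ᵏ e_k(x₁, …, x_j) (x₁ + ⋯ + xₙ)^{m−k}.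
altElementary : ∀ {n} → ℕ → ℕ → Vec ℕ n → ℤ
altElementary j zero α = one α
altElementary {n} j (suc m) α = mulSum n (altElementary j m) α + sgn (suc m) * elementary j (suc m) α

-- Termwise this is the recursion of `e_k` in the number of variables; the induction on `m` also
-- uses that multiplication by `p` commutes with multiplication by a variable.
altElementary-suc : ∀ {n} j m (α : Vec ℕ n) → altElementary (suc j) (suc m) α ≡ altElementary j (suc m) α + - 1ℤ * mulVar j (altElementary j m) α
altElementary-suc {n} j zero α = lem (mulSum n one α) (elementary j 1 α) (mulVar j one α)
  where
  opaque
    unfolding _+_
    lem : ∀ p a x → p + - 1ℤ * (a + x) ≡ p + - 1ℤ * a + - 1ℤ * x
    lem = solve-∀
altElementary-suc {n} j (suc m) α = begin
  mulSum n (altElementary (suc j) (suc m)) α + - sgn (suc m) * (elementary j (suc (suc m)) α + mulVar j (elementary j (suc m)) α)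
    ≡⟨ cong (_+ - sgn (suc m) * (elementary j (suc (suc m)) α + mulVar j (elementary j (suc m)) α)) (trans (mulSum-cong n (altElementary-suc j m) α)
         (trans (mulSum-+ n (altElementary j (suc m)) _ α) (cong (_+_ (mulSum n (altElementary j (suc m)) α)) (trans (mulSum-* n (- 1ℤ) (mulVar j (altElementary j m)) α) (cong (- 1ℤ *_) (mulSum-mulVar n j (altElementary j m) α)))))) ⟩
  mulSum n (altElementary j (suc m)) α + - 1ℤ * mulVar j (mulSum n (altElementary j m)) α + - sgn (suc m) * (elementary j (suc (suc m)) α + mulVar j (elementary j (suc m)) α)
    ≡⟨ lem (mulSum n (altElementary j (suc m)) α) _ (sgn (suc m)) (elementary j (suc (suc m)) α) _ ⟩
  mulSum n (altElementary j (suc m)) α + - sgn (suc m) * elementary j (suc (suc m)) α + - 1ℤ * (mulVar j (mulSum n (altElementary j m)) α + sgn (suc m) * mulVar j (elementary j (suc m)) α)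
    ≡⟨ cong (λ z → mulSum n (altElementary j (suc m)) α + - sgn (suc m) * elementary j (suc (suc m)) α + - 1ℤ * z)
         (trans (cong (_+_ (mulVar j (mulSum n (altElementary j m)) α)) (sym (mulVar-* j (sgn (suc m)) (elementary j (suc m)) α))) (sym (mulVar-+ j (mulSum n (altElementary j m)) _ α))) ⟩
  mulSum n (altElementary j (suc m)) α + - sgn (suc m) * elementary j (suc (suc m)) α + - 1ℤ * mulVar j (altElementary j (suc m)) α ∎
  where
  opaque
    unfolding _+_
    lem : ∀ p q σ a x → p + - 1ℤ * q + - σ * (a + x) ≡ p + - σ * a + - 1ℤ * (q + σ * x)
    lem = solve-∀

-- Since `e_{j+1}` vanishes in `j` variables, `E(j, j + 1) = p E(j, j)`; so a diagonal step is
-- multiplication by `p − x_{j+1}`, one factor of the product.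
altElementary-diagonal : ∀ {n} j (α : Vec ℕ n) → altElementary (suc j) (suc j) α ≡ mulSum n (altElementary j j) α + - 1ℤ * mulVar j (altElementary j j) α
altElementary-diagonal {n} j α = trans (altElementary-suc j j α) (cong (_+ - 1ℤ * mulVar j (altElementary j j) α)
  (trans (cong (_+_ (mulSum n (altElementary j j) α)) (trans (cong (sgn (suc j) *_) (elementary-> j (suc j) ℕₚ.≤-refl α)) (*-zeroʳ _))) (+-identityʳ _)))

-- Descents.

-- Replaces the local `go` of `rowOf`, which cannot be named here, by `Maybe.map suc`.
rowOf-∷ : ∀ v r t → rowOf v (r ∷ t) ≡ (if memᵇ v r then just 0 else Maybe.map suc (rowOf v t))
rowOf-∷ v r t with memᵇ v r
... | true = refl
... | false with rowOf v t
...   | just k = refl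
...   | nothing = refl

-- A copy of the local `cmp` of `isDescentᵇ`, so that a descent can be rewritten through the rows of
-- its two letters.
ascends : Maybe ℕ → Maybe ℕ → Bool
ascends (just r) (just r') = r <ᵇ r'
ascends _ _ = false

isDescent-rowOf : ∀ t i → isDescentᵇ t i ≡ ascends (rowOf i t) (rowOf (suc i) t)
isDescent-rowOf t i with rowOf i t | rowOf (suc i) t
... | just r | just r' = refl
... | just r | nothing = refl
... | nothing | just r' = refl
... | nothing | nothing = refl

rowOf-ext : ∀ {n v} → v ≤ n → ∀ la {mu t} → Fits n mu t → leqs mu la ≡ true → rowOf v (ext (suc n) la mu t) ≡ rowOf v t
rowOf-ext v≤n [] [] eq = refl
rowOf-ext {n} {v} v≤n (l ∷ la) {m ∷ mu} {r ∷ t} (_ ∷ fits) eq = begin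
  rowOf v ((r ++ replicate (l ∸ m) (suc n)) ∷ ext (suc n) la mu t)
    ≡⟨ rowOf-∷ v (r ++ replicate (l ∸ m) (suc n)) (ext (suc n) la mu t) ⟩
  (if memᵇ v (r ++ replicate (l ∸ m) (suc n)) then just 0 else Maybe.map suc (rowOf v (ext (suc n) la mu t)))
    ≡⟨ cong₂ (λ b x → if b then just 0 else Maybe.map suc x)
         (cong (0 <ᵇ_) (trans (count-++ v r _) (trans (cong (countℕ v r ℕ.+_) (count-replicate-≢ (λ e → ℕₚ.<⇒≢ (s≤s v≤n) (sym e)) (l ∸ m))) (ℕₚ.+-identityʳ _))))
         (rowOf-ext v≤n la fits (proj₂ (∧-true {m ≤ᵇ l} eq))) ⟩
  (if memᵇ v r then just 0 else Maybe.map suc (rowOf v t))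
    ≡⟨ rowOf-∷ v r t ⟨
  rowOf v (r ∷ t) ∎

rowOf-absent : ∀ {n v mu t} → n < v → Fits n mu t → rowOf v t ≡ nothing
rowOf-absent n<v [] = refl
rowOf-absent {n} {v} {t = r ∷ t} n<v ((_ , r≤) ∷ fits) = trans (rowOf-∷ v r t)
  (cong₂ (λ c x → if 0 <ᵇ c then just 0 else Maybe.map suc x) (count-0 (All.map (λ q → ℕₚ.≤-<-trans q n<v) r≤)) (rowOf-absent n<v fits))

allDescents : ℕ → Filling → Bool
allDescents zero t = true
allDescents (suc n) t = allDescents n t ∧ isDescentᵇ t (suc n)

-- Σ_{k ≤ n} (−1)ᵏ [1, …, k − 1 are descents of t], which is 1 or 0 according to
-- the parity of the smallest ascent of t.
alt : ℕ → Filling → ℤ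
alt zero t = 1ℤ
alt (suc n) t = alt n t + sgn (suc n) * ⟦ allDescents n t ⟧

module _ {t t' : Filling} where

  isDescent-cong : ∀ {i} → rowOf i t ≡ rowOf i t' → rowOf (suc i) t ≡ rowOf (suc i) t' → isDescentᵇ t i ≡ isDescentᵇ t' i
  isDescent-cong {i} p q = trans (isDescent-rowOf t i) (trans (cong₂ ascends p q) (sym (isDescent-rowOf t' i)))

  allDescents-cong : ∀ n → (∀ v → v ≤ suc n → rowOf v t ≡ rowOf v t') → allDescents n t ≡ allDescents n t'
  allDescents-cong zero p = refl
  allDescents-cong (suc n) p = cong₂ _∧_ (allDescents-cong n (λ v q → p v (ℕₚ.m≤n⇒m≤1+n q)))
    (isDescent-cong (p (suc n) (ℕₚ.n≤1+n _)) (p (suc (suc n)) ℕₚ.≤-refl))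

  -- The last bracket of `alt n` concerns descents up to `n − 1`, hence rows of letters up to `n`.
  -- This is why `alt n` survives the removal of the letter `n + 1`.
  alt-cong : ∀ n → (∀ v → v ≤ n → rowOf v t ≡ rowOf v t') → alt n t ≡ alt n t'
  alt-cong zero p = refl
  alt-cong (suc n) p = cong₂ (λ x b → x + sgn (suc n) * ⟦ b ⟧) (alt-cong n (λ v q → p v (ℕₚ.m≤n⇒m≤1+n q))) (allDescents-cong n p)

-- Weighted sums over standard tableaux.

ssytSum-cong : ∀ n la (α : Vec ℕ n) {f g} → (∀ t → Fits n la t → f t ≡ g t) → ssytSum n la α f ≡ ssytSum n la α g
ssytSum-cong n la α p = ∑-congAll (fillings-Fits n la) (λ t fits → cong (⟦ isSSYTᵇ t ∧ eqVecᵇ (content n t) α ⟧ *_) (p t fits))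

ssytSum-congᵗ : ∀ n la (α : Vec ℕ n) {f g} → (∀ t → Fits n la t → isSSYTᵇ t ≡ true → eqVecᵇ (content n t) α ≡ true → f t ≡ g t) → ssytSum n la α f ≡ ssytSum n la α g
ssytSum-congᵗ n la α {f} {g} p = ∑-congAll (fillings-Fits n la) step
  where
  step : ∀ t → Fits n la t → ⟦ isSSYTᵇ t ∧ eqVecᵇ (content n t) α ⟧ * f t ≡ ⟦ isSSYTᵇ t ∧ eqVecᵇ (content n t) α ⟧ * g t
  step t fits with isSSYTᵇ t in e₁ | eqVecᵇ (content n t) α in e₂
  ... | true | true = cong (1ℤ *_) (p t fits e₁ e₂)
  ... | true | false = trans (*-zeroˡ _) (sym (*-zeroˡ _))
  ... | false | _ = trans (*-zeroˡ _) (sym (*-zeroˡ _))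

ssytSum-0 : ∀ n la (α : Vec ℕ n) → ssytSum n la α (λ _ → 0ℤ) ≡ 0ℤ
ssytSum-0 n la α = ∑-0 (fillings la (range1 n)) (λ _ → *-zeroʳ _)

ssytSum-+* : ∀ n la (α : Vec ℕ n) c f g → ssytSum n la α (λ t → f t + c * g t) ≡ ssytSum n la α f + c * ssytSum n la α g
ssytSum-+* n la α c f g = trans (∑-cong (fillings la (range1 n)) (λ t → trans (*-distribˡ-+ _ (f t) _) (cong (_+_ _) (*-swapˡ _ c (g t)))))
  (trans (∑-+ (fillings la (range1 n)) _ _) (cong (_+_ _) (∑-*ˡ (fillings la (range1 n)) c _)))

ones : ∀ n → Vec ℕ n
ones n = V.replicate n 1

-- The `a_m(λ)` of the overview: with content `ones n` no entry repeats, so semistandard means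
-- standard.
altSYT : ℕ → List ℕ → ℤ
altSYT n la = ssytSum n la (ones n) (alt n)

hsp⇒leqs : ∀ {p} la mu → hsp p la mu ≡ true → leqs mu la ≡ true
hsp⇒leqs [] [] e = refl
hsp⇒leqs {p} (l ∷ la) (m ∷ mu) e with hsp-∷ p l la m mu e
... | _ , m≤l , e' = ∧-intro (≤⇒≤ᵇ m≤l) (hsp⇒leqs la mu e')

-- With exponent 1 for the last letter the strip is a single box, and `alt n` is unchanged by the
-- peeling; the second summand is the term `k = n + 1` of the alternating sum.
altSYT-suc : ∀ {M} n la → All (_< M) la →
  altSYT (suc n) la ≡ ∑[ mu ← Box M (length la) ] (kernel M la mu 1 * altSYT n mu) +
                 sgn (suc n) * ssytSum (suc n) la (ones (suc n)) (λ t → ⟦ allDescents n t ⟧)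
altSYT-suc {M} n la la<M = trans (ssytSum-+* (suc n) la (ones (suc n)) (sgn (suc n)) (alt n) _)
  (cong (_+ sgn (suc n) * ssytSum (suc n) la (ones (suc n)) (λ t → ⟦ allDescents n t ⟧)) (begin
    ssytSum (suc n) la (ones (suc n)) (alt n)       ≡⟨ cong (λ v → ssytSum (suc n) la v (alt n)) (replicate-∷ʳ n 1) ⟩
    ssytSum (suc n) la (ones n V.∷ʳ 1) (alt n)      ≡⟨ ssytSum-peel n la (ones n) 1 (alt n) la<M ⟩
    ∑[ mu ← Box M (length la) ] (kernel M la mu 1 * ssytSum n mu (ones n) (λ t → alt n (ext (suc n) la mu t)))
      ≡⟨ ∑-cong (Box M (length la)) (λ mu → kernel-true M la mu 1 (λ h _ → ssytSum-cong n mu (ones n) (λ t fits →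
           alt-cong n (λ v v≤n → rowOf-ext v≤n la fits (hsp⇒leqs la mu h))))) ⟩
    ∑[ mu ← Box M (length la) ] (kernel M la mu 1 * altSYT n mu) ∎))

-- Single columns.

nth : List ℕ → ℕ → ℕ
nth [] _ = 0
nth (l ∷ la) zero = l
nth (l ∷ la) (suc i) = nth la i

weaklyDec-tail : ∀ l la → weaklyDecᵇ (l ∷ la) ≡ true → weaklyDecᵇ la ≡ true
weaklyDec-tail l [] wd = refl
weaklyDec-tail l (m ∷ la) wd = proj₂ (∧-true {m ≤ᵇ l} wd)

weaklyDec-head : ∀ l m la → weaklyDecᵇ (l ∷ m ∷ la) ≡ true → m ≤ l
weaklyDec-head l m la wd = ≤ᵇ⇒≤ m l (proj₁ (∧-true {m ≤ᵇ l} wd))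

weaklyDec-zeros : ∀ la → weaklyDecᵇ (0 ∷ la) ≡ true → la ≡ replicate (length la) 0
weaklyDec-zeros [] wd = refl
weaklyDec-zeros (l ∷ la) wd with weaklyDec-head 0 l la wd
... | z≤n = cong (0 ∷_) (weaklyDec-zeros la (weaklyDec-tail 0 (0 ∷ la) wd))

weaklyDec-sum-0 : ∀ la → weaklyDecᵇ (0 ∷ la) ≡ true → sum la ≡ 0
weaklyDec-sum-0 la wd = trans (cong sum (weaklyDec-zeros la wd)) (col-sum 0 (length la))

sum-zeros : ∀ la → sum la ≡ 0 → la ≡ replicate (length la) 0
sum-zeros [] p = refl
sum-zeros (zero ∷ la) p = cong (0 ∷_) (sum-zeros la p)

nth-sum : ∀ la r → weaklyDecᵇ la ≡ true → 0 < nth la r → r < sum la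
nth-sum (l ∷ la) zero wd p = ℕₚ.<-≤-trans p (ℕₚ.m≤m+n l (sum la))
nth-sum (zero ∷ la) (suc r) wd p with nth-sum la r (weaklyDec-tail 0 la wd) p
... | q rewrite weaklyDec-sum-0 la wd with q
...   | ()
nth-sum (suc l ∷ la) (suc r) wd p = s≤s (ℕₚ.≤-trans (nth-sum la r (weaklyDec-tail (suc l) la wd) p) (ℕₚ.m≤n+m (sum la) l))

-- Rows `0, …, r` are all nonempty by decrease, and these `r + 1 ≥ m + 1` rows share only `m + 1`
-- boxes.
column-shape : ∀ m r la → weaklyDecᵇ la ≡ true → sum la ≡ suc m → m ≤ r → 0 < nth la r →
  la ≡ col (suc m) (length la ∸ suc m)
column-shape zero r (zero ∷ la) wd e m≤r p rewrite weaklyDec-sum-0 la wd with e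
... | ()
column-shape zero r (suc zero ∷ la) wd e m≤r p = cong (1 ∷_) (sum-zeros la (ℕₚ.suc-injective e))
column-shape (suc m) (suc r) (l ∷ la) wd e (s≤s m≤r) p
  with nth-sum la r (weaklyDec-tail l la wd) p
column-shape (suc m) (suc r) (zero ∷ la) wd e (s≤s m≤r) p | q
  rewrite weaklyDec-sum-0 la wd with e
... | ()
column-shape (suc m) (suc r) (suc zero ∷ la) wd e (s≤s m≤r) p | q =
  cong (1 ∷_) (column-shape m r la (weaklyDec-tail 1 la wd) (ℕₚ.suc-injective e) m≤r p)
column-shape (suc m) (suc r) (suc (suc l) ∷ la) wd e (s≤s m≤r) p | q = ⊥-elim (ℕₚ.<⇒≢
  (ℕₚ.≤-trans (s≤s (ℕₚ.≤-trans (s≤s m≤r) q)) (s≤s (ℕₚ.m≤n+m (sum la) l))) (sym (ℕₚ.suc-injective e)))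

rowOf-nth : ∀ {n la t} v r → Fits n la t → rowOf v t ≡ just r → 0 < nth la r
rowOf-nth {la = l ∷ la} {row ∷ t} v r ((refl , _) ∷ fits) eq with memᵇ v row in mem | trans (sym (rowOf-∷ v row t)) eq
... | true | refl = nonempty row mem
  where
  nonempty : ∀ xs → memᵇ v xs ≡ true → 0 < length xs
  nonempty (x ∷ xs) _ = s≤s z≤n
... | false | eq' with rowOf v t in eq'' | eq'
...   | just r' | refl = rowOf-nth v r' fits eq''

-- Each descent climbs at least one row; with rows counted from 0, the letter `m + 2` reaches row
-- `m + 1` or higher.
allDescents-rowOf : ∀ m t → allDescents (suc m) t ≡ true → ∃ λ r → rowOf (suc (suc m)) t ≡ just r × suc m ≤ r
allDescents-rowOf m t p with ∧-true {allDescents m t} p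
... | p₁ , p₂ with rowOf (suc m) t in e₁ | rowOf (suc (suc m)) t in e₂ | trans (sym (isDescent-rowOf t (suc m))) p₂
...   | just r | just r' | q = r' , refl , lower m p₁ e₁
  where
  lower : ∀ m → allDescents m t ≡ true → rowOf (suc m) t ≡ just r → suc m ≤ r'
  lower zero _ _ = ℕₚ.≤-<-trans z≤n (<ᵇ⇒< r r' q)
  lower (suc m) p₁ e₁ with allDescents-rowOf m t p₁
  ... | r'' , e , m≤r with trans (sym e) e₁
  ...   | refl = ℕₚ.≤-<-trans m≤r (<ᵇ⇒< r r' q)

allDescents-column : ∀ {n la t} m → Fits n la t → weaklyDecᵇ la ≡ true → sum la ≡ suc m → allDescents m t ≡ true →
  la ≡ col (suc m) (length la ∸ suc m)
allDescents-column {la = la} zero fits wd e p = column-shape 0 0 la wd e z≤n (head-pos la wd e)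
  where
  head-pos : ∀ la → weaklyDecᵇ la ≡ true → sum la ≡ 1 → 0 < nth la 0
  head-pos (zero ∷ la) wd e rewrite weaklyDec-sum-0 la wd with e
  ... | ()
  head-pos (suc l ∷ la) wd e = s≤s z≤n
allDescents-column {la = la} {t} (suc m) fits wd e p =
  let r , q , m≤r = allDescents-rowOf m t p in column-shape (suc m) r la wd e m≤r (rowOf-nth _ r fits q)

concat-zeros : ∀ {n} r {t} → Fits n (replicate r 0) t → concat t ≡ []
concat-zeros zero [] = refl
concat-zeros (suc r) {[] ∷ t} (_ ∷ fits) = concat-zeros r fits

column-increasing : ∀ {n} k r {x t} → Fits n (col k r) t → colsStrictᵇ ((x ∷ []) ∷ t) ≡ true → All (x <_) (concat t)
column-increasing zero r fits e rewrite concat-zeros r fits = []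
column-increasing (suc k) r {x} {(y ∷ []) ∷ t} (_ ∷ fits) e =
  let e₁ , e₂ = ∧-true {strictBelowᵇ (x ∷ []) (y ∷ [])} e
      x<y = <ᵇ⇒< x y (proj₁ (∧-true {x <ᵇ y} e₁))
  in x<y ∷ All.map (ℕₚ.<-trans x<y) (column-increasing k r fits e₂)

count-All : ∀ {P : ℕ → Set} v xs → All P xs → 0 < countℕ v xs → P v
count-All v (x ∷ xs) (p ∷ ps) q with x ≡ᵇ v in eq
... | true rewrite ≡ᵇ⇒≡ x v eq = p
... | false = count-All v xs ps q

rowOf-present : ∀ v t → 0 < countℕ v (concat t) → ∃ λ r → rowOf v t ≡ just r
rowOf-present v (row ∷ t) p with memᵇ v row in mem | rowOf-∷ v row t
... | true | eq = 0 , eq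
... | false | eq with rowOf-present v t (rest (countℕ v row) refl)
  where
  rest : ∀ c → countℕ v row ≡ c → 0 < countℕ v (concat t)
  rest zero q = subst (0 <_) (trans (count-++ v row (concat t)) (cong (ℕ._+ countℕ v (concat t)) q)) p
  rest (suc c) q with trans (sym mem) (cong (0 <ᵇ_) q)
  ... | ()
...   | r , eq' = suc r , trans eq (cong (Maybe.map suc) eq')

-- In a single column the entries increase from row to row, so letters are ordered as their rows
-- are.
column-descents : ∀ {n} k r {t} v w → Fits n (col k r) t → colsStrictᵇ t ≡ true → v < w →
  0 < countℕ v (concat t) → 0 < countℕ w (concat t) → ascends (rowOf v t) (rowOf w t) ≡ true
column-descents zero r {t} v w fits cs v<w pv pw rewrite concat-zeros r fits with pv
... | ()
column-descents (suc k) r {(x ∷ []) ∷ t} v w (_ ∷ fits) cs v<w pv pw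
  rewrite rowOf-∷ v (x ∷ []) t | rowOf-∷ w (x ∷ []) t with x ≡ᵇ v in xv | x ≡ᵇ w in xw
... | true | true = ⊥-elim (ℕₚ.<⇒≢ v<w (trans (sym (≡ᵇ⇒≡ x v xv)) (≡ᵇ⇒≡ x w xw)))
... | true | false with rowOf-present w t pw
...   | b , eq rewrite eq = refl
column-descents (suc k) r {(x ∷ []) ∷ t} v w (_ ∷ fits) cs v<w pv pw | false | true =
  ⊥-elim (ℕₚ.<-asym v<w (subst (_< v) (≡ᵇ⇒≡ x w xw) (count-All v (concat t) (column-increasing k r fits cs) pv)))
column-descents (suc k) r {(x ∷ []) ∷ t} v w (_ ∷ fits) cs v<w pv pw | false | false
  with rowOf-present v t pv | rowOf-present w t pw | column-descents k r v w fits (tail-strict t cs) v<w pv pw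
  where
  tail-strict : ∀ t → colsStrictᵇ ((x ∷ []) ∷ t) ≡ true → colsStrictᵇ t ≡ true
  tail-strict [] _ = refl
  tail-strict (r ∷ t) e = proj₂ (∧-true {strictBelowᵇ (x ∷ []) r} e)
... | b , eq | b' , eq' | lt rewrite eq | eq' = lt

eqVec-ones : ∀ n (h : ℕ → ℕ) → eqVecᵇ (V.tabulate {n = n} (h ∘ toℕ)) (ones n) ≡ true → ∀ i → i < n → h i ≡ 1
eqVec-ones (suc n) h e zero p = ≡ᵇ⇒≡ (h 0) 1 (proj₁ (∧-true {h 0 ≡ᵇ 1} e))
eqVec-ones (suc n) h e (suc i) (s≤s p) = eqVec-ones n (h ∘ suc) (proj₂ (∧-true {h 0 ≡ᵇ 1} e)) i p

column-allDescents : ∀ {n} r {t} m → m < n → Fits n (col n r) t → colsStrictᵇ t ≡ true → eqVecᵇ (content n t) (ones n) ≡ true →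
  allDescents m t ≡ true
column-allDescents r zero p fits cs e = refl
column-allDescents {n} r {t} (suc m) p fits cs e = ∧-intro (column-allDescents r m (ℕₚ.<-trans (ℕₚ.n<1+n m) p) fits cs e)
  (trans (isDescent-rowOf t (suc m)) (column-descents n r (suc m) (suc (suc m)) fits cs ℕₚ.≤-refl (present m (ℕₚ.<-trans (ℕₚ.n<1+n m) p)) (present (suc m) p)))
  where
  present : ∀ i → i < n → 0 < countℕ (suc i) (concat t)
  present i q = subst (0 <_) (sym (eqVec-ones n (λ i → countℕ (suc i) (concat t)) e i q)) (s≤s z≤n)

sum-ones : ∀ n → V.sum (ones n) ≡ n
sum-ones zero = refl
sum-ones (suc n) = cong suc (sum-ones n)

-- Every standard tableau of a single column passes the test, so the weight becomes 1 and the sum is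
-- the coefficient of `x₁ ⋯ x_{m+1}` in `e_{m+1}`.
ssytSum-allDescents-col : ∀ m r → ssytSum (suc m) (col (suc m) r) (ones (suc m)) (λ t → ⟦ allDescents m t ⟧) ≡ 1ℤ
ssytSum-allDescents-col m r = trans (ssytSum-congᵗ (suc m) (col (suc m) r) (ones (suc m)) (λ t fits e₁ e₂ → cong ⟦_⟧
    (column-allDescents r m ℕₚ.≤-refl fits (proj₂ (∧-true {allᵇ rowWeakᵇ t} e₁)) e₂)))
  (schurℤ-col-ones (suc m) r)

-- Completes the evaluation of the correction term as `[λ = 1^{m+1}]`; the number of padding zeros
-- is determined by the length of `la`.
ssytSum-allDescents-≢ : ∀ m la → ¬ la ≡ col (suc m) (length la ∸ suc m) → ssytSum (suc m) la (ones (suc m)) (λ t → ⟦ allDescents m t ⟧) ≡ 0ℤ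
ssytSum-allDescents-≢ m la la≢ with weaklyDecᵇ la in wd | sum la ℕₚ.≟ suc m
... | false | _ = ssytSum-weaklyDec (suc m) la (ones (suc m)) _ wd
... | true | no p = ssytSum-size (suc m) la (ones (suc m)) _ (λ q → p (trans q (sum-ones (suc m))))
... | true | yes p = trans (ssytSum-cong (suc m) la (ones (suc m)) {g = λ _ → 0ℤ} (λ t fits → cong ⟦_⟧ (≢true (λ q →
        la≢ (allDescents-column m fits wd p q))))) (ssytSum-0 (suc m) la (ones (suc m)))

-- Recursion in the number of boxes.

leqs-refl : ∀ la → leqs la la ≡ true
leqs-refl [] = refl
leqs-refl (l ∷ la) = ∧-intro (≤⇒≤ᵇ (ℕₚ.≤-refl {l})) (leqs-refl la)

leqs-sum : ∀ mu la → leqs mu la ≡ true → sum mu ≤ sum la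
leqs-sum [] [] p = z≤n
leqs-sum (m ∷ mu) (l ∷ la) p = let p₁ , p₂ = ∧-true {m ≤ᵇ l} p in ℕₚ.+-mono-≤ (≤ᵇ⇒≤ m l p₁) (leqs-sum mu la p₂)

leqs-antisym : ∀ mu la → leqs mu la ≡ true → sum la ≡ sum mu → mu ≡ la
leqs-antisym [] [] p q = refl
leqs-antisym (m ∷ mu) (l ∷ la) p q with ∧-true {m ≤ᵇ l} p
... | p₁ , p₂ with ℕₚ.m≤n⇒m<n∨m≡n (≤ᵇ⇒≤ m l p₁)
...   | inj₁ m<l = ⊥-elim (ℕₚ.<⇒≢ (ℕₚ.+-mono-<-≤ m<l (leqs-sum mu la p₂)) (sym q))
...   | inj₂ refl = cong (m ∷_) (leqs-antisym mu la p₂ (ℕₚ.+-cancelˡ-≡ m _ _ q))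

∑-leqs-≡ : ∀ {M} la → All (_< M) la → (f : List ℕ → ℤ) →
  ∑[ mu ← Box M (length la) ] (⟦ leqs mu la ∧ (sum la ≡ᵇ sum mu) ⟧ * f mu) ≡ f la
∑-leqs-≡ la la<M f = trans
  (∑-Box-only la la<M _ (λ mu _ mu≢la → trans (cong (λ b → ⟦ b ⟧ * f mu) (≢true (λ p →
    let p₁ , p₂ = ∧-true {leqs mu la} p in mu≢la (leqs-antisym mu la p₁ (≡ᵇ⇒≡ (sum la) _ p₂))))) (*-zeroˡ _)))
  (trans (cong (λ b → ⟦ b ⟧ * f la) (∧-intro (leqs-refl la) (≡⇒≡ᵇ {sum la} refl))) (*-identityˡ _))

-- A sequence below `la` with one box less has first row either one shorter, with all else equal, or
-- unchanged, with the missing box higher up; any other first row loses too many boxes.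
∑-leqs-decs : ∀ {M} la → All (_< M) la → (f : List ℕ → ℤ) →
  ∑[ mu ← Box M (length la) ] (⟦ leqs mu la ∧ (sum la ≡ᵇ suc (sum mu)) ⟧ * f mu) ≡ ∑ (decs la) f
∑-leqs-decs [] [] f = trans ∑-[x] (trans (*-zeroˡ _) (sym ∑-[]))
∑-leqs-decs {M} (zero ∷ la) (p ∷ ps) f = begin
  ∑[ mu ← Box M (suc (length la)) ] (⟦ leqs mu (0 ∷ la) ∧ (sum la ≡ᵇ suc (sum mu)) ⟧ * f mu)   ≡⟨ ∑-Box M (length la) ⟩
  ∑[ m ← upTo M ] ∑[ mu ← Box M (length la) ] (⟦ leqs (m ∷ mu) (0 ∷ la) ∧ (sum la ≡ᵇ suc (m ℕ.+ sum mu)) ⟧ * f (m ∷ mu))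
    ≡⟨ ∑-upTo-only p _ (λ { zero q → ⊥-elim (q refl) ; (suc m) _ → ∑-0 (Box M (length la)) (λ _ → *-zeroˡ _) }) ⟩
  ∑[ mu ← Box M (length la) ] (⟦ leqs mu la ∧ (sum la ≡ᵇ suc (sum mu)) ⟧ * f (0 ∷ mu))   ≡⟨ ∑-leqs-decs la ps (f ∘ (0 ∷_)) ⟩
  ∑ (decs la) (f ∘ (0 ∷_))                                       ≡⟨ +-identityˡ _ ⟨
  0ℤ + ∑ (decs la) (f ∘ (0 ∷_))                                  ≡⟨ cong (_+ ∑ (decs la) (f ∘ (0 ∷_))) ∑-[] ⟨
  ∑ [] f + ∑ (decs la) (f ∘ (0 ∷_))                              ≡⟨ ∑-decs 0 la f ⟨
  ∑ (decs (0 ∷ la)) f ∎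
∑-leqs-decs {M} (suc l ∷ la) (p ∷ ps) f = begin
  ∑[ mu ← Box M (suc (length la)) ] (⟦ leqs mu (suc l ∷ la) ∧ (suc l ℕ.+ sum la ≡ᵇ suc (sum mu)) ⟧ * f mu)   ≡⟨ ∑-Box M (length la) ⟩
  ∑[ m ← upTo M ] g m                                            ≡⟨ ∑-upTo-two p g (λ m q r → ∑-0 (Box M (length la)) (λ mu →
                                                                      trans (cong (λ b → ⟦ b ⟧ * f (m ∷ mu)) (≢true (far m mu q r))) (*-zeroˡ _))) ⟩
  g l + g (suc l)                                                ≡⟨ cong₂ _+_ shorter same ⟩
  f (l ∷ la) + ∑ (decs la) (f ∘ (suc l ∷_))                      ≡⟨ cong (_+ ∑ (decs la) (f ∘ (suc l ∷_))) ∑-[x] ⟨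
  ∑ ((l ∷ la) ∷ []) f + ∑ (decs la) (f ∘ (suc l ∷_))             ≡⟨ ∑-decs (suc l) la f ⟨
  ∑ (decs (suc l ∷ la)) f ∎
  where
  g : ℕ → ℤ
  g m = ∑[ mu ← Box M (length la) ] (⟦ leqs (m ∷ mu) (suc l ∷ la) ∧ (l ℕ.+ sum la ≡ᵇ m ℕ.+ sum mu) ⟧ * f (m ∷ mu))
  far : ∀ m mu → ¬ m ≡ l → ¬ m ≡ suc l → ¬ leqs (m ∷ mu) (suc l ∷ la) ∧ (l ℕ.+ sum la ≡ᵇ m ℕ.+ sum mu) ≡ true
  far m mu q r t with ∧-true {leqs (m ∷ mu) (suc l ∷ la)} t
  ... | t₁ , t₂ with ∧-true {m ≤ᵇ suc l} t₁
  ...   | t₃ , t₄ = ℕₚ.<⇒≢ (ℕₚ.+-mono-<-≤ m<l (leqs-sum mu la t₄)) (sym (≡ᵇ⇒≡ (l ℕ.+ sum la) _ t₂))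
    where
    m<l : m < l
    m<l = ℕₚ.≤∧≢⇒< (ℕₚ.≤-pred (ℕₚ.≤∧≢⇒< (≤ᵇ⇒≤ m (suc l) t₃) r)) q
  shorter : g l ≡ f (l ∷ la)
  shorter = trans (∑-cong (Box M (length la)) (λ mu → cong (λ b → ⟦ b ⟧ * f (l ∷ mu))
      (cong₂ (λ b c → (b ∧ leqs mu la) ∧ c) (≤⇒≤ᵇ (ℕₚ.n≤1+n l)) (≡ᵇ-cancel l (sum la) (sum mu)))))
    (∑-leqs-≡ la ps (f ∘ (l ∷_)))
  same : g (suc l) ≡ ∑ (decs la) (f ∘ (suc l ∷_))
  same = trans (∑-cong (Box M (length la)) (λ mu → cong (λ b → ⟦ b ⟧ * f (suc l ∷ mu))
      (cong₂ (λ b c → (b ∧ leqs mu la) ∧ c) (≤⇒≤ᵇ (ℕₚ.≤-refl {suc l}))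
        (trans (cong (l ℕ.+ sum la ≡ᵇ_) (sym (ℕₚ.+-suc l (sum mu)))) (≡ᵇ-cancel l (sum la) (suc (sum mu)))))))
    (∑-leqs-decs la ps (f ∘ (suc l ∷_)))

-- A strip of one box is `la` minus a box. The factor `hsp` remains, because lowering an arbitrary
-- row may destroy the interlacing.
∑-kernel-1 : ∀ {M} la → All (_< M) la → (f : List ℕ → ℤ) →
  ∑[ mu ← Box M (length la) ] (kernel M la mu 1 * f mu) ≡ ∑[ mu ← decs la ] (⟦ hsp M la mu ⟧ * f mu)
∑-kernel-1 {M} la la<M f = trans (∑-cong (Box M (length la)) (λ mu → trans (cong (λ b → ⟦ b ⟧ * f mu) (bools mu)) (⟦∧⟧* (leqs mu la ∧ (sum la ≡ᵇ suc (sum mu))) _ _)))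
  (∑-leqs-decs la la<M _)
  where
  bools : ∀ mu → hsp M la mu ∧ (sum la ≡ᵇ sum mu ℕ.+ 1) ≡ (leqs mu la ∧ (sum la ≡ᵇ suc (sum mu))) ∧ hsp M la mu
  bools mu rewrite ℕₚ.+-comm (sum mu) 1 with hsp M la mu in eq
  ... | false = sym (Bₚ.∧-zeroʳ _)
  ... | true rewrite hsp⇒leqs la mu eq = sym (Bₚ.∧-identityʳ _)

hsp-refl : ∀ p la → weaklyDecᵇ (p ∷ la) ≡ true → hsp p la la ≡ true
hsp-refl p [] wd = refl
hsp-refl p (l ∷ la) wd = ∧-intro (≤⇒≤ᵇ (weaklyDec-head p l la wd)) (∧-intro (≤⇒≤ᵇ (ℕₚ.≤-refl {l})) (hsp-refl l la (weaklyDec-tail p (l ∷ la) wd)))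

hsp-incs : ∀ p mu → weaklyDecᵇ mu ≡ true → All (λ x → weaklyDecᵇ (p ∷ x) ≡ true → hsp p x mu ≡ true) (incs mu)
hsp-incs p [] wd = []
hsp-incs p (m ∷ mu) wd =
  (λ wd' → ∧-intro (≤⇒≤ᵇ (weaklyDec-head p (suc m) mu wd')) (∧-intro (≤⇒≤ᵇ (ℕₚ.n≤1+n m)) (hsp-refl m mu wd))) ∷
  Allₚ.map⁺ (All.map (λ {x} h wd' → ∧-intro (≤⇒≤ᵇ (weaklyDec-head p m x wd'))
    (∧-intro (≤⇒≤ᵇ (ℕₚ.≤-refl {m})) (h (weaklyDec-tail p (m ∷ x) wd')))) (hsp-incs m mu (weaklyDec-tail m mu wd)))

weaklyDec-∷ : ∀ {p} la → All (_≤ p) la → weaklyDecᵇ la ≡ true → weaklyDecᵇ (p ∷ la) ≡ true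
weaklyDec-∷ [] _ wd = refl
weaklyDec-∷ (l ∷ la) (q ∷ _) wd = ∧-intro (≤⇒≤ᵇ q) wd

-- With fewer boxes than rows some row is empty, hence the last one is. This is how `m < n` makes
-- `Pieri` applicable.
weaklyDec⇒Shape : ∀ {b} la → weaklyDecᵇ (b ∷ la) ≡ true → sum la < length la → Shape b la
weaklyDec⇒Shape (zero ∷ []) wd p = last
weaklyDec⇒Shape (suc l ∷ []) wd (s≤s ())
weaklyDec⇒Shape {b} (l ∷ m ∷ la) wd p = weaklyDec-head b l (m ∷ la) wd ∷ weaklyDec⇒Shape (m ∷ la) wd' (smaller l p wd')
  where
  wd' = weaklyDec-tail b (l ∷ m ∷ la) wd
  smaller : ∀ l → sum (l ∷ m ∷ la) < suc (length (m ∷ la)) → weaklyDecᵇ (l ∷ m ∷ la) ≡ true → sum (m ∷ la) < length (m ∷ la)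
  smaller zero p wd = subst (_< length (m ∷ la)) (sym (weaklyDec-sum-0 (m ∷ la) wd)) (s≤s z≤n)
  smaller (suc l) p wd = ℕₚ.≤-<-trans (ℕₚ.m≤n+m _ l) (ℕₚ.≤-pred p)

altSYT-size : ∀ m la → ¬ sum la ≡ m → altSYT m la ≡ 0ℤ
altSYT-size m la p = ssytSum-size m la (ones m) (alt m) (λ q → p (trans q (sum-ones m)))

-- The factor `altSYT m mu` vanishes unless `mu` is a partition of `m`, and then `m < n` makes it a
-- `Shape`.
altSYT-Shape : ∀ {n} m mu x y → length mu ≡ n → m < n → (Shape m mu → x ≡ y) → altSYT m mu * x ≡ altSYT m mu * y
altSYT-Shape m mu x y len m<n p with weaklyDecᵇ mu in wd | sum mu ℕₚ.≟ m
... | false | _ rewrite ssytSum-weaklyDec m mu (ones m) (alt m) wd = trans (*-zeroˡ x) (sym (*-zeroˡ y))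
... | true | no q rewrite altSYT-size m mu q = trans (*-zeroˡ x) (sym (*-zeroˡ y))
... | true | yes q = cong (altSYT m mu *_) (p (weaklyDec⇒Shape mu
  (weaklyDec-∷ mu (subst (λ k → All (_≤ k) mu) q (All-≤-sum mu)) wd) (subst₂ _<_ (sym q) (sym len) m<n)))

-- Sequences of `n` entries up to `n` hold all partitions of every `m ≤ n`, so all stages of the
-- recursion share one index set.
altSchur : ∀ n → ℕ → Vec ℕ n → ℤ
altSchur n m α = ∑[ la ← Box (suc n) n ] (altSYT m la * schurℤ n la α)

altSchur-zero : ∀ n (α : Vec ℕ n) → altSchur n 0 α ≡ one α
altSchur-zero n α = begin
  ∑[ la ← Box (suc n) n ] (altSYT 0 la * schurℤ n la α)
    ≡⟨ cong (λ R → ∑[ la ← Box (suc n) R ] (altSYT 0 la * schurℤ n la α)) (col-length 0 n) ⟨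
  ∑[ la ← Box (suc n) (length (col 0 n)) ] (altSYT 0 la * schurℤ n la α)
    ≡⟨ ∑-Box-only (col 0 n) (Allₚ.replicate⁺ n (s≤s z≤n)) _ (λ la len la≢ → trans (cong (_* schurℤ n la α)
         (altSYT-size 0 la (λ q → la≢ (trans (sum-zeros la q) (cong (λ k → replicate k 0) (trans len (col-length 0 n))))))) (*-zeroˡ _)) ⟩
  altSYT 0 (col 0 n) * schurℤ n (col 0 n) α   ≡⟨ cong₂ _*_ (ssytSum-zeros n (alt 0)) (schurℤ-col n 0 n α) ⟩
  1ℤ * one α                             ≡⟨ *-identityˡ _ ⟩
  one α ∎

module _ {n m : ℕ} (m<n : m < n) (α : Vec ℕ n) where

  private
    M = suc n
    D : List ℕ → ℤ
    D la = ssytSum (suc m) la (ones (suc m)) (λ t → ⟦ allDescents m t ⟧)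
    F : List ℕ → List ℕ → ℤ
    F mu la = ⟦ hsp M la mu ⟧ * altSYT m mu * schurℤ n la α

  ∑-allDescents : ∑[ la ← Box M n ] (D la * schurℤ n la α) ≡ elementary n (suc m) α
  ∑-allDescents = begin
    ∑[ la ← Box M n ] (D la * schurℤ n la α)
      ≡⟨ cong (λ R → ∑[ la ← Box M R ] (D la * schurℤ n la α)) (sym col-len) ⟩
    ∑[ la ← Box M (length c) ] (D la * schurℤ n la α)
      ≡⟨ ∑-Box-only c (col-< (suc m) (n ∸ suc m) (s≤s (ℕₚ.≤-<-trans z≤n m<n))) _ (λ la len la≢ → trans (cong (_* schurℤ n la α)
           (ssytSum-allDescents-≢ m la (λ q → la≢ (trans q (cong (λ k → col (suc m) (k ∸ suc m)) (trans len col-len)))))) (*-zeroˡ _)) ⟩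
    D c * schurℤ n c α
      ≡⟨ cong₂ _*_ (ssytSum-allDescents-col m (n ∸ suc m)) (schurℤ-col n (suc m) (n ∸ suc m) α) ⟩
    1ℤ * elementary n (suc m) α
      ≡⟨ *-identityˡ _ ⟩
    elementary n (suc m) α ∎
    where
    c = col (suc m) (n ∸ suc m)
    col-len : length c ≡ n
    col-len = trans (col-length (suc m) (n ∸ suc m)) (ℕₚ.m+[n∸m]≡n m<n)

  ∑-kernel-altSYT : ∀ la → length la ≡ n → All (_< M) la →
    ∑[ mu ← Box M (length la) ] (kernel M la mu 1 * altSYT m mu) * schurℤ n la α ≡ ∑[ mu ← decs la ] F mu la
  ∑-kernel-altSYT la len la<M = trans (cong (_* schurℤ n la α) (∑-kernel-1 la la<M (altSYT m))) (sym (∑-*ʳ (decs la) _ _))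

  ∑-F : ∀ mu → length mu ≡ n → All (_< M) mu → ∑[ la ← incs mu ] F mu la ≡ altSYT m mu * mulSum n (schurℤ n mu) α
  ∑-F mu len mu<M = begin
    ∑[ la ← incs mu ] F mu la
      ≡⟨ ∑-congAll (All.zip (hsp-incs-wd , incs-≤ (All.map ℕₚ.≤-pred mu<M))) (λ la (h , la≤) → drop-hsp la h la≤) ⟩
    ∑[ la ← incs mu ] (altSYT m mu * schurℤ n la α)
      ≡⟨ ∑-*ˡ (incs mu) _ _ ⟩
    altSYT m mu * ∑[ la ← incs mu ] schurℤ n la α
      ≡⟨ altSYT-Shape m mu _ _ len m<n (λ sh → sym (Pieri n α sh (s≤s m<n))) ⟩
    altSYT m mu * mulSum n (schurℤ n mu) α ∎
    where
    hsp-incs-wd : All (λ la → weaklyDecᵇ mu ≡ true → weaklyDecᵇ (M ∷ la) ≡ true → hsp M la mu ≡ true) (incs mu)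
    hsp-incs-wd with weaklyDecᵇ mu in wd
    ... | true = All.map (λ h _ → h) (hsp-incs M mu wd)
    ... | false = All.universal (λ _ ()) (incs mu)
    drop-hsp : ∀ la → (weaklyDecᵇ mu ≡ true → weaklyDecᵇ (M ∷ la) ≡ true → hsp M la mu ≡ true) → All (_≤ M) la →
      F mu la ≡ altSYT m mu * schurℤ n la α
    drop-hsp la h la≤ with weaklyDecᵇ mu in wd | weaklyDecᵇ la in wd'
    ... | false | _ rewrite ssytSum-weaklyDec m mu (ones m) (alt m) wd = cong (_* schurℤ n la α) (*-zeroʳ _)
    ... | true | false rewrite ssytSum-weaklyDec n la α (λ _ → 1ℤ) wd' = trans (*-zeroʳ _) (sym (*-zeroʳ _))
    ... | true | true rewrite h refl (weaklyDec-∷ la la≤ wd') = cong (_* schurℤ n la α) (*-identityˡ _)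

  -- The recursion of `altSYT` removes boxes from the larger shape; `∑-incs-decs` turns this into
  -- adding boxes to the smaller one, where Pieri's rule collects the sum.
  altSchur-suc : altSchur n (suc m) α ≡ mulSum n (altSchur n m) α + sgn (suc m) * elementary n (suc m) α
  altSchur-suc = begin
    ∑[ la ← Box M n ] (altSYT (suc m) la * schurℤ n la α)
      ≡⟨ ∑-congAll (Box-All M n) (λ la (len , la<M) → trans (cong (_* schurℤ n la α) (altSYT-suc m la la<M)) (trans (expand _ _ (D la) (schurℤ n la α))
           (cong (_+ sgn (suc m) * (D la * schurℤ n la α)) (∑-kernel-altSYT la len la<M)))) ⟩
    ∑[ la ← Box M n ] (∑[ mu ← decs la ] F mu la + sgn (suc m) * (D la * schurℤ n la α))
      ≡⟨ trans (∑-+ (Box M n) _ _) (cong₂ _+_ main (trans (∑-*ˡ (Box M n) _ _) (cong (sgn (suc m) *_) ∑-allDescents))) ⟩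
    mulSum n (altSchur n m) α + sgn (suc m) * elementary n (suc m) α ∎
    where
    opaque
      unfolding _+_
      expand : ∀ x c d z → (x + c * d) * z ≡ x * z + c * (d * z)
      expand = solve-∀
    -- A nonzero `altSYT m mu` has `sum mu ≡ m`, so the entries of `mu` are at most `m < n` and stay
    -- below `M` when raised.
    large : ∀ mu la → ¬ All (λ k → suc k < M) mu → F mu la ≡ 0ℤ
    large mu la p rewrite altSYT-size m mu (λ q → p (All.map (λ k≤ → s≤s (ℕₚ.≤-<-trans k≤ (subst (_< n) (sym q) m<n))) (All-≤-sum mu))) =
      trans (cong (_* schurℤ n la α) (*-zeroʳ _)) (*-zeroˡ _)
    main : ∑[ la ← Box M n ] ∑[ mu ← decs la ] F mu la ≡ mulSum n (altSchur n m) α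
    main = begin
      ∑[ la ← Box M n ] ∑[ mu ← decs la ] F mu la      ≡⟨ ∑-incs-decs M n F large ⟨
      ∑[ mu ← Box M n ] ∑[ la ← incs mu ] F mu la      ≡⟨ ∑-congAll (Box-All M n) (λ mu (len , mu<M) → ∑-F mu len mu<M) ⟩
      ∑[ mu ← Box M n ] (altSYT m mu * mulSum n (schurℤ n mu) α) ≡⟨ mulSum-∑ n (Box M n) (altSYT m) (schurℤ n) α ⟨
      mulSum n (altSchur n m) α ∎

altSchur≡altElementary : ∀ {n} m → m ≤ n → (α : Vec ℕ n) → altSchur n m α ≡ altElementary n m α
altSchur≡altElementary {n} zero m≤n α = altSchur-zero n α
altSchur≡altElementary {n} (suc m) m<n α = trans (altSchur-suc m<n α) (cong (_+ sgn (suc m) * elementary n (suc m) α) (mulSum-cong n (altSchur≡altElementary m (ℕₚ.<⇒≤ m<n)) α))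

-- The product B n.

pos-sum : ∀ {A : Set} (f : A → ℕ) xs → + sum (map f xs) ≡ ∑[ x ← xs ] (+ f x)
pos-sum f [] = sym ∑-[]
pos-sum f (x ∷ xs) = trans (pos-+ (f x) _) (trans (cong (_+_ (+ f x)) (pos-sum f xs)) (sym ∑-∷))

pos-*P : ∀ {n} (f g : Poly n) α → + (f *P g) α ≡ ∑[ β ← below α ] (+ f β * + g (V.zipWith _∸_ α β))
pos-*P f g α = trans (pos-sum _ (below α)) (∑-cong (below α) (λ β → pos-* (f β) _))

pos-sumP : ∀ {n} (fs : List (Poly n)) α → + sumP fs α ≡ ∑[ f ← fs ] (+ f α)
pos-sumP [] α = sym ∑-[]
pos-sumP (f ∷ fs) α = trans (pos-+ (f α) _) (trans (cong (_+_ (+ f α)) (pos-sumP fs α)) (sym ∑-∷))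

pos-if : ∀ b → + (if b then 1 else 0) ≡ ⟦ b ⟧
pos-if true = refl
pos-if false = refl

∑-below-0 : ∀ {n} (H : Vec ℕ n → ℤ) α →
  ∑[ β ← below α ] (⟦ eqVecᵇ β (V.tabulate (λ _ → 0)) ⟧ * H (V.zipWith _∸_ α β)) ≡ H α
∑-below-0 H V.[] = trans ∑-[x] (*-identityˡ _)
∑-below-0 H (a V.∷ α) = begin
  ∑[ β ← below (a V.∷ α) ] (⟦ eqVecᵇ β (V.tabulate (λ _ → 0)) ⟧ * H (V.zipWith _∸_ (a V.∷ α) β))
    ≡⟨ ∑-cartesian V._∷_ (upTo (suc a)) (below α) ⟩
  ∑[ b ← upTo (suc a) ] ∑[ β ← below α ] (⟦ (b ≡ᵇ 0) ∧ eqVecᵇ β (V.tabulate (λ _ → 0)) ⟧ * H ((a ∸ b) V.∷ V.zipWith _∸_ α β))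
    ≡⟨ ∑-upTo-only (s≤s z≤n) _ (λ { zero q → ⊥-elim (q refl) ; (suc b) _ → ∑-0 (below α) (λ _ → *-zeroˡ _) }) ⟩
  ∑[ β ← below α ] (⟦ eqVecᵇ β (V.tabulate (λ _ → 0)) ⟧ * H (a V.∷ V.zipWith _∸_ α β))
    ≡⟨ ∑-below-0 (λ α → H (a V.∷ α)) α ⟩
  H (a V.∷ α) ∎

unit : ∀ {n} → Fin n → Vec ℕ n
unit i = V.tabulate (λ j → if toℕ j ≡ᵇ toℕ i then 1 else 0)

-- Convolution with a single monomial is a shift; this links `_*P_` to `mulVar`.
∑-below-unit : ∀ {n} (i : Fin n) (H : Vec ℕ n → ℤ) α →
  ∑[ β ← below α ] (⟦ eqVecᵇ β (unit i) ⟧ * H (V.zipWith _∸_ α β)) ≡ mulVar (toℕ i) H α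
∑-below-unit F.zero H (zero V.∷ α) =
  trans (∑-cartesian V._∷_ (upTo 1) (below α)) (trans ∑-[x] (∑-0 (below α) (λ _ → *-zeroˡ _)))
∑-below-unit F.zero H (suc a V.∷ α) = begin
  ∑[ β ← below (suc a V.∷ α) ] (⟦ eqVecᵇ β (unit F.zero) ⟧ * H (V.zipWith _∸_ (suc a V.∷ α) β))
    ≡⟨ ∑-cartesian V._∷_ (upTo (suc (suc a))) (below α) ⟩
  ∑[ b ← upTo (suc (suc a)) ] ∑[ β ← below α ] (⟦ (b ≡ᵇ 1) ∧ eqVecᵇ β (V.tabulate (λ _ → 0)) ⟧ * H ((suc a ∸ b) V.∷ V.zipWith _∸_ α β))
    ≡⟨ ∑-upTo-only {l = 1} (s≤s (s≤s z≤n)) _ (λ { zero q → ∑-0 (below α) (λ _ → *-zeroˡ _) ; (suc zero) q → ⊥-elim (q refl) ; (suc (suc b)) _ → ∑-0 (below α) (λ _ → *-zeroˡ _) }) ⟩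
  ∑[ β ← below α ] (⟦ eqVecᵇ β (V.tabulate (λ _ → 0)) ⟧ * H (a V.∷ V.zipWith _∸_ α β))
    ≡⟨ ∑-below-0 (λ α → H (a V.∷ α)) α ⟩
  H (a V.∷ α) ∎
∑-below-unit (F.suc i) H (a V.∷ α) = begin
  ∑[ β ← below (a V.∷ α) ] (⟦ eqVecᵇ β (unit (F.suc i)) ⟧ * H (V.zipWith _∸_ (a V.∷ α) β))
    ≡⟨ ∑-cartesian V._∷_ (upTo (suc a)) (below α) ⟩
  ∑[ b ← upTo (suc a) ] ∑[ β ← below α ] (⟦ (b ≡ᵇ 0) ∧ eqVecᵇ β (unit i) ⟧ * H ((a ∸ b) V.∷ V.zipWith _∸_ α β))
    ≡⟨ ∑-upTo-only (s≤s z≤n) _ (λ { zero q → ⊥-elim (q refl) ; (suc b) _ → ∑-0 (below α) (λ _ → *-zeroˡ _) }) ⟩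
  ∑[ β ← below α ] (⟦ eqVecᵇ β (unit i) ⟧ * H (a V.∷ V.zipWith _∸_ α β))
    ≡⟨ ∑-below-unit i (λ α → H (a V.∷ α)) α ⟩
  mulVar (toℕ i) (λ α → H (a V.∷ α)) α ∎

pos-sumOver-*P : ∀ {n} (S : Subset n) (g : Poly n) α →
  + (sumOver S *P g) α ≡ ∑[ i ← allFin n ] (⟦ V.lookup S i ⟧ * mulVar (toℕ i) (λ α → + g α) α)
pos-sumOver-*P {n} S g α = begin
  + (sumOver S *P g) α
    ≡⟨ pos-*P (sumOver S) g α ⟩
  ∑[ β ← below α ] (+ sumOver S β * H β)
    ≡⟨ ∑-cong (below α) (λ β → trans (cong (_* H β) (trans (pos-sumP _ β) (∑-map var is))) (sym (∑-*ʳ is (H β) _))) ⟩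
  ∑[ β ← below α ] ∑[ i ← is ] (+ var i β * H β)
    ≡⟨ ∑-swap (below α) is _ ⟩
  ∑[ i ← is ] ∑[ β ← below α ] (+ var i β * H β)
    ≡⟨ ∑-cong is (λ i → trans (∑-cong (below α) (λ β → cong (_* H β) (pos-if (eqVecᵇ β (unit i))))) (∑-below-unit i (λ α → + g α) α)) ⟩
  ∑[ i ← is ] mulVar (toℕ i) (λ α → + g α) α
    ≡⟨ ∑-filter (λ i → V.lookup S i) (allFin n) _ ⟩
  ∑[ i ← allFin n ] (⟦ V.lookup S i ⟧ * mulVar (toℕ i) (λ α → + g α) α) ∎
  where
  H : Vec ℕ n → ℤ
  H β = + g (V.zipWith _∸_ α β)
  is = filterᵇ (λ i → V.lookup S i) (allFin n)

∑-allFin : ∀ n (f : ℕ → ℤ) → ∑[ i ← allFin n ] f (toℕ i) ≡ ∑[ j ← upTo n ] f j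
∑-allFin zero f = trans ∑-[] (sym ∑-[])
∑-allFin (suc n) f = begin
  ∑[ i ← allFin (suc n) ] f (toℕ i)                 ≡⟨ ∑-∷ ⟩
  f 0 + ∑[ i ← tabulate F.suc ] f (toℕ i)
    ≡⟨ cong (λ xs → f 0 + ∑[ i ← xs ] f (toℕ i)) (Lₚ.map-tabulate id F.suc) ⟨
  f 0 + ∑[ i ← map F.suc (allFin n) ] f (toℕ i)     ≡⟨ cong (_+_ (f 0)) (trans (∑-map F.suc (allFin n)) (∑-allFin n (f ∘ suc))) ⟩
  f 0 + ∑[ j ← upTo n ] f (suc j)                   ≡⟨ ∑-upTo-suc n ⟨
  ∑[ j ← upTo (suc n) ] f j ∎

cosingleton : ∀ n → ℕ → Subset n
cosingleton n j = V.tabulate (λ i → not (toℕ i ≡ᵇ j))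

-- The sum of all variables but `x_{j+1}` is `p − x_{j+1}`, which is where integers become
-- necessary.
pos-cosingleton-*P : ∀ {n j} → j < n → (g : Poly n) → ∀ α →
  + (sumOver (cosingleton n j) *P g) α ≡ mulSum n (λ α → + g α) α + - 1ℤ * mulVar j (λ α → + g α) α
pos-cosingleton-*P {n} {j} j<n g α = begin
  + (sumOver (cosingleton n j) *P g) α
    ≡⟨ pos-sumOver-*P (cosingleton n j) g α ⟩
  ∑[ i ← allFin n ] (⟦ V.lookup (cosingleton n j) i ⟧ * x (toℕ i))
    ≡⟨ ∑-cong (allFin n) (λ i → cong (λ b → ⟦ b ⟧ * x (toℕ i)) (Vₚ.lookup∘tabulate _ i)) ⟩
  ∑[ i ← allFin n ] (⟦ not (toℕ i ≡ᵇ j) ⟧ * x (toℕ i))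
    ≡⟨ ∑-allFin n (λ i → ⟦ not (i ≡ᵇ j) ⟧ * x i) ⟩
  ∑[ i ← upTo n ] (⟦ not (i ≡ᵇ j) ⟧ * x i)
    ≡⟨ ∑-cong (upTo n) (λ i → complement (i ≡ᵇ j) (x i)) ⟩
  ∑[ i ← upTo n ] (x i + - 1ℤ * (⟦ i ≡ᵇ j ⟧ * x i))
    ≡⟨ trans (∑-+ (upTo n) _ _) (cong (_+_ (∑ (upTo n) x)) (∑-*ˡ (upTo n) _ _)) ⟩
  ∑ (upTo n) x + - 1ℤ * ∑[ i ← upTo n ] (⟦ i ≡ᵇ j ⟧ * x i)
    ≡⟨ cong (λ z → ∑ (upTo n) x + - 1ℤ * z) (trans
         (∑-upTo-only j<n _ (λ i q → trans (cong (λ b → ⟦ b ⟧ * x i) (≢⇒≡ᵇ q)) (*-zeroˡ _)))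
         (trans (cong (λ b → ⟦ b ⟧ * x j) (≡⇒≡ᵇ {j} refl)) (*-identityˡ _))) ⟩
  mulSum n (λ α → + g α) α + - 1ℤ * x j ∎
  where
  x : ℕ → ℤ
  x i = mulVar i (λ α → + g α) α
  opaque
    unfolding _+_
    complement : ∀ b z → ⟦ not b ⟧ * z ≡ z + - 1ℤ * (⟦ b ⟧ * z)
    complement true = lem
      where
      lem : ∀ z → 0ℤ * z ≡ z + - 1ℤ * (1ℤ * z)
      lem = solve-∀
    complement false = lem
      where
      lem : ∀ z → 1ℤ * z ≡ z + - 1ℤ * (0ℤ * z)
      lem = solve-∀

-- With the factors in the order of `downFrom`, the new factor omits `x_{j+1}` and stands at the
-- head, so each one is a diagonal step of `altElementary`.
pos-prodP : ∀ {n} j → j ≤ n → ∀ α → + prodP (map sumOver (map (cosingleton n) (downFrom j))) α ≡ altElementary {n} j j α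
pos-prodP zero j≤n α = pos-if (eqVecᵇ α (V.replicate _ 0))
pos-prodP {n} (suc j) j<n α = begin
  + (sumOver (cosingleton n j) *P prodP (map sumOver (map (cosingleton n) (downFrom j)))) α
    ≡⟨ pos-cosingleton-*P j<n (prodP (map sumOver (map (cosingleton n) (downFrom j)))) α ⟩
  _ + - 1ℤ * _
    ≡⟨ cong₂ (λ x y → x + - 1ℤ * y) (mulSum-cong n (pos-prodP j (ℕₚ.<⇒≤ j<n)) α) (mulVar-cong j (pos-prodP j (ℕₚ.<⇒≤ j<n)) α) ⟩
  mulSum n (altElementary j j) α + - 1ℤ * mulVar j (altElementary j j) α
    ≡⟨ altElementary-diagonal j α ⟨
  altElementary (suc j) (suc j) α ∎

filterᵇ-map : ∀ {A B : Set} (p : B → Bool) (f : A → B) xs → filterᵇ p (map f xs) ≡ map f (filterᵇ (p ∘ f) xs)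
filterᵇ-map p f [] = refl
filterᵇ-map p f (x ∷ xs) with p (f x)
... | true = cong (f x ∷_) (filterᵇ-map p f xs)
... | false = filterᵇ-map p f xs

filterᵇ-none : ∀ {A : Set} {p : A → Bool} xs → (∀ x → p x ≡ false) → filterᵇ p xs ≡ []
filterᵇ-none [] q = refl
filterᵇ-none {p = p} (x ∷ xs) q rewrite q x = filterᵇ-none xs q

filter-allSubsets : ∀ n (p : Subset (suc n) → Bool) → filterᵇ p (allSubsets (suc n)) ≡
  map (true V.∷_) (filterᵇ (λ S → p (true V.∷ S)) (allSubsets n)) ++ map (false V.∷_) (filterᵇ (λ S → p (false V.∷ S)) (allSubsets n))
filter-allSubsets n p = begin
  filterᵇ p (map (true V.∷_) (allSubsets n) ++ (map (false V.∷_) (allSubsets n) ++ []))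
    ≡⟨ cong (λ xs → filterᵇ p (map (true V.∷_) (allSubsets n) ++ xs)) (Lₚ.++-identityʳ _) ⟩
  filterᵇ p (map (true V.∷_) (allSubsets n) ++ map (false V.∷_) (allSubsets n))
    ≡⟨ Lₚ.filter-++ (Bₚ.T? ∘ p) (map (true V.∷_) (allSubsets n)) _ ⟩
  filterᵇ p (map (true V.∷_) (allSubsets n)) ++ filterᵇ p (map (false V.∷_) (allSubsets n))
    ≡⟨ cong₂ _++_ (filterᵇ-map p (true V.∷_) (allSubsets n)) (filterᵇ-map p (false V.∷_) (allSubsets n)) ⟩
  _ ∎

filter-full : ∀ n → filterᵇ (λ S → ∣ S ∣ ≡ᵇ n) (allSubsets n) ≡ V.tabulate (λ _ → true) ∷ []
filter-full zero = refl
filter-full (suc n) = trans (filter-allSubsets n (λ S → ∣ S ∣ ≡ᵇ suc n)) (cong₂ (λ xs ys → map (true V.∷_) xs ++ map (false V.∷_) ys)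
  (filter-full n) (filterᵇ-none (allSubsets n) (λ S → ≢⇒≡ᵇ (ℕₚ.<⇒≢ (s≤s (∣p∣≤n S))))))

downFrom-suc : ∀ n → downFrom (suc n) ≡ map suc (downFrom n) ++ 0 ∷ []
downFrom-suc zero = refl
downFrom-suc (suc n) = cong (suc n ∷_) (downFrom-suc n)

-- `allSubsets` lists the sets containing the first element before the others, so the set omitting
-- index 0 comes last; hence the descending order.
filter-cosingletons : ∀ n → filterᵇ (λ S → ∣ S ∣ ≡ᵇ n) (allSubsets (suc n)) ≡ map (cosingleton (suc n)) (downFrom (suc n))
filter-cosingletons zero = refl
filter-cosingletons (suc n) = begin
  filterᵇ (λ S → ∣ S ∣ ≡ᵇ suc n) (allSubsets (suc (suc n)))
    ≡⟨ filter-allSubsets (suc n) (λ S → ∣ S ∣ ≡ᵇ suc n) ⟩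
  map (true V.∷_) (filterᵇ (λ S → ∣ S ∣ ≡ᵇ n) (allSubsets (suc n))) ++ map (false V.∷_) (filterᵇ (λ S → ∣ S ∣ ≡ᵇ suc n) (allSubsets (suc n)))
    ≡⟨ cong₂ (λ xs ys → map (true V.∷_) xs ++ map (false V.∷_) ys) (filter-cosingletons n) (filter-full (suc n)) ⟩
  map (true V.∷_) (map (cosingleton (suc n)) (downFrom (suc n))) ++ cosingleton (suc (suc n)) 0 ∷ []
    ≡⟨ cong (_++ cosingleton (suc (suc n)) 0 ∷ []) (trans (sym (Lₚ.map-∘ (downFrom (suc n)))) (Lₚ.map-∘ (downFrom (suc n)))) ⟩
  map (cosingleton (suc (suc n))) (map suc (downFrom (suc n))) ++ map (cosingleton (suc (suc n))) (0 ∷ [])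
    ≡⟨ Lₚ.map-++ (cosingleton (suc (suc n))) (map suc (downFrom (suc n))) (0 ∷ []) ⟨
  map (cosingleton (suc (suc n))) (map suc (downFrom (suc n)) ++ 0 ∷ [])
    ≡⟨ cong (map (cosingleton (suc (suc n)))) (downFrom-suc (suc n)) ⟨
  map (cosingleton (suc (suc n))) (downFrom (suc (suc n))) ∎

pos-B : ∀ n α → + B (suc n) α ≡ altElementary (suc n) (suc n) α
pos-B n α = trans (cong (λ Ss → + prodP (map sumOver Ss) α) (filter-cosingletons n)) (pos-prodP (suc n) ℕₚ.≤-refl α)

-- Parity of the smallest ascent.

if-sgn : ∀ n → sgn n ≡ (if evenᵇ n then 1ℤ else - 1ℤ)
if-sgn zero = refl
if-sgn (suc n) rewrite if-sgn n with evenᵇ n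
... | true = refl
... | false = neg-neg
  where
  opaque
    unfolding _+_
    neg-neg : - (- 1ℤ) ≡ 1ℤ
    neg-neg = refl

even-suc : ∀ n → ⟦ evenᵇ n ⟧ + sgn (suc n) * 1ℤ ≡ ⟦ evenᵇ (suc n) ⟧
even-suc n rewrite if-sgn (suc n) with evenᵇ n
... | true = lem
  where
  opaque
    unfolding _+_
    lem : 1ℤ + - 1ℤ * 1ℤ ≡ 0ℤ
    lem = refl
... | false = trans (+-identityˡ _) (*-identityˡ _)

first-∷ʳ : ∀ (p : ℕ → Bool) xs x →
  firstᵇ p (xs ++ x ∷ []) ≡ Maybe.maybe just (if p x then just x else nothing) (firstᵇ p xs)
first-∷ʳ p [] x = refl
first-∷ʳ p (y ∷ xs) x with p y
... | true = refl
... | false = first-∷ʳ p xs x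

smallestAscent-suc : ∀ n t → smallestAscent (suc n) t ≡
  Maybe.maybe just (if isAscentᵇ t (suc n) then just (suc n) else nothing) (smallestAscent n t)
smallestAscent-suc n t = trans (cong (firstᵇ (isAscentᵇ t)) (range1-∷ʳ n)) (first-∷ʳ (isAscentᵇ t) (range1 n) (suc n))

-- Invariant of the scan: until an ascent appears, the partial sum alternates as `[n even]`; from
-- the first ascent `i` on it is frozen at `[i even]`.
data AscentStatus (n : ℕ) (t : Filling) : Set where
  found   : ∀ i → smallestAscent n t ≡ just i → allDescents n t ≡ false → alt n t ≡ ⟦ evenᵇ i ⟧ → AscentStatus n t
  absent  : smallestAscent n t ≡ nothing → allDescents n t ≡ true → alt n t ≡ ⟦ evenᵇ n ⟧ → AscentStatus n t

ascentStatus : ∀ n t → AscentStatus n t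
ascentStatus zero t = absent refl refl refl
ascentStatus (suc n) t with ascentStatus n t
... | found i p q r = found i (trans (smallestAscent-suc n t) (cong (Maybe.maybe just _) p)) (cong (_∧ isDescentᵇ t (suc n)) q)
      (trans (cong₂ (λ x b → x + sgn (suc n) * ⟦ b ⟧) r q) (trans (cong (_+_ ⟦ evenᵇ i ⟧) (*-zeroʳ _)) (+-identityʳ _)))
... | absent p q r with isDescentᵇ t (suc n) in d
...   | true = absent (trans (smallestAscent-suc n t) (cong₂ (λ b m → Maybe.maybe just (if not b then just (suc n) else nothing) m) d p))
        (∧-intro q d) (trans (cong₂ (λ x b → x + sgn (suc n) * ⟦ b ⟧) r q) (even-suc n))
...   | false = found (suc n) (trans (smallestAscent-suc n t) (cong₂ (λ b m → Maybe.maybe just (if not b then just (suc n) else nothing) m) d p))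
        (trans (cong (allDescents n t ∧_) d) (Bₚ.∧-zeroʳ _)) (trans (cong₂ (λ x b → x + sgn (suc n) * ⟦ b ⟧) r q) (even-suc n))

-- The status `absent` is impossible: the letter after the largest one lies in no row, so the
-- largest letter is an ascent.
smallestAscentEven-alt : ∀ n {la t} → Fits (suc n) la t → ⟦ smallestAscentEvenᵇ (suc n) t ⟧ ≡ alt (suc n) t
smallestAscentEven-alt n {la} {t} fits with ascentStatus (suc n) t
... | absent p q r with trans (sym (proj₂ (∧-true {allDescents n t} q))) (trans (isDescent-rowOf t (suc n)) (no-next (rowOf (suc n) t)))
  where
  no-next : ∀ x → ascends x (rowOf (suc (suc n)) t) ≡ false
  no-next x rewrite rowOf-absent (ℕₚ.n<1+n (suc n)) fits with x
  ... | just _ = refl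
  ... | nothing = refl
...   | ()
smallestAscentEven-alt n {la} {t} fits | found i p q r with smallestAscent (suc n) t | p
... | just .i | refl = sym r

-- Standard tableaux as semistandard tableaux of content 1ⁿ.

fillings-All : ∀ {Q : ℕ → Set} {xs} → All Q xs → ∀ la → All (All (All Q)) (fillings la xs)
fillings-All qs [] = [] ∷ []
fillings-All qs (l ∷ la) =
  Allₚ.concat⁺ (Allₚ.map⁺ (All.map (λ (_ , p) → Allₚ.map⁺ (All.map (p ∷_) (fillings-All qs la))) (listsOf-All qs l)))

rowStrict⇒rowWeak : ∀ r → rowStrictᵇ r ≡ true → rowWeakᵇ r ≡ true
rowStrict⇒rowWeak [] p = refl
rowStrict⇒rowWeak (a ∷ []) p = refl
rowStrict⇒rowWeak (a ∷ b ∷ r) p = let p₁ , p₂ = ∧-true {a <ᵇ b} p in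
  ∧-intro (≤⇒≤ᵇ (ℕₚ.<⇒≤ (<ᵇ⇒< a b p₁))) (rowStrict⇒rowWeak (b ∷ r) p₂)

rowWeak⇒rowStrict : ∀ r → All (λ v → countℕ v r ≤ 1) r → rowWeakᵇ r ≡ true → rowStrictᵇ r ≡ true
rowWeak⇒rowStrict [] c p = refl
rowWeak⇒rowStrict (a ∷ []) c p = refl
rowWeak⇒rowStrict (a ∷ b ∷ r) (c ∷ cs) p = let p₁ , p₂ = ∧-true {a ≤ᵇ b} p in
  ∧-intro (<⇒<ᵇ (ℕₚ.≤∧≢⇒< (≤ᵇ⇒≤ a b p₁) (λ q → twice (subst (λ b → countℕ a (a ∷ b ∷ r) ≤ 1) (sym q) c))))
    (rowWeak⇒rowStrict (b ∷ r) (All.map (λ {v} → ℕₚ.≤-trans (ℕₚ.≤-trans (ℕₚ.m≤n+m _ (if a ≡ᵇ v then 1 else 0))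
      (ℕₚ.≤-reflexive (sym (count-∷ v a (b ∷ r)))))) cs) p₂)
  where
  twice : ¬ countℕ a (a ∷ a ∷ r) ≤ 1
  twice q with subst (_≤ 1) (trans (count-∷ a a (a ∷ r)) (trans (cong ((if a ≡ᵇ a then 1 else 0) ℕ.+_) (count-∷ a a r))
                 (cong (λ b → (if b then 1 else 0) ℕ.+ ((if b then 1 else 0) ℕ.+ countℕ a r)) (≡⇒≡ᵇ {a} refl)))) q
  ... | s≤s ()

rowsWeak≡rowsStrict : ∀ t → All (All (λ v → countℕ v (concat t) ≤ 1)) t → allᵇ rowStrictᵇ t ≡ allᵇ rowWeakᵇ t
rowsWeak≡rowsStrict [] [] = refl
rowsWeak≡rowsStrict (r ∷ t) (c ∷ cs) = cong₂ _∧_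
  (≡-of-true (rowStrict⇒rowWeak r) (rowWeak⇒rowStrict r (All.map (λ {v} → ℕₚ.≤-trans (left v)) c)))
  (rowsWeak≡rowsStrict t (All.map (All.map (λ {v} → ℕₚ.≤-trans (right v))) cs))
  where
  left : ∀ v → countℕ v r ≤ countℕ v (r ++ concat t)
  left v = ℕₚ.≤-trans (ℕₚ.m≤m+n _ _) (ℕₚ.≤-reflexive (sym (count-++ v r (concat t))))
  right : ∀ v → countℕ v (concat t) ≤ countℕ v (r ++ concat t)
  right v = ℕₚ.≤-trans (ℕₚ.m≤n+m _ _) (ℕₚ.≤-reflexive (sym (count-++ v r (concat t))))

all-map : ∀ {A B : Set} (q : B → Bool) (f : A → B) xs → allᵇ q (map f xs) ≡ allᵇ (q ∘ f) xs
all-map q f [] = refl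
all-map q f (x ∷ xs) = cong (q (f x) ∧_) (all-map q f xs)

all-ones : ∀ n (h : ℕ → ℕ) → allᵇ (λ i → h i ≡ᵇ 1) (upTo n) ≡ eqVecᵇ (V.tabulate {n = n} (h ∘ toℕ)) (ones n)
all-ones zero h = refl
all-ones (suc n) h = cong ((h 0 ≡ᵇ 1) ∧_) (trans (cong (allᵇ (λ i → h i ≡ᵇ 1)) (sym (Lₚ.map-upTo suc n)))
  (trans (all-map (λ i → h i ≡ᵇ 1) suc (upTo n)) (all-ones n (h ∘ suc))))

-- Once every letter occurs exactly once, weak and strict rows agree. Positivity of the entries
-- matters because `content` counts only the letters from 1 on.
isSYT≡isSSYT : ∀ n {la t} → Fits n la t → All (All (0 <_)) t → isSYTᵇ n t ≡ isSSYTᵇ t ∧ eqVecᵇ (content n t) (ones n)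
isSYT≡isSSYT n {la} {t} fits pos = begin
  allᵇ (λ v → countℕ v (concat t) ≡ᵇ 1) (range1 n) ∧ (allᵇ rowStrictᵇ t ∧ colsStrictᵇ t)
    ≡⟨ cong (_∧ (allᵇ rowStrictᵇ t ∧ colsStrictᵇ t)) (trans (all-map _ suc (upTo n)) (all-ones n (λ i → countℕ (suc i) (concat t)))) ⟩
  eqVecᵇ (content n t) (ones n) ∧ (allᵇ rowStrictᵇ t ∧ colsStrictᵇ t)
    ≡⟨ under ⟩
  eqVecᵇ (content n t) (ones n) ∧ (allᵇ rowWeakᵇ t ∧ colsStrictᵇ t)
    ≡⟨ Bₚ.∧-comm (eqVecᵇ (content n t) (ones n)) _ ⟩
  isSSYTᵇ t ∧ eqVecᵇ (content n t) (ones n) ∎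
  where
  under : eqVecᵇ (content n t) (ones n) ∧ (allᵇ rowStrictᵇ t ∧ colsStrictᵇ t) ≡
          eqVecᵇ (content n t) (ones n) ∧ (allᵇ rowWeakᵇ t ∧ colsStrictᵇ t)
  under with eqVecᵇ (content n t) (ones n) in eq
  ... | false = refl
  ... | true = cong (_∧ colsStrictᵇ t) (rowsWeak≡rowsStrict t (counts fits pos))
    where
    count-1 : ∀ v → 0 < v → v ≤ n → countℕ v (concat t) ≤ 1
    count-1 (suc v) _ p = ℕₚ.≤-reflexive (eqVec-ones n (λ i → countℕ (suc i) (concat t)) eq v p)
    counts : ∀ {mu u} → Fits n mu u → All (All (0 <_)) u → All (All (λ v → countℕ v (concat t) ≤ 1)) u
    counts [] [] = []
    counts ((_ , p) ∷ fits) (q ∷ pos) = All.map (λ (x , y) → count-1 _ x y) (All.zip (q , p)) ∷ counts fits pos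

pos-aCoeff : ∀ n la → + aCoeff (suc n) la ≡ altSYT (suc n) la
pos-aCoeff n la = trans (length-filter _ (fillings la (range1 (suc n))))
  (∑-congAll (All.zip (fillings-Fits (suc n) la , fillings-All (Allₚ.map⁺ (All.universal (λ _ → s≤s z≤n) (upTo (suc n)))) la))
    (λ t (fits , pos) → trans (⟦∧⟧ (isSYTᵇ (suc n) t) _) (cong₂ _*_ (cong ⟦_⟧ (isSYT≡isSSYT (suc n) fits pos)) (smallestAscentEven-alt n fits))))

pos-schur : ∀ n la α → + schur n la α ≡ schurℤ n la α
pos-schur n la α = trans (length-filter _ (fillings la (range1 n))) (∑-cong (fillings la (range1 n)) (λ t → sym (*-identityʳ _)))

-- Partitions as sequences of fixed length.

-- The split is at the last entry because the padding zeros of a shape are at its end.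
∑-listsOf-∷ʳ : ∀ {A : Set} k (xs : List A) (f : List A → ℤ) →
  ∑ (listsOf (suc k) xs) f ≡ ∑[ x ← xs ] ∑[ l ← listsOf k xs ] f (l ++ x ∷ [])
∑-listsOf-∷ʳ zero xs f = trans (∑-cartesian _∷_ xs ([] ∷ [])) (∑-cong xs (λ x → trans ∑-[x] (sym ∑-[x])))
∑-listsOf-∷ʳ (suc k) xs f = begin
  ∑ (listsOf (suc (suc k)) xs) f                                       ≡⟨ ∑-cartesian _∷_ xs (listsOf (suc k) xs) ⟩
  ∑[ y ← xs ] ∑[ l ← listsOf (suc k) xs ] f (y ∷ l)                    ≡⟨ ∑-cong xs (λ y → ∑-listsOf-∷ʳ k xs (f ∘ (y ∷_))) ⟩
  ∑[ y ← xs ] ∑[ x ← xs ] ∑[ l ← listsOf k xs ] f (y ∷ l ++ x ∷ [])    ≡⟨ ∑-swap xs xs _ ⟩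
  ∑[ x ← xs ] ∑[ y ← xs ] ∑[ l ← listsOf k xs ] f (y ∷ l ++ x ∷ [])    ≡⟨ ∑-cong xs (λ x → sym (∑-cartesian _∷_ xs (listsOf k xs))) ⟩
  ∑[ x ← xs ] ∑[ l ← listsOf (suc k) xs ] f (l ++ x ∷ []) ∎

∑-fillings-∷ʳ0 : ∀ la xs (f : Filling → ℤ) → ∑ (fillings (la ++ 0 ∷ []) xs) f ≡ ∑[ t ← fillings la xs ] f (t ++ [] ∷ [])
∑-fillings-∷ʳ0 [] xs f = trans ∑-[x] (sym ∑-[x])
∑-fillings-∷ʳ0 (l ∷ la) xs f = trans (∑-cartesian _∷_ (listsOf l xs) (fillings (la ++ 0 ∷ []) xs))
  (trans (∑-cong (listsOf l xs) (λ r → ∑-fillings-∷ʳ0 la xs (f ∘ (r ∷_)))) (sym (∑-cartesian _∷_ (listsOf l xs) (fillings la xs))))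

isSSYT-∷ʳ[] : ∀ t → isSSYTᵇ (t ++ [] ∷ []) ≡ isSSYTᵇ t
isSSYT-∷ʳ[] t = cong₂ _∧_ (weak t) (cols t)
  where
  weak : ∀ t → allᵇ rowWeakᵇ (t ++ [] ∷ []) ≡ allᵇ rowWeakᵇ t
  weak [] = refl
  weak (r ∷ t) = cong (rowWeakᵇ r ∧_) (weak t)
  cols : ∀ t → colsStrictᵇ (t ++ [] ∷ []) ≡ colsStrictᵇ t
  cols [] = refl
  cols (r ∷ []) = trans (Bₚ.∧-identityʳ _) (strictBelow-[] r)
  cols (r ∷ r' ∷ t) = cong (strictBelowᵇ r r' ∧_) (cols (r' ∷ t))

concat-∷ʳ[] : ∀ (t : Filling) → concat (t ++ [] ∷ []) ≡ concat t
concat-∷ʳ[] [] = refl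
concat-∷ʳ[] (r ∷ t) = cong (r ++_) (concat-∷ʳ[] t)

rowOf-∷ʳ[] : ∀ v t → rowOf v (t ++ [] ∷ []) ≡ rowOf v t
rowOf-∷ʳ[] v [] = refl
rowOf-∷ʳ[] v (r ∷ t) = trans (rowOf-∷ v r (t ++ [] ∷ [])) (trans
  (cong (λ x → if memᵇ v r then just 0 else Maybe.map suc x) (rowOf-∷ʳ[] v t)) (sym (rowOf-∷ v r t)))

ssytSum-∷ʳ0 : ∀ n la (α : Vec ℕ n) f → (∀ t → f (t ++ [] ∷ []) ≡ f t) → ssytSum n (la ++ 0 ∷ []) α f ≡ ssytSum n la α f
ssytSum-∷ʳ0 n la α f p = trans (∑-fillings-∷ʳ0 la (range1 n) _) (∑-cong (fillings la (range1 n)) (λ t → cong₂ (λ b x → ⟦ b ⟧ * x)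
  (cong₂ (λ b c → b ∧ eqVecᵇ (V.tabulate (λ i → countℕ (suc (toℕ i)) c)) α) (isSSYT-∷ʳ[] t) (concat-∷ʳ[] t)) (p t)))

weaklyDec-positive : ∀ la x → weaklyDecᵇ (la ++ suc x ∷ []) ≡ true → allᵇ (0 <ᵇ_) (la ++ suc x ∷ []) ≡ true
weaklyDec-positive [] x p = refl
weaklyDec-positive (suc l ∷ la) x p = weaklyDec-positive la x (weaklyDec-tail (suc l) (la ++ suc x ∷ []) p)
weaklyDec-positive (zero ∷ []) x ()
weaklyDec-positive (zero ∷ zero ∷ la) x p = weaklyDec-positive (zero ∷ la) x p
weaklyDec-positive (zero ∷ suc l ∷ la) x ()

not-positive : ∀ la → allᵇ (0 <ᵇ_) (la ++ 0 ∷ []) ≡ false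
not-positive [] = refl
not-positive (zero ∷ la) = refl
not-positive (suc l ∷ la) = not-positive la

module _ (n M : ℕ) (F : List ℕ → ℤ)
  (F-∷ʳ0 : ∀ la → F (la ++ 0 ∷ []) ≡ F la)
  (F-size : ∀ la → ¬ sum la ≡ suc n → F la ≡ 0ℤ)
  (F-weaklyDec : ∀ la → weaklyDecᵇ la ≡ false → F la ≡ 0ℤ) where

  private
    part : List ℕ → ℤ
    part la = ⟦ isPartitionOfᵇ (suc n) la ⟧ * F la

  part-∷ʳ0 : ∀ la → part (la ++ 0 ∷ []) ≡ 0ℤ
  part-∷ʳ0 la rewrite not-positive la | Bₚ.∧-zeroʳ (sum (la ++ 0 ∷ []) ≡ᵇ suc n) = *-zeroˡ _

  part-∷ʳsuc : ∀ la x → part (la ++ suc x ∷ []) ≡ F (la ++ suc x ∷ [])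
  part-∷ʳsuc la x = main (la ++ suc x ∷ []) (weaklyDec-positive la x)
    where
    main : ∀ mu → (weaklyDecᵇ mu ≡ true → allᵇ (0 <ᵇ_) mu ≡ true) → part mu ≡ F mu
    main mu p with weaklyDecᵇ mu in wd | sum mu ℕₚ.≟ suc n
    ... | false | _ = trans (cong (_ *_) (F-weaklyDec mu wd)) (trans (*-zeroʳ _) (sym (F-weaklyDec mu wd)))
    ... | true | no q = trans (cong (_ *_) (F-size mu q)) (trans (*-zeroʳ _) (sym (F-size mu q)))
    ... | true | yes q rewrite ≡⇒≡ᵇ q | p refl = *-identityˡ _

  -- Split by the last entry. A final 0 is dropped, leaving a shorter sequence; if the last entry is
  -- positive, decrease makes all of them positive, which accounts for the partitions with exactly
  -- `r + 1` parts. The empty sequence contributes 0, since the size is `suc n`.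
  ∑-Box-partitions : ∀ r → ∑ (Box (suc M) r) F ≡ ∑[ k ← upTo (suc r) ] ∑ (Box (suc M) k) part
  ∑-Box-partitions zero = begin
    ∑ ([] ∷ []) F                     ≡⟨ ∑-[x] ⟩
    F []                              ≡⟨ F-size [] (λ ()) ⟩
    0ℤ                                ≡⟨ *-zeroˡ _ ⟨
    part []                           ≡⟨ ∑-[x] ⟨
    ∑ (Box (suc M) 0) part            ≡⟨ ∑-[x] ⟨
    ∑[ k ← upTo 1 ] ∑ (Box (suc M) k) part ∎
  ∑-Box-partitions (suc r) = begin
    ∑ (Box (suc M) (suc r)) F
      ≡⟨ trans (∑-listsOf-∷ʳ r (upTo (suc M)) F) (∑-upTo-suc M) ⟩
    ∑[ la ← Box (suc M) r ] F (la ++ 0 ∷ []) + ∑[ x ← upTo M ] ∑[ la ← Box (suc M) r ] F (la ++ suc x ∷ [])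
      ≡⟨ cong₂ _+_ (trans (∑-cong (Box (suc M) r) F-∷ʳ0) (∑-Box-partitions r)) positive ⟩
    ∑[ k ← upTo (suc r) ] ∑ (Box (suc M) k) part + ∑ (Box (suc M) (suc r)) part
      ≡⟨ ∑-upTo-last (suc r) ⟨
    ∑[ k ← upTo (suc (suc r)) ] ∑ (Box (suc M) k) part ∎
    where
    positive : ∑[ x ← upTo M ] ∑[ la ← Box (suc M) r ] F (la ++ suc x ∷ []) ≡ ∑ (Box (suc M) (suc r)) part
    positive = begin
      ∑[ x ← upTo M ] ∑[ la ← Box (suc M) r ] F (la ++ suc x ∷ [])      ≡⟨ +-identityˡ _ ⟨
      0ℤ + ∑[ x ← upTo M ] ∑[ la ← Box (suc M) r ] F (la ++ suc x ∷ [])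
        ≡⟨ cong₂ _+_ (sym (∑-0 (Box (suc M) r) part-∷ʳ0)) (∑-cong (upTo M) (λ x → ∑-cong (Box (suc M) r) (λ la → sym (part-∷ʳsuc la x)))) ⟩
      ∑[ la ← Box (suc M) r ] part (la ++ 0 ∷ []) + ∑[ x ← upTo M ] ∑[ la ← Box (suc M) r ] part (la ++ suc x ∷ [])
        ≡⟨ trans (∑-listsOf-∷ʳ r (upTo (suc M)) part) (∑-upTo-suc M) ⟨
      ∑ (Box (suc M) (suc r)) part ∎

∑-partitions : ∀ n (F : List ℕ → ℤ) → (∀ la → F (la ++ 0 ∷ []) ≡ F la) → (∀ la → ¬ sum la ≡ suc n → F la ≡ 0ℤ) →
  (∀ la → weaklyDecᵇ la ≡ false → F la ≡ 0ℤ) → ∑ (partitions (suc n)) F ≡ ∑ (Box (suc (suc n)) (suc n)) F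
∑-partitions n F p q r = begin
  ∑ (partitions (suc n)) F
    ≡⟨ ∑-filter (isPartitionOfᵇ (suc n)) _ F ⟩
  ∑[ la ← concatMap (Box (suc (suc n))) (upTo (suc (suc n))) ] (⟦ isPartitionOfᵇ (suc n) la ⟧ * F la)
    ≡⟨ ∑-concatMap (Box (suc (suc n))) (upTo (suc (suc n))) ⟩
  ∑[ k ← upTo (suc (suc n)) ] ∑[ la ← Box (suc (suc n)) k ] (⟦ isPartitionOfᵇ (suc n) la ⟧ * F la)
    ≡⟨ ∑-Box-partitions n (suc n) F p q r (suc n) ⟨
  ∑ (Box (suc (suc n)) (suc n)) F ∎

-- Comparison of the two expansions.

pos-B-schur : ∀ n (α : Vec ℕ (suc n)) →
  + B (suc n) α ≡ + sumP (map (λ la → scaleP (aCoeff (suc n) la) (schur (suc n) la)) (partitions (suc n))) α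
pos-B-schur n α = begin
  + B (suc n) α                               ≡⟨ pos-B n α ⟩
  altElementary (suc n) (suc n) α                         ≡⟨ altSchur≡altElementary (suc n) ℕₚ.≤-refl α ⟨
  ∑ (Box (suc (suc n)) (suc n)) F
    ≡⟨ ∑-partitions n F
         (λ la → cong₂ _*_ (ssytSum-∷ʳ0 (suc n) la (ones (suc n)) (alt (suc n)) (λ t → alt-cong (suc n) (λ v _ → rowOf-∷ʳ[] v t)))
                           (ssytSum-∷ʳ0 (suc n) la α (λ _ → 1ℤ) (λ _ → refl)))
         (λ la q → trans (cong (_* schurℤ (suc n) la α) (altSYT-size (suc n) la q)) (*-zeroˡ _))
         (λ la wd → trans (cong (_* schurℤ (suc n) la α) (ssytSum-weaklyDec (suc n) la (ones (suc n)) _ wd)) (*-zeroˡ _)) ⟨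
  ∑ (partitions (suc n)) F
    ≡⟨ ∑-cong (partitions (suc n)) (λ la → trans (pos-* (aCoeff (suc n) la) _) (cong₂ _*_ (pos-aCoeff n la) (pos-schur (suc n) la α))) ⟨
  ∑[ la ← partitions (suc n) ] (+ scaleP (aCoeff (suc n) la) (schur (suc n) la) α)
    ≡⟨ trans (pos-sumP _ α) (∑-map _ (partitions (suc n))) ⟨
  + sumP (map (λ la → scaleP (aCoeff (suc n) la) (schur (suc n) la)) (partitions (suc n))) α ∎
  where
  F : List ℕ → ℤ
  F la = altSYT (suc n) la * schurℤ (suc n) la α

theorem3p1 : (n : ℕ) → 2 ≤ n →
    B n ≈P sumP (map (λ la → scaleP (aCoeff n la) (schur n la)) (partitions n))
theorem3p1 (suc n) _ α = ℤₚ.+-injective (pos-B-schur n α)
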